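{- Let $m\geq 2$ and $n\geq 1$ be integers, and suppose that $$v_2\big(\operatorname{tr}(P_{m+1,n})\big)\leq m+1+\frac{3n}{2}.$$ If $P_{m,n}$ is $2$-special, then $P_{m+1,n}$ is also $2$-special.
   Context: Let $a_i=a_i(c)\in\mathbb{Z}[c]$ be defined by $a_0=0$ and $a_i=a_{i-1}^2+c$ (i.e. $a_i=f_c^i(0)$ with $f_c(z)=z^2+c$). $\mu$ is the Möbius function. For $m\geq 2$, $n\geq 1$, $G_{m,n}\in\mathbb{Z}[c]$ is $\prod_{k\mid n}(a_{m+k-1}+a_{m-1})^{\mu(n/k)}$ if $n\nmid m-1$, and $\prod_{k\mid n}(a_{m+k-1}+a_{m-1})^{\mu(n/k)}\prod_{k\mid n}a_k^{ -\mu(n/k)}$ if $n\mid m-1$ (a monic integer polynomial). For a root $\alpha$ of $G_{m,n}$, $\lambda_{m,n}(\alpha)=2^n\prod_{i=0}^{n-1}a_{m+i}(\alpha)$, and $P_{m,n}(x)=\prod_j(x-\lambda_{m,n}(\alpha_j))\in\mathbb{Z}[x]$ over all roots $\alpha_j$ of $G_{m,n}$ with multiplicity. For a monic polynomial $P$, $\operatorname{tr}(P)$ is the sum of its roots. $v_p$ is the $p$-adic valuation on $\mathbb{Z}$ with $v_p(p)=1$. A monic polynomial $P(x)=x^i+A_{i-1}x^{i-1}+\cdots+A_0\in\mathbb{Z}[x]$ is called $p$-special (for a prime $p$) if $v_p(A_{i-1})>v_p(2)$ and $v_p(A_j)>v_p(A_{i-1})$ for all $j=0,1,\ldots,i-2$.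 -}

module Defs where

open import Level using (Level; _⊔_)
open import Data.Bool using (Bool; true; false; if_then_else_; _∧_)
open import Data.Nat as ℕ using (ℕ; zero; suc; _∸_; _/_)
open import Data.Nat.Divisibility using (_∣?_)
open import Data.Nat.Primality using (prime?)
open import Data.Integer as ℤ using (ℤ; +_; -[1+_]; -1ℤ; 1ℤ; 0ℤ)
open import Data.List using (List; []; _∷_; _++_; map; foldr; filter; applyUpTo; upTo; length; concatMap; _∷ʳ_)
open import Data.List.Relation.Unary.All using (All)
open import Data.List.Relation.Unary.Any using (any?)
open import Data.Product using (Σ; _×_; _,_; ∃)
open import Data.Unit.Polymorphic using (⊤)
open import Data.Empty using (⊥)
open import Relation.Nullary using (¬_; does)
open import Relation.Nullary.Decidable using (_×-dec_)
open import Relation.Binary.PropositionalEquality using (_≡_)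
open import Algebra.Bundles using (CommutativeRing)

negOnePow : ℕ → ℤ
negOnePow zero    = 1ℤ
negOnePow (suc k) = ℤ.- negOnePow k

mobius : ℕ → ℤ
mobius zero = 0ℤ
mobius d@(suc _) =
  if does (any? (λ k → (k ℕ.* k) ∣? d) (applyUpTo (2 ℕ.+_) d))
  then 0ℤ
  else negOnePow (length (filter (λ p → prime? p ×-dec (p ∣? d)) (applyUpTo suc d)))

data ℕ∞ : Set where
  fin : ℕ → ℕ∞
  ∞   : ℕ∞

_<∞_ : ℕ∞ → ℕ∞ → Set
fin a <∞ fin b = a ℕ.< b
fin a <∞ ∞     = ⊤
∞     <∞ _     = ⊥

largestPow : ℕ → ℕ → ℕ → ℕ
largestPow p x zero      = 0
largestPow p x (suc k)   = if does ((p ℕ.^ suc k) ∣? x) then suc k else largestPow p x k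

-- v_p(x) = max { k : p^k ∣ x } for x ≠ 0 (for p ≥ 2 this max is ≤ |x|),
-- v_p(0) = ∞.
v : ℕ → ℤ → ℕ∞
v p (+ zero) = ∞
v p x = fin (largestPow p ℤ.∣ x ∣ ℤ.∣ x ∣)

-- p-special.  A monic polynomial x^i + A_{i-1} x^{i-1} + ... + A_0 is
-- represented by the list of its non-leading coefficients  A_0 , ... , A_{i-1}
-- (ascending order; the leading coefficient 1 is implicit).

Special : ℕ → List ℤ → Set
Special p As =
  Σ (List ℤ) λ Bs → Σ ℤ λ top →
    (As ≡ Bs ∷ʳ top) ×
    (v p (+ 2) <∞ v p top) ×
    All (λ B → v p top <∞ v p B) Bs

-- Hypothesis  v_2(t) ≤ m + 1 + 3n/2  (cleared of denominators; v_2(0) = ∞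
-- does not satisfy it).

TraceBound : ℕ → ℕ → ℤ → Set
TraceBound m n t = ∃ λ k → (v 2 t ≡ fin k) × (2 ℕ.* k ℕ.≤ 2 ℕ.* (m ℕ.+ 1) ℕ.+ 3 ℕ.* n)

module OverRing {c ℓ : Level} (K : CommutativeRing c ℓ) where
  open CommutativeRing K

  IsField : Set (c ⊔ ℓ)
  IsField = ¬ (1# ≈ 0#) × (∀ x → ¬ (x ≈ 0#) → Σ Carrier λ y → x * y ≈ 1#)

  fromℕ : ℕ → Carrier
  fromℕ zero    = 0#
  fromℕ (suc n) = 1# + fromℕ n

  fromℤ : ℤ → Carrier
  fromℤ (+ n)    = fromℕ n
  fromℤ -[1+ n ] = - fromℕ (suc n)

  CharZero : Set ℓ
  CharZero = ∀ n → ¬ (fromℕ (suc n) ≈ 0#)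

  pow : Carrier → ℕ → Carrier
  pow x zero    = 1#
  pow x (suc k) = x * pow x k

  -- polynomials over K: ascending coefficient lists
  Poly : Set c
  Poly = List Carrier

  infixl 6 _⊕_
  infixl 7 _⊗_
  _⊕_ : Poly → Poly → Poly
  []      ⊕ q       = q
  (a ∷ p) ⊕ []      = a ∷ p
  (a ∷ p) ⊕ (b ∷ q) = (a + b) ∷ (p ⊕ q)

  _⊗_ : Poly → Poly → Poly
  []      ⊗ q = []
  (a ∷ p) ⊗ q = map (a *_) q ⊕ (0# ∷ (p ⊗ q))

  X : Poly
  X = 0# ∷ 1# ∷ []

  prodP : List Poly → Poly
  prodP = foldr _⊗_ (1# ∷ [])

  _≈P_ : Poly → Poly → Set ℓ
  []      ≈P []      = ⊤
  []      ≈P (b ∷ q) = (b ≈ 0#) × ([] ≈P q)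
  (a ∷ p) ≈P []      = (a ≈ 0#) × (p ≈P [])
  (a ∷ p) ≈P (b ∷ q) = (a ≈ b) × (p ≈P q)

  aPoly : ℕ → Poly
  aPoly zero    = []
  aPoly (suc i) = aPoly i ⊗ aPoly i ⊕ X

  -- a_i(α) = f_α^i(0)
  aVal : Carrier → ℕ → Carrier
  aVal α zero    = 0#
  aVal α (suc i) = aVal α i * aVal α i + α

  -- G_{m,n} = Gnum m n / Gden m n  (the products over k ∣ n with exponent
  -- μ(n/k) = +1 resp. -1, together with the extra factor ∏ a_k^{-μ(n/k)}
  -- when n ∣ m - 1).
  private
    isOne isMinusOne : ℤ → Bool
    isOne e      = does (e ℤ.≟ 1ℤ)
    isMinusOne e = does (e ℤ.≟ -1ℤ)

    numOf denOf : ℕ → ℕ → ℕ → List Poly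
    numOf m n j =
      let k = suc j ; e = mobius (n / k)
          f = aPoly (m ℕ.+ k ∸ 1) ⊕ aPoly (m ∸ 1)
          extra = does (n ∣? (m ∸ 1))
      in (if isOne e then f ∷ [] else []) ++
         (if extra ∧ isMinusOne e then aPoly k ∷ [] else [])
    denOf m n j =
      let k = suc j ; e = mobius (n / k)
          f = aPoly (m ℕ.+ k ∸ 1) ⊕ aPoly (m ∸ 1)
          extra = does (n ∣? (m ∸ 1))
      in (if isMinusOne e then f ∷ [] else []) ++
         (if extra ∧ isOne e then aPoly k ∷ [] else [])

    divisorIdx : ℕ → List ℕ
    divisorIdx n = filter (λ j → suc j ∣? n) (upTo n)

  Gnum Gden : ℕ → ℕ → Poly
  Gnum m n = prodP (concatMap (numOf m n) (divisorIdx n))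
  Gden m n = prodP (concatMap (denOf m n) (divisorIdx n))

  linear : Carrier → Poly
  linear r = (- r) ∷ 1# ∷ []

  -- αs is the list of roots (with multiplicity) of G_{m,n} in K, i.e.
  -- G_{m,n}(c) = ∏_j (c - α_j), written without division as
  -- Gden · ∏_j (c - α_j) = Gnum.
  RootsOfG : ℕ → ℕ → List Carrier → Set ℓ
  RootsOfG m n αs = (Gden m n ⊗ prodP (map linear αs)) ≈P Gnum m n

  lam : ℕ → ℕ → Carrier → Carrier
  lam m n α = pow (1# + 1#) n * foldr _*_ 1# (map (λ i → aVal α (m ℕ.+ i)) (upTo n))

  Pmn : ℕ → ℕ → List Carrier → Poly
  Pmn m n αs = prodP (map (λ α → linear (lam m n α)) αs)

  trP : ℕ → ℕ → List Carrier → Carrier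
  trP m n αs = foldr _+_ 0# (map (lam m n) αs)

  IsIntPoly : List ℤ → Poly → Set ℓ
  IsIntPoly As P = map fromℤ (As ∷ʳ 1ℤ) ≈P P

module Submission where

-- A polynomial in c is studied through its residues at infinity: the trace of h over the roots of F is the residue of
-- h F'/F, and F'/F is additive in F, so power sums over the roots of G_{m,n} are alternating sums of traces over the
-- roots of F_k = a_{m+k-1} + a_{m-1}, k ∣ n (the factors a_k contribute nothing, as a_k divides ∏ a_{m+i}).
-- Modulo F_k the values a_{m-1}, …, a_{m+k-2} satisfy z_i² = z_{i+1} - c cyclically up to a sign, so every word in them
-- reduces to squarefree ones times powers of c; comparing degrees, traces of words of small weight merely double when
-- m increases by 1. By Newton's identities the elementary symmetric functions e_j of the multipliers for m + 1 are then
-- those of P_{m,n}², provided n j ≤ 2^{m-1} - 2, and P_{m,n}² inherits the property from P_{m,n}.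
-- For the other j one uses 2^{nj+1} ∣ e_j: modulo 2, F_k is a power of a_k, so ∏ a_{m+i} is nilpotent, its high power
-- sums are very divisible by 2, and this descends along Graeffe's root squaring to its elementary symmetric functions.
-- The trace bound leaves out finitely many (m, n), where the trace itself is computed and found to be small enough.

open import Defs
open import Level using (_⊔_)
open import Data.Bool.Base using (Bool; true; false; if_then_else_; _∧_) renaming (T to IsTrue)
open import Data.Nat.Base as ℕ using (ℕ; zero; suc; _≤_; _<_; z≤n; s≤s; z<s; s<s; s≤s⁻¹; s<s⁻¹; _∸_; _^_; _!)
open import Data.Nat.Properties as ℕₚ using
  (*-cancelˡ-<; *-cancelˡ-≤; *-monoʳ-≤; *-monoˡ-≤; +-cancelʳ-≤; +-mono-≤; +-monoʳ-<; +-monoʳ-≤; +-monoˡ-≤; 1≤n!; <-cmp; <-irrefl; <-≤-trans; <ᵇ⇒<; <⇒<ᵇ; <⇒≤; <⇒≱; ^-distribˡ-+-*; ^-monoʳ-<; ^-monoʳ-≤; m+[n∸m]≡n; m+n∸m≡n; m+n≮m; m<m+n; m<n⇒m<1+n; m∸n+n≡m; m≤m*n; m≤m+n; m≤n+m; m≤n⇒m<n∨m≡n; m≤n⇒m≤1+n; n<1+n; n≤1+n; ≤-<-trans; ≤-antisym; ≤-refl; ≤-reflexive; ≤-total; ≤-trans; ≮⇒≥; ≰⇒>)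
import Data.Nat.Tactic.RingSolver as ℕSolver
open import Data.Nat.Divisibility using (_∣_; _∣?_; divides; ∣⇒≤)
open import Data.Nat.DivMod using (_/_; m≡m%n+[m/n]*n; m%n<n; m/n*n≡m)
open import Data.Nat.ListAction using (sum)
open import Data.Integer as ℤ using (ℤ; +_; -[1+_]; +[1+_]; 0ℤ; 1ℤ; -1ℤ)
import Data.Integer.Properties as ℤₚ
import Data.Integer.Tactic.RingSolver as ℤSolver
open import Data.Integer.DivMod using (a≡a%n+[a/n]*n; n%d<d)
open import Data.List.Base using (List; []; _∷_; map; take; _++_; concatMap; filter; foldr; length; replicate; upTo; applyUpTo; _∷ʳ_; InitLast; initLast; _∷ʳ′_)
open import Data.List.Properties using (length-map; length-replicate; length-++; map-∘)
open import Data.List.Relation.Binary.Pointwise as Pointwise using (Pointwise; []; _∷_)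
open import Data.List.Relation.Unary.All using (All; []; _∷_)
open import Data.List.Relation.Unary.All.Properties using (all-filter)
open import Data.Maybe.Base using (Maybe; just; nothing)
open import Data.Product using (_×_; _,_; proj₁; proj₂; ∃)
open import Data.Sum using (_⊎_; inj₁; inj₂)
open import Data.Empty using (⊥-elim)
open import Data.Unit.Base using (tt) renaming (⊤ to 𝟙)
open import Function.Base using (_∘_; id)
open import Relation.Nullary using (¬_; Dec; yes; no; does)
open import Relation.Nullary.Decidable using (True; False; toWitness; toWitnessFalse)
open import Relation.Binary.Definitions using (tri<; tri≈; tri>)
open import Relation.Binary.PropositionalEquality as ≡ using (_≡_; cong; cong₂)
open import Algebra.Bundles using (CommutativeRing)
open import Algebra.Morphism.Structures using (module RingMorphisms)
open import Algebra.Solver.Ring.AlmostCommutativeRing using (fromCommutativeRing; _-Raw-AlmostCommutative⟶_)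
import Algebra.Solver.Ring
import Algebra.Properties.Ring
import Algebra.Properties.AbelianGroup
import Algebra.Properties.Semiring.Mult
import Algebra.Properties.CommutativeSemiring.Exp
import Relation.Binary.Reasoning.Setoid

-- Write λ = 2^n u for the multipliers. An integral P_{m,n} shows only that 2^{nj} e_j(u) is an
-- integer; that e_j(u) itself is an integer, and even, has to be extracted from the power sums.
-- Newton's identities alone would lose a factorial, so the u are first squared until their power
-- sums outweigh it, and each squaring is undone by e_j(u)² ≡ e_j(u²) modulo 2, applied to
-- numerators over a common power of 2.
--
-- The trace bound decides between the two estimates. Let τ be the valuation of the trace. If nj ≥
-- τ, divisibility by 2^{nj+1} is enough. If j ≥ 2 and nj < τ, the bound gives nj ≤ m + 3n/2, hence
-- n ≤ 2m and nj ≤ 4m, which lies in the exponential range nj ≤ 2^{m-1} - 2 once m ≥ 6; the finite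
-- list of pairs comes from smaller m.
--
-- Equality in K is not assumed decidable, so polynomials over K have no normal forms and G_{m,n} is
-- never formed by division. It enters only through Gden · ∏ (c - α) = Gnum, and polynomials are
-- compared through their action on sequences.

-- The homomorphism from ℤ to a commutative ring

module IntegerHom {c ℓ} (R : CommutativeRing c ℓ) where
  open CommutativeRing R
  open OverRing R using (fromℕ; fromℤ)
  open Algebra.Properties.Ring ring using (-‿distribˡ-*; -‿distribʳ-*)
  open Algebra.Properties.AbelianGroup +-abelianGroup
    using (⁻¹-involutive; ⁻¹-∙-comm) renaming (ε⁻¹≈ε to -0≈0)
  open Algebra.Properties.Semiring.Mult semiring using (×-homo-+; ×1-homo-*) renaming (_×_ to _·_)
  open Relation.Binary.Reasoning.Setoid setoid

  private
    fromℕ≈× : ∀ n → fromℕ n ≈ n · 1#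
    fromℕ≈× zero    = refl
    fromℕ≈× (suc n) = +-congˡ (fromℕ≈× n)

  fromℕ-+ : ∀ m n → fromℕ (m ℕ.+ n) ≈ fromℕ m + fromℕ n
  fromℕ-+ m n = trans (fromℕ≈× (m ℕ.+ n)) (trans (×-homo-+ 1# m n) (sym (+-cong (fromℕ≈× m) (fromℕ≈× n))))

  fromℕ-* : ∀ m n → fromℕ (m ℕ.* n) ≈ fromℕ m * fromℕ n
  fromℕ-* m n = trans (fromℕ≈× (m ℕ.* n)) (trans (×1-homo-* m n) (sym (*-cong (fromℕ≈× m) (fromℕ≈× n))))

  fromℤ-⊖ : ∀ m n → fromℤ (m ℤ.⊖ n) ≈ fromℕ m - fromℕ n
  fromℤ-⊖ zero    zero    = sym (trans (+-identityˡ _) -0≈0)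
  fromℤ-⊖ zero    (suc n) = sym (+-identityˡ _)
  fromℤ-⊖ (suc m) zero    = sym (trans (+-congˡ -0≈0) (+-identityʳ _))
  fromℤ-⊖ (suc m) (suc n) = begin
    fromℤ (suc m ℤ.⊖ suc n)  ≡⟨ ≡.cong fromℤ (ℤₚ.[1+m]⊖[1+n]≡m⊖n m n) ⟩
    fromℤ (m ℤ.⊖ n)  ≈⟨ fromℤ-⊖ m n ⟩
    fromℕ m - fromℕ n  ≈⟨ +-identityˡ _ ⟨
    0# + (fromℕ m - fromℕ n)  ≈⟨ +-congʳ (-‿inverseʳ 1#) ⟨
    (1# - 1#) + (fromℕ m - fromℕ n)  ≈⟨ +-assoc _ _ _ ⟩
    1# + (- 1# + (fromℕ m - fromℕ n))     ≈⟨ +-congˡ (trans (sym (+-assoc _ _ _)) (trans (+-congʳ (+-comm _ _)) (+-assoc _ _ _))) ⟩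
    1# + (fromℕ m + (- 1# - fromℕ n))     ≈⟨ +-congˡ (+-congˡ (⁻¹-∙-comm _ _)) ⟩
    1# + (fromℕ m - (1# + fromℕ n))  ≈⟨ +-assoc _ _ _ ⟨
    fromℕ (suc m) - fromℕ (suc n)  ∎

  fromℤ-+ : ∀ i j → fromℤ (i ℤ.+ j) ≈ fromℤ i + fromℤ j
  fromℤ-+ (+ m)    (+ n)    = fromℕ-+ m n
  fromℤ-+ (+ m)    -[1+ n ] = fromℤ-⊖ m (suc n)
  fromℤ-+ -[1+ m ] (+ n)    = trans (fromℤ-⊖ n (suc m)) (+-comm _ _)
  fromℤ-+ -[1+ m ] -[1+ n ] = begin
    - fromℕ (suc (suc (m ℕ.+ n)))  ≡⟨ ≡.cong (λ k → - fromℕ (suc k)) (≡.sym (ℕₚ.+-suc m n)) ⟩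
    - fromℕ (suc m ℕ.+ suc n)  ≈⟨ -‿cong (fromℕ-+ (suc m) (suc n)) ⟩
    - (fromℕ (suc m) + fromℕ (suc n))  ≈⟨ ⁻¹-∙-comm _ _ ⟨
    - fromℕ (suc m) - fromℕ (suc n)    ∎

  fromℤ-neg : ∀ i → fromℤ (ℤ.- i) ≈ - fromℤ i
  fromℤ-neg (+ zero)  = sym -0≈0
  fromℤ-neg +[1+ n ]  = refl
  fromℤ-neg -[1+ n ]  = sym (⁻¹-involutive _)

  private
    fromℤ-*-pos : ∀ m j → fromℤ (+ m ℤ.* j) ≈ fromℤ (+ m) * fromℤ j
    fromℤ-*-pos m (+ n)    = trans (reflexive (≡.cong fromℤ (≡.sym (ℤₚ.pos-* m n)))) (fromℕ-* m n)
    fromℤ-*-pos m -[1+ n ] = begin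
      fromℤ (+ m ℤ.* -[1+ n ])  ≡⟨ ≡.cong fromℤ (≡.sym (ℤₚ.neg-distribʳ-* (+ m) (+ suc n))) ⟩
      fromℤ (ℤ.- (+ m ℤ.* + suc n))   ≈⟨ fromℤ-neg (+ m ℤ.* + suc n) ⟩
      - fromℤ (+ m ℤ.* + suc n)  ≈⟨ -‿cong (fromℤ-*-pos m (+ suc n)) ⟩
      - (fromℕ m * fromℕ (suc n))     ≈⟨ -‿distribʳ-* _ _ ⟩
      fromℕ m * - fromℕ (suc n)  ∎

  fromℤ-* : ∀ i j → fromℤ (i ℤ.* j) ≈ fromℤ i * fromℤ j
  fromℤ-* (+ m)    j = fromℤ-*-pos m j
  fromℤ-* -[1+ m ] j = begin
    fromℤ (-[1+ m ] ℤ.* j)  ≡⟨ ≡.cong fromℤ (≡.sym (ℤₚ.neg-distribˡ-* (+ suc m) j)) ⟩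
    fromℤ (ℤ.- (+ suc m ℤ.* j))     ≈⟨ fromℤ-neg (+ suc m ℤ.* j) ⟩
    - fromℤ (+ suc m ℤ.* j)  ≈⟨ -‿cong (fromℤ-*-pos (suc m) j) ⟩
    - (fromℕ (suc m) * fromℤ j)     ≈⟨ -‿distribˡ-* _ _ ⟩
    - fromℕ (suc m) * fromℤ j  ∎

  fromℤ-1 : fromℤ 1ℤ ≈ 1#
  fromℤ-1 = +-identityʳ 1#

  private
    almostCommutativeRing = fromCommutativeRing R

    fromℤ-morphism : ℤ.+-*-rawRing -Raw-AlmostCommutative⟶ almostCommutativeRing
    fromℤ-morphism = record
      { ⟦_⟧ = fromℤ ; +-homo = fromℤ-+ ; *-homo = fromℤ-* ; -‿homo = fromℤ-neg ; 0-homo = refl ; 1-homo = fromℤ-1 }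

    _coeff≟_ : ∀ i j → Maybe (fromℤ i ≈ fromℤ j)
    i coeff≟ j with i ℤ.≟ j
    ... | yes ≡.refl = just refl
    ... | no _       = nothing

  -- Coefficients are integers because the solver has to compare constants, and equality in R need
  -- not be decidable.
  module Solver = Algebra.Solver.Ring ℤ.+-*-rawRing almostCommutativeRing fromℤ-morphism _coeff≟_

-- Polynomials as operators on sequences

module Derivative {c ℓ} (R : CommutativeRing c ℓ) where
  open CommutativeRing R using (0#)
  open OverRing R using (Poly; _⊕_)

  -- From (a + c p)′ = p + c p′, so no integer multiples of coefficients occur.
  deriv : Poly → Poly
  deriv []      = []
  deriv (a ∷ p) = p ⊕ (0# ∷ deriv p)

-- A polynomial acts on sequences by letting the variable act as the shift.  The sequence of
-- coefficients of h/F at infinity is then h acting on that of 1/F.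
module Action {c ℓ c′ ℓ′} (R : CommutativeRing c ℓ) (S : CommutativeRing c′ ℓ′)
  (φ : CommutativeRing.Carrier R → CommutativeRing.Carrier S)
  (φ-hom : RingMorphisms.IsRingHomomorphism (CommutativeRing.rawRing R) (CommutativeRing.rawRing S) φ) where

  private
    module R = CommutativeRing R hiding (_-_)
    module H = RingMorphisms.IsRingHomomorphism φ-hom
  open OverRing R using (Poly; _⊕_; _⊗_; X; _≈P_; aPoly; prodP)
  open Derivative R public
  open CommutativeRing S hiding (zero)
  open Algebra.Properties.AbelianGroup +-abelianGroup using () renaming (ε⁻¹≈ε to -0≈0)
  open Relation.Binary.Reasoning.Setoid setoid
  open IntegerHom S using (module Solver)

  Seq : Set c′
  Seq = ℕ → Carrier

  infix 4 _≐_
  _≐_ : Seq → Seq → Set ℓ′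
  y ≐ z = ∀ n → y n ≈ z n

  act : Poly → Seq → Seq
  act []      y n = 0#
  act (a ∷ p) y n = φ a * y n + act p (y ∘ suc) n

  act-cong : ∀ p {y z} → y ≐ z → act p y ≐ act p z
  act-cong []      e n = refl
  act-cong (a ∷ p) e n = +-cong (*-congˡ (e n)) (act-cong p (e ∘ suc) n)

  act-suc : ∀ p y n → act p (y ∘ suc) n ≈ act p y (suc n)
  act-suc []      y n = refl
  act-suc (a ∷ p) y n = +-congˡ (act-suc p (y ∘ suc) n)

  act-zero : ∀ p {y} → (∀ n → y n ≈ 0#) → ∀ n → act p y n ≈ 0#
  act-zero []      e n = refl
  act-zero (a ∷ p) e n = trans (+-cong (trans (*-congˡ (e n)) (zeroʳ _)) (act-zero p (e ∘ suc) n)) (+-identityˡ _)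

  act-+ : ∀ p y z → act p (λ n → y n + z n) ≐ (λ n → act p y n + act p z n)
  act-+ []      y z n = sym (+-identityˡ _)
  act-+ (a ∷ p) y z n = trans (+-congˡ (act-+ p _ _ n))
    (solve 5 (λ a y z u v → a :* (y :+ z) :+ (u :+ v) := (a :* y :+ u) :+ (a :* z :+ v)) refl _ _ _ _ _)
    where open Solver

  act-scale : ∀ p s y → act p (λ n → s * y n) ≐ (λ n → s * act p y n)
  act-scale []      s y n = sym (zeroʳ s)
  act-scale (a ∷ p) s y n = trans (+-congˡ (act-scale p s _ n))
    (solve 4 (λ a s y u → a :* (s :* y) :+ s :* u := s :* (a :* y :+ u)) refl _ _ _ _)
    where open Solver

  act-neg : ∀ p y → act p (λ n → - y n) ≐ (λ n → - act p y n)
  act-neg []      y n = sym -0≈0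
  act-neg (a ∷ p) y n = trans (+-congˡ (act-neg p _ n))
    (solve 3 (λ a y u → a :* (:- y) :+ (:- u) := :- (a :* y :+ u)) refl _ _ _)
    where open Solver

  act-⊕ : ∀ p q y → act (p ⊕ q) y ≐ (λ n → act p y n + act q y n)
  act-⊕ []      q       y n = sym (+-identityˡ _)
  act-⊕ (a ∷ p) []      y n = sym (+-identityʳ _)
  act-⊕ (a ∷ p) (b ∷ q) y n = trans (+-cong (*-congʳ (H.+-homo a b)) (act-⊕ p q _ n))
    (solve 5 (λ a b y u v → (a :+ b) :* y :+ (u :+ v) := (a :* y :+ u) :+ (b :* y :+ v)) refl _ _ _ _ _)
    where open Solver

  act-map-* : ∀ a p y → act (map (a R.*_) p) y ≐ (λ n → φ a * act p y n)
  act-map-* a []      y n = sym (zeroʳ _)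
  act-map-* a (b ∷ p) y n = trans (+-cong (*-congʳ (H.*-homo a b)) (act-map-* a p _ n))
    (solve 4 (λ a b y u → a :* b :* y :+ a :* u := a :* (b :* y :+ u)) refl _ _ _ _)
    where open Solver

  act-map-neg : ∀ p y → act (map (R.-_) p) y ≐ (λ n → - act p y n)
  act-map-neg []      y n = sym -0≈0
  act-map-neg (b ∷ p) y n = trans (+-cong (*-congʳ (H.-‿homo b)) (act-map-neg p _ n))
    (solve 3 (λ b y u → (:- b) :* y :+ (:- u) := :- (b :* y :+ u)) refl _ _ _)
    where open Solver

  act-0∷ : ∀ p y n → act (R.0# ∷ p) y n ≈ act p (y ∘ suc) n
  act-0∷ p y n = trans (+-congʳ (trans (*-congʳ H.0#-homo) (zeroˡ _))) (+-identityˡ _)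

  act-⊗ : ∀ p q y → act (p ⊗ q) y ≐ act p (act q y)
  act-⊗ []      q y n = refl
  act-⊗ (a ∷ p) q y n = begin
    act (map (a R.*_) q ⊕ (R.0# ∷ (p ⊗ q))) y n  ≈⟨ act-⊕ (map (a R.*_) q) _ y n ⟩
    act (map (a R.*_) q) y n + act (R.0# ∷ (p ⊗ q)) y n
      ≈⟨ +-cong (act-map-* a q y n) (trans (act-0∷ (p ⊗ q) y n) (trans (act-⊗ p q _ n) (act-cong p (act-suc q y) n))) ⟩
    φ a * act q y n + act p (act q y ∘ suc) n  ∎

  act-comm : ∀ p q y → act p (act q y) ≐ act q (act p y)
  act-comm []      q y n = sym (act-zero q (λ _ → refl) n)
  act-comm (a ∷ p) q y n = begin
    φ a * act q y n + act p (act q y ∘ suc) n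
      ≈⟨ +-cong (sym (act-scale q (φ a) y n)) (trans (act-cong p (λ i → sym (act-suc q y i)) n) (act-comm p q _ n)) ⟩
    act q (λ i → φ a * y i) n + act q (act p (y ∘ suc)) n  ≈⟨ act-+ q _ _ n ⟨
    act q (act (a ∷ p) y) n  ∎

  act-1 : ∀ y → act (R.1# ∷ []) y ≐ y
  act-1 y n = trans (+-identityʳ _) (trans (*-congʳ H.1#-homo) (*-identityˡ _))

  act-X : ∀ y → act X y ≐ y ∘ suc
  act-X y n = trans (act-0∷ (R.1# ∷ []) y n) (act-1 (y ∘ suc) n)

  act-≈0 : ∀ {p} → [] ≈P p → ∀ y n → act p y n ≈ 0#
  act-≈0 {[]}    e       y n = refl
  act-≈0 {a ∷ p} (e , f) y n = trans (+-cong (trans (*-congʳ (trans (H.⟦⟧-cong e) H.0#-homo)) (zeroˡ _)) (act-≈0 f _ n)) (+-identityˡ _)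

  []≈P-sym : ∀ {p} → p ≈P [] → [] ≈P p
  []≈P-sym {[]}    e       = _
  []≈P-sym {a ∷ p} (e , f) = e , []≈P-sym f

  act-≈P : ∀ {p q} → p ≈P q → ∀ y → act p y ≐ act q y
  act-≈P {[]}    {q}     e       y n = sym (act-≈0 {q} e y n)
  act-≈P {a ∷ p} {[]}    e       y n = act-≈0 {a ∷ p} ([]≈P-sym {a ∷ p} e) y n
  act-≈P {a ∷ p} {b ∷ q} (e , f) y n = +-cong (*-congʳ (H.⟦⟧-cong e)) (act-≈P f _ n)

  -- Polynomials modulo those that annihilate every sequence satisfying M.
  module Quotient {m} (M : Seq → Set m) (closed : ∀ p {y} → M y → M (act p y)) where

    infix 4 _≈M_
    record _≈M_ (p q : Poly) : Set (c ⊔ c′ ⊔ ℓ′ ⊔ m) where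
      constructor acts
      field on : ∀ {y} → M y → act p y ≐ act q y
    open _≈M_ public

    private
      ≈M-refl : ∀ {p} → p ≈M p
      ≈M-refl = acts λ _ _ → refl

      ≈M-sym : ∀ {p q} → p ≈M q → q ≈M p
      ≈M-sym e = acts λ My n → sym (on e My n)

      ≈M-trans : ∀ {p q r} → p ≈M q → q ≈M r → p ≈M r
      ≈M-trans e f = acts λ My n → trans (on e My n) (on f My n)

      ⊕-cong : ∀ {p q r s} → p ≈M q → r ≈M s → p ⊕ r ≈M q ⊕ s
      ⊕-cong {p} {q} {r} {s} e f = acts λ {y} My n →
        trans (act-⊕ p r y n) (trans (+-cong (on e My n) (on f My n)) (sym (act-⊕ q s y n)))

      ⊕-assoc : ∀ p q r → (p ⊕ q) ⊕ r ≈M p ⊕ (q ⊕ r)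
      ⊕-assoc p q r = acts λ {y} My n → trans (act-⊕ (p ⊕ q) r y n) (trans (+-congʳ (act-⊕ p q y n))
        (trans (+-assoc _ _ _) (sym (trans (act-⊕ p (q ⊕ r) y n) (+-congˡ (act-⊕ q r y n))))))

      ⊕-comm : ∀ p q → p ⊕ q ≈M q ⊕ p
      ⊕-comm p q = acts λ {y} My n → trans (act-⊕ p q y n) (trans (+-comm _ _) (sym (act-⊕ q p y n)))

      ⊕-inverseˡ : ∀ p → map (R.-_) p ⊕ p ≈M []
      ⊕-inverseˡ p = acts λ {y} My n → trans (act-⊕ (map (R.-_) p) p y n) (trans (+-congʳ (act-map-neg p y n)) (-‿inverseˡ _))

      neg-cong : ∀ {p q} → p ≈M q → map (R.-_) p ≈M map (R.-_) q
      neg-cong {p} {q} e = acts λ {y} My n → trans (act-map-neg p y n) (trans (-‿cong (on e My n)) (sym (act-map-neg q y n)))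

      ⊗-cong : ∀ {p q r s} → p ≈M q → r ≈M s → p ⊗ r ≈M q ⊗ s
      ⊗-cong {p} {q} {r} {s} e f = acts λ {y} My n →
        trans (act-⊗ p r y n) (trans (act-cong p (on f My) n) (trans (on e (closed s My) n) (sym (act-⊗ q s y n))))

      ⊗-comm : ∀ p q → p ⊗ q ≈M q ⊗ p
      ⊗-comm p q = acts λ {y} My n → trans (act-⊗ p q y n) (trans (act-comm p q y n) (sym (act-⊗ q p y n)))

      ⊗-assoc : ∀ p q r → (p ⊗ q) ⊗ r ≈M p ⊗ (q ⊗ r)
      ⊗-assoc p q r = acts λ {y} My n → begin
        act ((p ⊗ q) ⊗ r) y n  ≈⟨ act-⊗ (p ⊗ q) r y n ⟩
        act (p ⊗ q) (act r y) n     ≈⟨ act-⊗ p q _ n ⟩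
        act p (act q (act r y)) n   ≈⟨ act-cong p (act-⊗ q r y) n ⟨
        act p (act (q ⊗ r) y) n     ≈⟨ act-⊗ p (q ⊗ r) y n ⟨
        act (p ⊗ (q ⊗ r)) y n  ∎

      ⊗-identityˡ : ∀ p → (R.1# ∷ []) ⊗ p ≈M p
      ⊗-identityˡ p = acts λ {y} My n → trans (act-⊗ (R.1# ∷ []) p y n) (act-1 (act p y) n)

      ⊗-distribʳ : ∀ p q r → (q ⊕ r) ⊗ p ≈M (q ⊗ p) ⊕ (r ⊗ p)
      ⊗-distribʳ p q r = acts λ {y} My n → begin
        act ((q ⊕ r) ⊗ p) y n  ≈⟨ act-⊗ (q ⊕ r) p y n ⟩
        act (q ⊕ r) (act p y) n  ≈⟨ act-⊕ q r _ n ⟩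
        act q (act p y) n + act r (act p y) n    ≈⟨ +-cong (act-⊗ q p y n) (act-⊗ r p y n) ⟨
        act (q ⊗ p) y n + act (r ⊗ p) y n  ≈⟨ act-⊕ (q ⊗ p) (r ⊗ p) y n ⟨
        act ((q ⊗ p) ⊕ (r ⊗ p)) y n  ∎

    -- With equality read off the action, the ring laws are identities between commuting operators
    -- and no coefficient lists are compared. The ring solver becomes available, modulo a polynomial
    -- as well.
    polyRing : CommutativeRing c (c ⊔ c′ ⊔ ℓ′ ⊔ m)
    polyRing = record
      { Carrier = Poly ; _≈_ = _≈M_ ; _+_ = _⊕_ ; _*_ = _⊗_ ; -_ = map (R.-_) ; 0# = [] ; 1# = R.1# ∷ []
      ; isCommutativeRing = record
        { isRing = record
          { +-isAbelianGroup = record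
            { isGroup = record
              { isMonoid = record
                { isSemigroup = record
                  { isMagma = record
                    { isEquivalence = record { refl = ≈M-refl ; sym = ≈M-sym ; trans = ≈M-trans }
                    ; ∙-cong = ⊕-cong }
                  ; assoc = ⊕-assoc }
                ; identity = (λ p → ≈M-refl) , λ p → ⊕-comm p [] }
              ; inverse = ⊕-inverseˡ , λ p → ≈M-trans (⊕-comm p _) (⊕-inverseˡ p)
              ; ⁻¹-cong = neg-cong }
            ; comm = ⊕-comm }
          ; *-cong = ⊗-cong
          ; *-assoc = ⊗-assoc
          ; *-identity = ⊗-identityˡ , λ p → ≈M-trans (⊗-comm p _) (⊗-identityˡ p)
          ; distrib = (λ p q r → ≈M-trans (⊗-comm p _) (≈M-trans (⊗-distribʳ p q r) (⊕-cong (⊗-comm q p) (⊗-comm r p))))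
                    , ⊗-distribʳ }
        ; *-comm = ⊗-comm } }

  -- Degrees and expansions at infinity

  -- Zeros may trail, since lists cannot be normalised without decidable equality; `Deg< 0` means
  -- that every coefficient is 0.
  data Deg< : ℕ → Poly → Set (c ⊔ ℓ) where
    nil  : ∀ {d} → Deg< d []
    zero : ∀ {a p} → a R.≈ R.0# → Deg< 0 p → Deg< 0 (a ∷ p)
    suc  : ∀ {d a p} → Deg< d p → Deg< (suc d) (a ∷ p)

  data Monic : ℕ → Poly → Set (c ⊔ ℓ) where
    one : ∀ {a p} → a R.≈ R.1# → Deg< 0 p → Monic 0 (a ∷ p)
    suc : ∀ {d a p} → Monic d p → Monic (suc d) (a ∷ p)

  Deg<-mono : ∀ {d e p} → d ≤ e → Deg< d p → Deg< e p
  Deg<-mono le         nil                    = nil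
  Deg<-mono {e = zero}  z≤n (zero a≈0 D)      = zero a≈0 D
  Deg<-mono {e = suc e} z≤n (zero a≈0 D)      = suc (Deg<-mono z≤n D)
  Deg<-mono (s≤s le)   (suc D)                = suc (Deg<-mono le D)

  Monic⇒Deg< : ∀ {d p} → Monic d p → Deg< (suc d) p
  Monic⇒Deg< (one _ D) = suc D
  Monic⇒Deg< (suc M)   = suc (Monic⇒Deg< M)

  Deg<-⊕ : ∀ {d p q} → Deg< d p → Deg< d q → Deg< d (p ⊕ q)
  Deg<-⊕ nil        E          = E
  Deg<-⊕ (zero a D) nil        = zero a D
  Deg<-⊕ (suc D)    nil        = suc D
  Deg<-⊕ (zero a D) (zero b E) = zero (R.trans (R.+-cong a b) (R.+-identityˡ _)) (Deg<-⊕ D E)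
  Deg<-⊕ (suc D)    (suc E)    = suc (Deg<-⊕ D E)

  Deg<-map-* : ∀ {d p} a → Deg< d p → Deg< d (map (a R.*_) p)
  Deg<-map-* a nil        = nil
  Deg<-map-* a (zero b D) = zero (R.trans (R.*-congˡ b) (R.zeroʳ a)) (Deg<-map-* a D)
  Deg<-map-* a (suc D)    = suc (Deg<-map-* a D)

  Monic-⊕ : ∀ {d p q} → Deg< d p → Monic d q → Monic d (p ⊕ q)
  Monic-⊕ nil        M          = M
  Monic-⊕ (zero a D) (one b E)  = one (R.trans (R.+-cong a b) (R.+-identityˡ _)) (Deg<-⊕ D E)
  Monic-⊕ (suc D)    (suc M)    = suc (Monic-⊕ D M)

  Monic-⊕ʳ : ∀ {d p q} → Monic d p → Deg< d q → Monic d (p ⊕ q)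
  Monic-⊕ʳ (one a E) nil        = one a E
  Monic-⊕ʳ (suc M)   nil        = suc M
  Monic-⊕ʳ (one a E) (zero b D) = one (R.trans (R.+-cong a b) (R.+-identityʳ _)) (Deg<-⊕ E D)
  Monic-⊕ʳ (suc M)   (suc D)    = suc (Monic-⊕ʳ M D)

  Monic-map-* : ∀ {d p a} → a R.≈ R.1# → Monic d p → Monic d (map (a R.*_) p)
  Monic-map-* a≈1 (one b D) = one (R.trans (R.*-cong a≈1 b) (R.*-identityˡ _)) (Deg<-map-* _ D)
  Monic-map-* a≈1 (suc M)   = suc (Monic-map-* a≈1 M)

  Deg<0-map-* : ∀ {a} q → a R.≈ R.0# → Deg< 0 (map (a R.*_) q)
  Deg<0-map-* []      a≈0 = nil
  Deg<0-map-* (b ∷ q) a≈0 = zero (R.trans (R.*-congʳ a≈0) (R.zeroˡ b)) (Deg<0-map-* q a≈0)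

  Deg<0-⊗ : ∀ {p} q → Deg< 0 p → Deg< 0 (p ⊗ q)
  Deg<0-⊗ q nil          = nil
  Deg<0-⊗ q (zero a≈0 D) = Deg<-⊕ (Deg<0-map-* q a≈0) (zero R.refl (Deg<0-⊗ q D))

  Monic-⊗ : ∀ {d e p q} → Monic d p → Monic e q → Monic (d ℕ.+ e) (p ⊗ q)
  Monic-⊗ {q = q} (one a≈1 D) N = Monic-⊕ʳ (Monic-map-* a≈1 N) (Deg<-mono z≤n (zero R.refl (Deg<0-⊗ q D)))
  Monic-⊗ {suc d} (suc M) N =
    Monic-⊕ (Deg<-map-* _ (Deg<-mono (s≤s (m≤n+m _ d)) (Monic⇒Deg< N))) (suc (Monic-⊗ M N))

  Monic-1 : Monic 0 (R.1# ∷ [])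
  Monic-1 = one R.refl nil

  Monic-X : Monic 1 X
  Monic-X = suc Monic-1

  Deg<-X : ∀ {d} → 2 ≤ d → Deg< d X
  Deg<-X 2≤d = Deg<-mono 2≤d (Monic⇒Deg< Monic-X)

  Monic-a : ∀ i → Monic (2 ^ i) (aPoly (suc i))
  Monic-a zero    = Monic-X
  Monic-a (suc i) = Monic-⊕ʳ
    (≡.subst (λ d → Monic d (aPoly (suc i) ⊗ aPoly (suc i))) (≡.cong (2 ^ i ℕ.+_) (≡.sym (ℕₚ.+-identityʳ _))) (Monic-⊗ (Monic-a i) (Monic-a i)))
    (Deg<-X (*-monoʳ-≤ 2 (ℕₚ.m^n>0 2 i)))

  Monic-a+a : ∀ p j → Monic (2 ^ (p ℕ.+ suc j)) (aPoly (suc p ℕ.+ suc j) ⊕ aPoly (suc p))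
  Monic-a+a p j = Monic-⊕ʳ (Monic-a (p ℕ.+ suc j))
    (Deg<-mono (^-monoʳ-< 2 (s≤s (s≤s z≤n)) (m<m+n p z<s)) (Monic⇒Deg< (Monic-a p)))

  act-local : ∀ {d p} → Deg< d p → ∀ y z n → (∀ i → n ≤ i → i < d ℕ.+ n → y i ≈ z i) → act p y n ≈ act p z n
  act-local nil            y z n e = refl
  act-local (zero a≈0 D)   y z n e = +-cong (trans (a*≈0 y) (sym (a*≈0 z)))
    (act-local D _ _ n λ i n≤i i<n → ⊥-elim (<-irrefl ≡.refl (≤-<-trans n≤i i<n)))
    where a*≈0 : ∀ y → _ * y n ≈ 0#
          a*≈0 y = trans (*-congʳ (trans (H.⟦⟧-cong a≈0) H.0#-homo)) (zeroˡ _)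
  act-local {suc d} (suc D) y z n e = +-cong (*-congˡ (e n ≤-refl (s≤s (m≤n+m n d))))
    (act-local D _ _ n λ i n≤i i<d+n → e (suc i) (m≤n⇒m≤1+n n≤i) (s≤s i<d+n))

  -- y = O(c^{-n})
  Van : ℕ → Seq → Set ℓ′
  Van n y = ∀ i → i < n → y i ≈ 0#

  Van-mono : ∀ {m n y} → m ≤ n → Van n y → Van m y
  Van-mono m≤n V i i<m = V i (<-≤-trans i<m m≤n)

  act-Van : ∀ {d p} → Deg< (suc d) p → ∀ {y n} → Van (d ℕ.+ n) y → Van n (act p y)
  act-Van {d} {p} D {y} V i i<n = trans
    (act-local D y (λ _ → 0#) i λ j _ j≤d+i → V j (≤-<-trans (s≤s⁻¹ j≤d+i) (+-monoʳ-< d i<n)))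
    (act-zero p (λ _ → refl) i)

  act-Monic : ∀ {d p} → Monic d p → ∀ {y} n → Van (d ℕ.+ n) y → act p y n ≈ y (d ℕ.+ n)
  act-Monic {p = _ ∷ p} (one a≈1 D) {y} n V = trans (+-cong (trans (*-congʳ (trans (H.⟦⟧-cong a≈1) H.1#-homo)) (*-identityˡ _))
    (trans (act-local D (y ∘ suc) (λ _ → 0#) n λ i n≤i i<n → ⊥-elim (<-irrefl ≡.refl (≤-<-trans n≤i i<n)))
           (act-zero p (λ _ → refl) n)))
    (+-identityʳ _)
  act-Monic {suc d} (suc M) {y} n V = trans (+-cong (trans (*-congˡ (V n (s≤s (m≤n+m n d)))) (zeroʳ _))
    (act-Monic M n λ i i<d+n → V (suc i) (s≤s i<d+n))) (+-identityˡ _)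

  -- Expansion of 1 at infinity, index i being the coefficient of c^{-i}.
  δ : Seq
  δ zero    = 1#
  δ (suc _) = 0#

  -- `seq` is the expansion of 1/p. The action drops positive powers of c, so `inv` alone leaves d
  -- coefficients free; `van` fixes them.
  record Inverse (d : ℕ) (p : Poly) : Set (c ⊔ ℓ ⊔ c′ ⊔ ℓ′) where
    field
      monic : Monic d p
      seq   : Seq
      inv   : act p seq ≐ δ
      van   : Van d seq

    -- After a shift by one `δ` is gone; hence residues, read at index 1, depend only on classes
    -- modulo p.
    annihilates : ∀ n → act p (seq ∘ suc) n ≈ 0#
    annihilates n = trans (act-suc p seq n) (inv (suc n))

    leading : seq d ≈ 1#
    leading = ≡.subst (λ e → seq e ≈ 1#) (ℕₚ.+-identityʳ d)
      (trans (sym (act-Monic monic 0 (≡.subst (λ e → Van e seq) (≡.sym (ℕₚ.+-identityʳ d)) van))) (inv 0))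

  -- The difference w is killed by p, and once w vanishes below d + n its value at d + n equals that
  -- of `act p w` at n.
  unique : ∀ {d p} → Monic d p → ∀ {y z} → act p y ≐ act p z → Van d y → Van d z → y ≐ z
  unique {d} {p} M {y} {z} e Vy Vz i = trans (sym (-‿cancel (y i) (z i)))
      (trans (+-congʳ (vanish (suc i) i (<-≤-trans (n<1+n i) (m≤n+m (suc i) d)))) (+-identityˡ _))
    where
      -‿cancel : ∀ u v → (u - v) + v ≈ u
      -‿cancel u v = trans (+-assoc _ _ _) (trans (+-congˡ (-‿inverseˡ v)) (+-identityʳ u))
      w : Seq
      w n = y n - z n
      aw≈0 : ∀ n → act p w n ≈ 0#
      aw≈0 n = trans (act-+ p y _ n) (trans (+-cong (e n) (act-neg p z n)) (-‿inverseʳ _))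
      vanish : ∀ n → Van (d ℕ.+ n) w
      vanish zero    j j<d = trans (+-cong (Vy j (lt j<d)) (trans (-‿cong (Vz j (lt j<d))) -0≈0)) (+-identityˡ _)
        where lt : j < d ℕ.+ 0 → j < d
              lt = ≡.subst (j <_) (ℕₚ.+-identityʳ d)
      vanish (suc n) j j< with m≤n⇒m<n∨m≡n (s≤s⁻¹ (≡.subst (j <_) (ℕₚ.+-suc d n) j<))
      ... | inj₁ lt      = vanish n j lt
      ... | inj₂ ≡.refl  = trans (sym (act-Monic M n (vanish n))) (aw≈0 n)

  private
    take-Deg< : ∀ d p → Deg< d (take d p)
    take-Deg< zero    p       = nil
    take-Deg< (suc d) []      = nil
    take-Deg< (suc d) (a ∷ p) = suc (take-Deg< d p)

    act-split : ∀ {d p} → Monic d p → ∀ y n → act p y n ≈ act (take d p) y n + y (d ℕ.+ n)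
    -- Blanking y below n changes nothing at n and makes `act-Monic` applicable.
    act-split M@(one _ _) y n = trans (trans (act-local (Monic⇒Deg< M) y y₀ n agree) (act-Monic M n V)) (trans eq (sym (+-identityˡ _)))
      where
        y₀ : Seq
        y₀ i with i ℕₚ.<? n
        ... | yes _ = 0#
        ... | no  _ = y i
        agree : ∀ i → n ≤ i → i < suc n → y i ≈ y₀ i
        agree i n≤i _ with i ℕₚ.<? n
        ... | yes i<n = ⊥-elim (<⇒≱ i<n n≤i)
        ... | no  _   = refl
        V : Van n y₀
        V i i<n with i ℕₚ.<? n
        ... | yes _   = refl
        ... | no  i≮n = ⊥-elim (i≮n i<n)
        eq : y₀ n ≈ y n
        eq = sym (agree n ≤-refl (n<1+n n))
    act-split (suc M) y n = trans (+-congˡ (act-split M (y ∘ suc) n)) (sym (+-assoc _ _ _))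

  inverse : ∀ {d p} → Monic d p → Inverse d p
  inverse {d} {p} M = record { monic = M ; seq = λ i → stage (suc i) i ; inv = solves ; van = λ i → low (suc i) i }
    where
      -- The coefficient at d + n is forced by those below it. Iterating this from 0, index i is
      -- final from stage i + 1 on.
      stage : ℕ → Seq
      stage zero    i = 0#
      stage (suc k) i with i ℕₚ.<? d
      ... | yes _ = 0#
      ... | no  _ = δ (i ∸ d) - act (take d p) (stage k) (i ∸ d)

      low : ∀ k i → i < d → stage k i ≈ 0#
      low zero    i i<d = refl
      low (suc k) i i<d with i ℕₚ.<? d
      ... | yes _   = refl
      ... | no  i≮d = ⊥-elim (i≮d i<d)

      stable : ∀ k l i → i < k → i < l → stage k i ≈ stage l i
      stable (suc k) (suc l) i i<k i<l with i ℕₚ.<? d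
      ... | yes _   = refl
      ... | no  i≮d = +-congˡ (-‿cong (act-local (take-Deg< d p) _ _ (i ∸ d) λ j _ j< →
        stable k l j (<-≤-trans (lt j<) (s≤s⁻¹ i<k)) (<-≤-trans (lt j<) (s≤s⁻¹ i<l))))
        where lt : ∀ {j} → j < d ℕ.+ (i ∸ d) → j < i
              lt {j} = ≡.subst (j <_) (m+[n∸m]≡n (≮⇒≥ i≮d))

      at : ∀ k n → stage (suc k) (d ℕ.+ n) ≈ δ n - act (take d p) (stage k) n
      at k n with (d ℕ.+ n) ℕₚ.<? d
      ... | yes lt = ⊥-elim (m+n≮m d n lt)
      ... | no  _  rewrite m+n∸m≡n d n = refl

      solves : act p (λ i → stage (suc i) i) ≐ δ
      solves n = begin
        act p (λ i → stage (suc i) i) n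
          ≈⟨ act-split M _ n ⟩
        act (take d p) (λ i → stage (suc i) i) n + stage (suc (d ℕ.+ n)) (d ℕ.+ n)
          ≈⟨ +-cong (act-local (take-Deg< d p) _ _ n λ j _ j< → stable (suc j) (d ℕ.+ n) j (n<1+n j) j<) (at (d ℕ.+ n) n) ⟩
        act (take d p) (stage (d ℕ.+ n)) n + (δ n - act (take d p) (stage (d ℕ.+ n)) n)
          ≈⟨ solve 2 (λ u v → u :+ (v :- u) := v) refl _ _ ⟩
        δ n ∎
        where open Solver

  -- Rules for derivatives

  act-deriv-∷ : ∀ a p y n → act (deriv (a ∷ p)) y n ≈ act p y n + act (deriv p) (y ∘ suc) n
  act-deriv-∷ a p y n = trans (act-⊕ p _ y n) (+-congˡ (act-0∷ (deriv p) y n))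

  deriv-⊕ : ∀ p q y n → act (deriv (p ⊕ q)) y n ≈ act (deriv p) y n + act (deriv q) y n
  deriv-⊕ []      q       y n = sym (+-identityˡ _)
  deriv-⊕ (a ∷ p) []      y n = sym (+-identityʳ _)
  deriv-⊕ (a ∷ p) (b ∷ q) y n = begin
    act (deriv ((a ∷ p) ⊕ (b ∷ q))) y n  ≈⟨ act-deriv-∷ (a R.+ b) (p ⊕ q) y n ⟩
    act (p ⊕ q) y n + act (deriv (p ⊕ q)) (y ∘ suc) n    ≈⟨ +-cong (act-⊕ p q y n) (deriv-⊕ p q _ n) ⟩
    (act p y n + act q y n) + (act (deriv p) (y ∘ suc) n + act (deriv q) (y ∘ suc) n)
      ≈⟨ solve 4 (λ u v w x → (u :+ v) :+ (w :+ x) := (u :+ w) :+ (v :+ x)) refl _ _ _ _ ⟩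
    (act p y n + act (deriv p) (y ∘ suc) n) + (act q y n + act (deriv q) (y ∘ suc) n)
      ≈⟨ +-cong (act-deriv-∷ a p y n) (act-deriv-∷ b q y n) ⟨
    act (deriv (a ∷ p)) y n + act (deriv (b ∷ q)) y n ∎
    where open Solver

  deriv-map-* : ∀ a p y n → act (deriv (map (a R.*_) p)) y n ≈ φ a * act (deriv p) y n
  deriv-map-* a []      y n = sym (zeroʳ _)
  deriv-map-* a (b ∷ p) y n = begin
    act (deriv (map (a R.*_) (b ∷ p))) y n  ≈⟨ act-deriv-∷ (a R.* b) (map (a R.*_) p) y n ⟩
    act (map (a R.*_) p) y n + act (deriv (map (a R.*_) p)) (y ∘ suc) n ≈⟨ +-cong (act-map-* a p y n) (deriv-map-* a p _ n) ⟩
    φ a * act p y n + φ a * act (deriv p) (y ∘ suc) n  ≈⟨ distribˡ _ _ _ ⟨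
    φ a * (act p y n + act (deriv p) (y ∘ suc) n)  ≈⟨ *-congˡ (act-deriv-∷ b p y n) ⟨
    φ a * act (deriv (b ∷ p)) y n  ∎

  deriv-⊗ : ∀ p q y n → act (deriv (p ⊗ q)) y n ≈ act (deriv p) (act q y) n + act p (act (deriv q) y) n
  deriv-⊗ []      q y n = sym (+-identityˡ _)
  deriv-⊗ (a ∷ p) q y n = begin
    act (deriv (map (a R.*_) q ⊕ (R.0# ∷ (p ⊗ q)))) y n
      ≈⟨ trans (deriv-⊕ (map (a R.*_) q) _ y n) (+-cong (deriv-map-* a q y n) (act-deriv-∷ R.0# (p ⊗ q) y n)) ⟩
    φ a * act (deriv q) y n + (act (p ⊗ q) y n + act (deriv (p ⊗ q)) (y ∘ suc) n)
      ≈⟨ +-congˡ (+-cong (act-⊗ p q y n) (deriv-⊗ p q _ n)) ⟩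
    φ a * act (deriv q) y n + (act p (act q y) n + (act (deriv p) (act q (y ∘ suc)) n + act p (act (deriv q) (y ∘ suc)) n))
      ≈⟨ solve 4 (λ u v w x → u :+ (v :+ (w :+ x)) := (v :+ w) :+ (u :+ x)) refl _ _ _ _ ⟩
    (act p (act q y) n + act (deriv p) (act q (y ∘ suc)) n) + (φ a * act (deriv q) y n + act p (act (deriv q) (y ∘ suc)) n)
      ≈⟨ +-cong (+-congˡ (act-cong (deriv p) (act-suc q y) n)) (+-congˡ (act-cong p (act-suc (deriv q) y) n)) ⟩
    (act p (act q y) n + act (deriv p) (act q y ∘ suc) n) + act (a ∷ p) (act (deriv q) y) n
      ≈⟨ +-congʳ (act-deriv-∷ a p (act q y) n) ⟨
    act (deriv (a ∷ p)) (act q y) n + act (a ∷ p) (act (deriv q) y) n ∎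
    where open Solver

  deriv-≈0 : ∀ {p} → [] ≈P p → ∀ y n → act (deriv p) y n ≈ 0#
  deriv-≈0 {[]}    e       y n = refl
  deriv-≈0 {a ∷ p} (_ , e) y n = trans (act-deriv-∷ a p y n) (trans (+-cong (act-≈0 e y n) (deriv-≈0 e _ n)) (+-identityˡ _))

  deriv-≈P : ∀ {p q} → p ≈P q → ∀ y → act (deriv p) y ≐ act (deriv q) y
  deriv-≈P {[]}    {q}     e       y n = sym (deriv-≈0 {q} e y n)
  deriv-≈P {a ∷ p} {[]}    e       y n = deriv-≈0 {a ∷ p} ([]≈P-sym {a ∷ p} e) y n
  deriv-≈P {a ∷ p} {b ∷ q} (_ , e) y n =
    trans (act-deriv-∷ a p y n) (trans (+-cong (act-≈P e y n) (deriv-≈P e _ n)) (sym (act-deriv-∷ b q y n)))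

  deriv-Deg< : ∀ {d p} → Deg< (suc d) p → Deg< d (deriv p)
  deriv-Deg< nil               = nil
  deriv-Deg< {zero}  (suc D)   = Deg<-⊕ D (zero R.refl (deriv-Deg<0 D))
    where deriv-Deg<0 : ∀ {p} → Deg< 0 p → Deg< 0 (deriv p)
          deriv-Deg<0 nil        = nil
          deriv-Deg<0 (zero _ D) = Deg<-⊕ D (zero R.refl (deriv-Deg<0 D))
  deriv-Deg< {suc d} (suc D)   = Deg<-⊕ D (suc (deriv-Deg< D))

  act-Van< : ∀ {d p} → Deg< d p → ∀ {y n} → Van (d ℕ.+ n) y → Van (suc n) (act p y)
  act-Van< {d} {p} D {y} V i i≤n = trans
    (act-local D y (λ _ → 0#) i λ j _ j<d+i → V j (<-≤-trans j<d+i (+-monoʳ-≤ d (s≤s⁻¹ i≤n))))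
    (act-zero p (λ _ → refl) i)

-- The ring ℤ[c] and its quotients

module IntegerPolynomials where

  open ≡ using (refl; sym; trans; cong; cong₂; subst)
  open import Data.Nat.Base using (_+_; _*_)

  ℤ-ring : CommutativeRing _ _
  ℤ-ring = ℤₚ.+-*-commutativeRing

  id-isRingHomomorphism : ∀ {c ℓ} (R : CommutativeRing c ℓ) →
    RingMorphisms.IsRingHomomorphism (CommutativeRing.rawRing R) (CommutativeRing.rawRing R) id
  id-isRingHomomorphism R = record
    { isSemiringHomomorphism = record
      { isNearSemiringHomomorphism = record
        { +-isMonoidHomomorphism = record
          { isMagmaHomomorphism = record { isRelHomomorphism = record { cong = id } ; homo = λ _ _ → R.refl }
          ; ε-homo = R.refl }
        ; *-homo = λ _ _ → R.refl }
      ; 1#-homo = R.refl }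
    ; -‿homo = λ _ → R.refl }
    where module R = CommutativeRing R

  open OverRing ℤ-ring using (Poly; _⊕_; _⊗_; X; aPoly)
  module Actℤ = Action ℤ-ring ℤ-ring id (id-isRingHomomorphism ℤ-ring)
  open Actℤ

  module Everything = Quotient (λ _ → 𝟙) (λ _ _ → tt)
  open Everything using () renaming (_≈M_ to _≈ₚ_; polyRing to ℤ[c])

  Annihilated : Poly → Seq → Set
  Annihilated F y = ∀ n → act F y n ≡ 0ℤ

  Annihilated-closed : ∀ F p {y} → Annihilated F y → Annihilated F (act p y)
  Annihilated-closed F p {y} A n = trans (act-comm F p y n) (act-zero p A n)

  ⊝_ : Poly → Poly
  ⊝_ = map (ℤ.-_)

  open Algebra.Properties.CommutativeSemiring.Exp (CommutativeRing.commutativeSemiring ℤ[c])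
    using (^-homo-*; ^-congˡ; ^-assocʳ; ^-distrib-*) renaming (_^_ to _^ₚ_) public

  module ℤ[c] = CommutativeRing ℤ[c]
  module ℤ[c]-Solver = IntegerHom.Solver ℤ[c]
  module ℤ[c]-Reasoning = Relation.Binary.Reasoning.Setoid ℤ[c].setoid

  -- A model of ℤ[c]/F: multiples of F act as 0 on the sequences killed by F.
  module Mod (F : Poly) where
    open Quotient (Annihilated F) (Annihilated-closed F) public
      renaming (polyRing to ring)
    module ring = CommutativeRing ring

    mod : ∀ {p q} → p ≈ₚ q → p ≈M q
    mod e = acts λ _ → Everything.on e tt

  Monic-^ : ∀ {d p} → Monic d p → ∀ e → Monic (e * d) (p ^ₚ e)
  Monic-^ M zero    = Monic-1
  Monic-^ M (suc e) = Monic-⊗ M (Monic-^ M e)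

  Monic-X^ : ∀ b → Monic b (X ^ₚ b)
  Monic-X^ b = subst (λ d → Monic d (X ^ₚ b)) (ℕₚ.*-identityʳ b) (Monic-^ Monic-X b)

  da : ℕ → Poly
  da i = deriv (aPoly i)

  Deg<-da : ∀ i → Deg< (2 ^ i) (da (suc i))
  Deg<-da i = deriv-Deg< (Monic⇒Deg< (Monic-a i))

  1ₚ : Poly
  1ₚ = 1ℤ ∷ []

  da-suc : ∀ i → da (suc i) ≈ₚ (aPoly i ⊗ da i ⊕ aPoly i ⊗ da i) ⊕ 1ₚ
  da-suc i = Everything.acts λ {y} _ n → let a = aPoly i ; a′ = da i in
    trans (deriv-⊕ (a ⊗ a) X y n) (trans (cong₂ ℤ._+_
      (trans (deriv-⊗ a a y n) (trans (cong₂ ℤ._+_ (act-comm a′ a y n) refl)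
        (sym (trans (act-⊕ (a ⊗ a′) (a ⊗ a′) y n) (cong₂ ℤ._+_ (act-⊗ a a′ y n) (act-⊗ a a′ y n))))))
      (deriv-X y n)) (sym (act-⊕ (a ⊗ a′ ⊕ a ⊗ a′) 1ₚ y n)))
    where
      deriv-X : ∀ y n → act (deriv X) y n ≡ act 1ₚ y n
      deriv-X y n = trans (act-deriv-∷ 0ℤ 1ₚ y n)
        (trans (cong (ℤ._+_ (act 1ₚ y n)) (trans (act-deriv-∷ 1ℤ [] (y ∘ suc) n) refl)) (ℤₚ.+-identityʳ _))

  -- Words in consecutive a_i

  word : ℕ → List ℕ → Poly
  word s []       = 1ₚ
  word s (e ∷ es) = aPoly s ^ₚ e ⊗ word (suc s) es

  -- As deg a_{i+1} = 2 deg a_i, this is the degree of a word measured in that of its first letter.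
  binary : List ℕ → ℕ
  binary []       = 0
  binary (e ∷ es) = e + 2 * binary es

  Monic-word : ∀ s es → Monic (2 ^ s * binary es) (word (suc s) es)
  Monic-word s []       = subst (λ d → Monic d 1ₚ) (sym (ℕₚ.*-zeroʳ (2 ^ s))) Monic-1
  Monic-word s (e ∷ es) = subst (λ d → Monic d (word (suc s) (e ∷ es))) (eq e (2 ^ s) (binary es))
      (Monic-⊗ (Monic-^ (Monic-a s) e) (Monic-word (suc s) es))
    where eq : ∀ e q b → e * q + (2 * q) * b ≡ q * (e + 2 * b)
          eq = ℕSolver.solve-∀

  -- a_i² = a_{i+1} - c applied inside a word; the total exponent drops by one and by two in the two
  -- summands, so rewriting terminates.
  word-mid : ∀ s pre e f post → word s (pre ++ suc (suc e) ∷ f ∷ post)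
    ≈ₚ word s (pre ++ e ∷ suc f ∷ post) ⊕ ⊝ (X ⊗ word s (pre ++ e ∷ f ∷ post))
  word-mid s [] e f post = solve 5 (λ a e f w x → (a :* (a :* e)) :* (f :* w) := e :* (((a :* a :+ x) :* f) :* w) :- x :* (e :* (f :* w)))
      ℤ[c].refl (aPoly s) (aPoly s ^ₚ e) (aPoly (suc s) ^ₚ f) (word (suc (suc s)) post) X
    where open ℤ[c]-Solver
  word-mid s (g ∷ pre) e f post = ℤ[c].trans (ℤ[c].*-congˡ {aPoly s ^ₚ g} (word-mid (suc s) pre e f post))
      (solve 4 (λ g u x v → g :* (u :- x :* v) := g :* u :- x :* (g :* v)) ℤ[c].refl (aPoly s ^ₚ g) (word (suc s) (pre ++ e ∷ suc f ∷ post)) X (word (suc s) (pre ++ e ∷ f ∷ post)))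
    where open ℤ[c]-Solver

  -- At the last letter the same rewriting creates a letter outside the word, which `a-wrap` brings
  -- back modulo F.
  word-top : ∀ s pre e → word s (pre ++ suc (suc e) ∷ [])
    ≈ₚ aPoly (suc (s + length pre)) ⊗ word s (pre ++ e ∷ []) ⊕ ⊝ (X ⊗ word s (pre ++ e ∷ []))
  word-top s [] e rewrite ℕₚ.+-identityʳ s = solve 4 (λ a e w x → (a :* (a :* e)) :* w := (a :* a :+ x) :* (e :* w) :- x :* (e :* w))
      ℤ[c].refl (aPoly s) (aPoly s ^ₚ e) 1ₚ X
    where open ℤ[c]-Solver
  word-top s (g ∷ pre) e rewrite ℕₚ.+-suc s (length pre) = ℤ[c].trans (ℤ[c].*-congˡ {aPoly s ^ₚ g} (word-top (suc s) pre e))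
      (solve 4 (λ g u x v → g :* (u :* v :- x :* v) := u :* (g :* v) :- x :* (g :* v)) ℤ[c].refl (aPoly s ^ₚ g) (aPoly (suc (suc (s + length pre)))) X (word (suc s) (pre ++ e ∷ [])))
    where open ℤ[c]-Solver

  increment : ℕ → List ℕ → List ℕ
  increment i       []       = []
  increment zero    (e ∷ es) = suc e ∷ es
  increment (suc i) (e ∷ es) = e ∷ increment i es

  word-increment : ∀ s i es → i < length es → word s (increment i es) ≈ₚ aPoly (i + s) ⊗ word s es
  word-increment s zero    (e ∷ es) _   = ℤ[c].*-assoc (aPoly s) (aPoly s ^ₚ e) _
  word-increment s (suc i) (e ∷ es) i<n = ℤ[c].trans
      (ℤ[c].*-congˡ {aPoly s ^ₚ e} (subst (λ j → word (suc s) (increment i es) ≈ₚ aPoly j ⊗ word (suc s) es) (ℕₚ.+-suc i s)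
        (word-increment (suc s) i es (s<s⁻¹ i<n))))
      (solve 3 (λ g a w → g :* (a :* w) := a :* (g :* w)) ℤ[c].refl (aPoly s ^ₚ e) (aPoly (suc i + s)) (word (suc s) es))
    where open ℤ[c]-Solver

  sum-increment : ∀ i es → i < length es → sum (increment i es) ≡ suc (sum es)
  sum-increment zero    (e ∷ es) _   = refl
  sum-increment (suc i) (e ∷ es) i<n = trans (cong (e ℕ.+_) (sum-increment i es (s<s⁻¹ i<n))) (ℕₚ.+-suc e _)

  length-increment : ∀ i es → length (increment i es) ≡ length es
  length-increment i       []       = refl
  length-increment zero    (e ∷ es) = refl
  length-increment (suc i) (e ∷ es) = cong suc (length-increment i es)

  data Split : List ℕ → Set where
    small : ∀ {es} → All (_≤ 1) es → Split es
    mid   : ∀ pre e f post → Split (pre ++ suc (suc e) ∷ f ∷ post)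
    top   : ∀ pre e → Split (pre ++ suc (suc e) ∷ [])

  split : ∀ es → Split es
  split []                       = small []
  split (g ∷ es) with split es
  ... | mid pre e f post         = mid (g ∷ pre) e f post
  ... | top pre e                = top (g ∷ pre) e
  split (0 ∷ es)                | small s = small (z≤n ∷ s)
  split (1 ∷ es)                | small s = small (s≤s z≤n ∷ s)
  split (suc (suc e) ∷ [])      | small s = top [] e
  split (suc (suc e) ∷ f ∷ post)| small s = mid [] e f post

  sum-mid : ∀ pre e f post → sum (pre ++ suc (suc e) ∷ f ∷ post) ≡ suc (sum (pre ++ e ∷ suc f ∷ post))
  sum-mid []        e f post = cong suc (sym (ℕₚ.+-suc e (f + sum post)))
  sum-mid (g ∷ pre) e f post = trans (cong (g ℕ.+_) (sum-mid pre e f post)) (ℕₚ.+-suc g _)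

  sum-lower : ∀ pre e post → sum (pre ++ suc (suc e) ∷ post) ≡ suc (suc (sum (pre ++ e ∷ post)))
  sum-lower []        e post = refl
  sum-lower (g ∷ pre) e post = trans (cong (g ℕ.+_) (sum-lower pre e post)) (trans (ℕₚ.+-suc g _) (cong suc (ℕₚ.+-suc g _)))

  length-replace : ∀ (pre : List ℕ) {a b post post′} → length post ≡ length post′ → length (pre ++ a ∷ post) ≡ length (pre ++ b ∷ post′)
  length-replace []        e = cong suc e
  length-replace (g ∷ pre) e = cong suc (length-replace pre e)

  sum≤length : ∀ {es} → All (_≤ 1) es → sum es ≤ length es
  sum≤length []      = z≤n
  sum≤length (l ∷ s) = +-mono-≤ l (sum≤length s)

  -- A missing letter at position i costs 2^i, so each of the z missing ones costs at least 1
  -- against the full value 2^k - 1.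
  binary-small : ∀ {es} → All (_≤ 1) es → ∀ z → sum es + z ≡ length es → suc (binary es + z) ≤ 2 ^ length es
  binary-small [] zero refl = s≤s z≤n
  binary-small {.0 ∷ es} (z≤n ∷ s) zero e = ⊥-elim (<-irrefl (trans (sym (ℕₚ.+-identityʳ _)) e) (s≤s (sum≤length s)))
  binary-small {.0 ∷ es} (z≤n ∷ s) (suc z) e = ≤-trans
    (≤-trans (m≤m+n _ z) (≤-reflexive (eq (binary es) z)))
    (*-monoʳ-≤ 2 (binary-small s z (ℕₚ.suc-injective (trans (sym (ℕₚ.+-suc (sum es) z)) e))))
    where eq : ∀ b z → suc (2 * b + suc z) + z ≡ 2 * suc (b + z)
          eq = ℕSolver.solve-∀
  binary-small {.1 ∷ es} (s≤s z≤n ∷ s) z e = ≤-trans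
    (≤-trans (m≤m+n _ z) (≤-reflexive (eq (binary es) z)))
    (*-monoʳ-≤ 2 (binary-small s z (ℕₚ.suc-injective e)))
    where eq : ∀ b z → suc (suc (2 * b) + z) + z ≡ 2 * suc (b + z)
          eq = ℕSolver.solve-∀

  -- Residues of h / F at infinity

  -- G_{p+2,n} is assembled from the F p j, j + 1 ranging over the divisors of n.
  F : ℕ → ℕ → Poly
  F p j = aPoly (suc p + suc j) ⊕ aPoly (suc p)

  abstract
    1/F : ∀ p j → Inverse (2 ^ (p + suc j)) (F p j)
    1/F p j = inverse (Monic-a+a p j)

  -- Residue at infinity of h / F, up to sign.
  res : ℕ → ℕ → Poly → ℤ
  res p j h = act h (Inverse.seq (1/F p j)) 1

  module Residue (p j : ℕ) where
    open Mod (F p j) public using (ring; mod) renaming (_≈M_ to _≈F_; acts to actsF; on to onF)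
    open Inverse (1/F p j)

    private
      s = suc p
      D = 2 ^ (p + suc j)

    -- Index 1 of the expansion is index 0 of its shift, and the shift is killed by F.
    res-F : ∀ {g h} → g ≈F h → res p j g ≡ res p j h
    res-F {g} {h} e = trans (sym (act-suc g seq 0)) (trans (onF e annihilates 0) (act-suc h seq 0))

    res-≈ : ∀ {g h} → g ≈ₚ h → res p j g ≡ res p j h
    res-≈ e = Everything.on e tt 1

    res-⊕ : ∀ g h → res p j (g ⊕ h) ≡ res p j g ℤ.+ res p j h
    res-⊕ g h = act-⊕ g h seq 1

    res-⊝ : ∀ h → res p j (⊝ h) ≡ ℤ.- res p j h
    res-⊝ h = act-map-neg h seq 1

    -- The degree of g h is at most D - 2, so g h / F = O(c^(-2)).
    res-vanish : ∀ {d e g h} → Monic d g → Deg< e h → suc (e + d) ≤ D → res p j (g ⊗ h) ≡ 0ℤ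
    res-vanish {d} {e} {g} {h} Mg Dh le = trans (act-⊗ g h seq 1)
      (act-Van (Monic⇒Deg< Mg) {n = 2} (subst (λ n → Van n (act h seq)) (sym (eq d))
        (act-Van< Dh (Van-mono (≤-trans (≤-reflexive (ℕₚ.+-suc e d)) le) van))) 1 (s≤s (s≤s z≤n)))
      where eq : ∀ d → d + 2 ≡ suc (suc d)
            eq = ℕSolver.solve-∀

    res-top : ∀ {d h} → Monic d h → suc d ≡ D → res p j h ≡ 1ℤ
    res-top {d} M e = trans (act-Monic M 1 (Van-mono (≤-reflexive eq) van)) (trans (cong seq eq) leading)
      where eq : d + 1 ≡ D
            eq = trans (ℕₚ.+-comm d 1) e

    a-wrap : aPoly (suc s + j) ≈F ⊝ aPoly s
    a-wrap = ring.trans (ring.sym (ring.+-identityʳ _)) (ring.trans (ring.+-congˡ (ring.sym (ring.-‿inverseʳ (aPoly s))))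
      (ring.trans (ring.sym (ring.+-assoc (aPoly (suc s + j)) _ _)) (ring.trans (ring.+-congʳ F≈0) (ring.+-identityˡ _))))
      where F≈0 : aPoly (suc s + j) ⊕ aPoly s ≈F []
            F≈0 = actsF λ {y} A n → trans (cong (λ i → act (aPoly i ⊕ aPoly s) y n) (sym (ℕₚ.+-suc s j))) (A n)

  term : ℕ → ℕ → List ℕ → Poly → Poly
  term s b es d = (X ^ₚ b ⊗ word s es) ⊗ d

  module Reduction (p j : ℕ) where
    open Residue p j

    private
      s = suc p

    res-mid : ∀ s b pre e f post d → res p j (term s b (pre ++ suc (suc e) ∷ f ∷ post) d)
      ≡ res p j (term s b (pre ++ e ∷ suc f ∷ post) d) ℤ.- res p j (term s (suc b) (pre ++ e ∷ f ∷ post) d)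
    res-mid s b pre e f post d = trans
      (res-≈ (ℤ[c].trans (ℤ[c].*-congʳ {d} (ℤ[c].*-congˡ {X ^ₚ b} (word-mid s pre e f post)))
        (solve 5 (λ x u w v d → (x :* (u :- w :* v)) :* d := (x :* u) :* d :- ((w :* x) :* v) :* d) ℤ[c].refl
          (X ^ₚ b) (word s (pre ++ e ∷ suc f ∷ post)) X (word s (pre ++ e ∷ f ∷ post)) d)))
      (trans (res-⊕ (term s b (pre ++ e ∷ suc f ∷ post) d) _) (cong (ℤ._+_ (res p j (term s b (pre ++ e ∷ suc f ∷ post) d)))
        (res-⊝ (term s (suc b) (pre ++ e ∷ f ∷ post) d))))
      where open ℤ[c]-Solver

    -- The letters are a_t, …, a_{s+j}; the next one, a_{s+j+1}, equals - a_s modulo F.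
    res-word-top : ∀ {t i} b pre e d → t + length pre ≡ s + j → i + t ≡ s → i < length (pre ++ e ∷ []) →
      res p j (term t b (pre ++ suc (suc e) ∷ []) d)
      ≡ ℤ.- res p j (term t b (increment i (pre ++ e ∷ [])) d) ℤ.- res p j (term t (suc b) (pre ++ e ∷ []) d)
    res-word-top {t} {i} b pre e d end start i< = trans
      (res-F (ring.trans (ring.*-congʳ {d} (ring.*-congˡ {X ^ₚ b} step))
        (mod (solve 6 (λ x a u w v d → (x :* ((:- u) :- w :* v)) :* d := :- ((x :* u) :* d) :- ((w :* x) :* v) :* d) ℤ[c].refl
          (X ^ₚ b) 1ₚ (word t (increment i es)) X (word t es) d))))
      (trans (res-⊕ (⊝ term t b (increment i es) d) _) (cong₂ ℤ._+_ (res-⊝ (term t b (increment i es) d)) (res-⊝ (term t (suc b) es d))))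
      where
        open ℤ[c]-Solver
        es = pre ++ e ∷ []
        neg-* : ⊝ aPoly s ⊗ word t es ≈ₚ ⊝ (aPoly s ⊗ word t es)
        neg-* = solve 2 (λ a w → (:- a) :* w := :- (a :* w)) ℤ[c].refl (aPoly s) (word t es)
        inc : aPoly s ⊗ word t es ≈ₚ word t (increment i es)
        inc = ℤ[c].sym (subst (λ k → word t (increment i es) ≈ₚ aPoly k ⊗ word t es) start (word-increment t i es i<))
        step : word t (pre ++ suc (suc e) ∷ []) ≈F ⊝ word t (increment i es) ⊕ ⊝ (X ⊗ word t es)
        step = ring.trans (mod (word-top t pre e)) (ring.+-congʳ (ring.trans
          (ring.*-congʳ {word t es} (subst (λ k → aPoly k ≈F ⊝ aPoly s) (cong suc (sym end)) a-wrap))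
          (mod (ℤ[c].trans neg-* (ℤ[c].-‿cong inc)))))

  -- Words of small weight

  z≤q*z : ∀ {q} z → 1 ≤ q → z ≤ q * z
  z≤q*z z 1≤q = ≤-trans (≤-reflexive (sym (ℕₚ.*-identityˡ z))) (*-monoˡ-≤ z 1≤q)

  -- Here q = 2^p, v = `binary es`, and z letters are missing. Each missing letter lowers the degree
  -- by at least q but relaxes the bound on b by only 1/2. The conclusion says degree at most D - 2.
  degree-bound₀ : ∀ {q b v z D} → 1 ≤ q → 2 * b + 3 ≤ 2 * q + z → q * suc (v + z) ≤ D →
    suc (1 + (b + q * v)) ≤ D
  degree-bound₀ {q} {b} {v} {z} {D} 1≤q h le = ≤-trans
      (≤-trans (+-monoˡ-≤ (q * v) key) (≤-reflexive (eq₁ q v z))) le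
    where
      eq₁ : ∀ q v z → (q * z + q) + q * v ≡ q * suc (v + z)
      eq₁ = ℕSolver.solve-∀
      eq₂ : ∀ q z → suc (2 * (q * z + q)) ≡ suc (q * z + (q * z)) + 2 * q
      eq₂ = ℕSolver.solve-∀
      eq₃ : ∀ b → suc (2 * suc b) ≡ 2 * b + 3
      eq₃ = ℕSolver.solve-∀
      key : suc (suc b) ≤ q * z + q
      key with suc (suc b) ℕₚ.≤? q * z + q
      ... | yes p = p
      ... | no ¬p = ⊥-elim (<⇒≱ (+-cancelʳ-≤ (2 * q) _ _ (≤-trans (≤-reflexive (sym (eq₂ q z)))
        (≤-trans (s≤s (*-monoʳ-≤ 2 (s≤s⁻¹ (≰⇒> ¬p)))) (≤-trans (≤-reflexive (eq₃ b)) (≤-trans h (≤-reflexive (ℕₚ.+-comm (2 * q) z)))))))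
        (≤-trans (z≤q*z z 1≤q) (m≤m+n _ _)))

  -- A further factor of degree below q, the derivative of a_{p+1}, costs no more than one missing
  -- letter gains; hence `suc z`.
  degree-bound₁ : ∀ {q b v z D} → 1 ≤ q → 2 * b + 2 ≤ 2 * q + suc z → q * suc (v + suc z) ≤ D →
    suc (q + (b + q * v)) ≤ D
  degree-bound₁ {q} {b} {v} {z} {D} 1≤q h le = ≤-trans
      (≤-trans (≤-reflexive (eq₀ q b v)) (≤-trans (+-monoʳ-≤ (q + q * v) key) (≤-reflexive (eq₁ q v z)))) le
    where
      eq₀ : ∀ q b v → suc (q + (b + q * v)) ≡ (q + q * v) + suc b
      eq₀ = ℕSolver.solve-∀
      eq₁ : ∀ q v z → (q + q * v) + q * suc z ≡ q * suc (v + suc z)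
      eq₁ = ℕSolver.solve-∀
      eq₂ : ∀ q z → 2 * (q * suc z) + 2 ≡ suc (suc (q * z + (q * z))) + 2 * q
      eq₂ = ℕSolver.solve-∀
      key : suc b ≤ q * suc z
      key with suc b ℕₚ.≤? q * suc z
      ... | yes p = p
      ... | no ¬p = ⊥-elim (<⇒≱ (s≤s⁻¹ (+-cancelʳ-≤ (2 * q) _ _ (≤-trans (≤-reflexive (sym (eq₂ q z)))
        (≤-trans (+-monoˡ-≤ 2 (*-monoʳ-≤ 2 (s≤s⁻¹ (≰⇒> ¬p)))) (≤-trans h (≤-reflexive (ℕₚ.+-comm (2 * q) (suc z))))))))
        (≤-trans (z≤q*z z 1≤q) (m≤m+n _ _)))

  Monic-term : ∀ p b es → Monic (b + 2 ^ p * binary es) (X ^ₚ b ⊗ word (suc p) es)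
  Monic-term p b es = Monic-⊗ (Monic-X^ b) (Monic-word p es)

  missing : ∀ {es} → All (_≤ 1) es → ∃ λ z → sum es + z ≡ length es
  missing s = _ , m+[n∸m]≡n (sum≤length s)

  word-degree : ∀ p j {es z} → All (_≤ 1) es → length es ≡ suc j → sum es + z ≡ length es →
    2 ^ p * suc (binary es + z) ≤ 2 ^ (p + suc j)
  word-degree p j {es} {z} s len e = ≤-trans (*-monoʳ-≤ (2 ^ p) (binary-small s z e))
    (≤-reflexive (trans (cong (λ l → 2 ^ p * 2 ^ l) len) (sym (^-distribˡ-+-* 2 p (suc j)))))

  -- `W + 2 ≤ 2 * q` is the source of the range n j ≤ 2^{m-1} - 2, with W = n j, q = 2^p and m = p +
  -- 2. The slack c is 1 for words without a derivative factor and 0 for those with one.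
  weight-small : ∀ {b S W k z q} c → 2 * b + (c + S) ≤ W + k → W + 2 ≤ 2 * q → S + z ≡ k →
    2 * b + (c + 2) ≤ 2 * q + z
  weight-small {b} {S} {W} {k} {z} {q} c h Wq refl = +-cancelʳ-≤ S _ _
    (≤-trans (≤-reflexive (eq₁ b c S)) (≤-trans (+-monoˡ-≤ 2 h)
      (≤-trans (≤-reflexive (eq₂ W S z)) (≤-trans (+-monoˡ-≤ (z + S) Wq) (≤-reflexive (sym (ℕₚ.+-assoc (2 * q) z S)))))))
    where
      eq₁ : ∀ b c S → 2 * b + (c + 2) + S ≡ 2 * b + (c + S) + 2
      eq₁ = ℕSolver.solve-∀
      eq₂ : ∀ W S z → W + (S + z) + 2 ≡ (W + 2) + (z + S)
      eq₂ = ℕSolver.solve-∀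

  lower₁ : ∀ {b S S′ N} c → S ≡ suc S′ → 2 * b + (c + S) ≤ N → 2 * b + (c + S′) ≤ N
  lower₁ {b} {S} {S′} c refl h = ≤-trans (+-monoʳ-≤ (2 * b) (+-monoʳ-≤ c (n≤1+n S′))) h

  lower₂ : ∀ {b S S′ N} c → S ≡ suc (suc S′) → 2 * b + (c + S) ≤ N → 2 * suc b + (c + S′) ≤ N
  lower₂ {b} {S} {S′} c refl h = ≤-trans (≤-reflexive (eq b c S′)) h
    where eq : ∀ b c S → 2 * suc b + (c + S) ≡ 2 * b + (c + suc (suc S))
          eq = ℕSolver.solve-∀

  length-top : ∀ (pre : List ℕ) {e} → length (pre ++ e ∷ []) ≡ suc (length pre)
  length-top []        = refl
  length-top (_ ∷ pre) = cong suc (length-top pre)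

  -- By induction on the total exponent, the degree bound for squarefree words extends to all words of small weight
  -- (each a_i weighing 1 and c weighing 2).
  module Stable (j W : ℕ) where

    vanish : ∀ p → W + 2 ≤ 2 * 2 ^ p → ∀ n b es → sum es < n → length es ≡ suc j →
      2 * b + (1 + sum es) ≤ W + suc j → res p j (term (suc p) b es 1ₚ) ≡ 0ℤ
    vanish p Wq (suc n) b es lt len h with split es
    ... | small s = let z , e = missing s in
      res-vanish (Monic-term p b es) (Monic⇒Deg< Monic-1)
        (degree-bound₀ {q = 2 ^ p} {v = binary es} {z = z} (ℕₚ.m^n>0 2 p) (weight-small {b} {z = z} {2 ^ p} 1 h Wq (trans e len)) (word-degree p j {z = z} s len e))
      where open Residue p j
    ... | mid pre e f post = trans (res-mid (suc p) b pre e f post 1ₚ) (cong₂ ℤ._-_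
        (vanish p Wq n b (pre ++ e ∷ suc f ∷ post) (≤-trans (≤-reflexive (sym s₁)) (s≤s⁻¹ lt)) (trans (length-replace pre refl) len) (lower₁ {b} 1 s₁ h))
        (vanish p Wq n (suc b) (pre ++ e ∷ f ∷ post) (≤-trans (n≤1+n _) (≤-trans (≤-reflexive (sym s₂)) (s≤s⁻¹ lt))) (trans (length-replace pre refl) len) (lower₂ {b} 1 s₂ h)))
      where open Reduction p j
            s₁ = sum-mid pre e f post
            s₂ = sum-lower pre e (f ∷ post)
    ... | top pre e = trans (res-word-top {i = 0} b pre e 1ₚ (cong (suc p ℕ.+_) (ℕₚ.suc-injective (trans (sym (length-top pre)) len))) refl 0<) (cong₂ (λ x y → ℤ.- x ℤ.- y)
        (vanish p Wq n b (increment 0 es′) (≤-trans (≤-reflexive (sym s₁)) (s≤s⁻¹ lt)) (trans (length-increment 0 es′) len′) (lower₁ {b} 1 s₁ h))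
        (vanish p Wq n (suc b) es′ (≤-trans (n≤1+n _) (≤-trans (≤-reflexive (sym s₂)) (s≤s⁻¹ lt))) len′ (lower₂ {b} 1 s₂ h)))
      where open Reduction p j
            es′ = pre ++ e ∷ []
            len′ : length es′ ≡ suc j
            len′ = trans (length-replace pre refl) len
            0< : 0 < length es′
            0< = subst (0 <_) (sym len′) z<s
            s₂ = sum-lower pre e []
            s₁ = trans s₂ (cong suc (sym (sum-increment 0 es′ 0<)))

  -- The full squarefree word

  ones : ℕ → List ℕ
  ones k = replicate k 1

  binary-ones : ∀ k → suc (binary (ones k)) ≡ 2 ^ k
  binary-ones zero    = refl
  binary-ones (suc k) = trans (eq (binary (ones k))) (cong (2 ℕ.*_) (binary-ones k))
    where eq : ∀ b → suc (suc (2 * b)) ≡ 2 * suc b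
          eq = ℕSolver.solve-∀

  all-ones : ∀ {es} → All (_≤ 1) es → sum es ≡ length es → es ≡ ones (length es)
  all-ones []                 e = refl
  all-ones (s≤s z≤n ∷ s)      e = cong (1 ∷_) (all-ones s (ℕₚ.suc-injective e))
  all-ones {_ ∷ es} (z≤n ∷ s) e = ⊥-elim (<-irrefl e (s≤s (sum≤length s)))

  word-ones-shift : ∀ s k → word s (ones k) ⊗ aPoly (s + k) ≈ₚ aPoly s ⊗ word (suc s) (ones k)
  word-ones-shift s zero    rewrite ℕₚ.+-identityʳ s = ℤ[c].*-comm 1ₚ (aPoly s)
  word-ones-shift s (suc k) = ℤ[c].trans
      (ℤ[c].trans (solve 4 (λ a e w b → ((a :* e) :* w) :* b := (a :* e) :* (w :* b)) ℤ[c].refl (aPoly s) 1ₚ (word (suc s) (ones k)) (aPoly (s + suc k)))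
        (ℤ[c].*-congˡ {aPoly s ⊗ 1ₚ} (subst (λ i → word (suc s) (ones k) ⊗ aPoly i ≈ₚ aPoly (suc s) ⊗ word (suc (suc s)) (ones k)) (sym (ℕₚ.+-suc s k)) (word-ones-shift (suc s) k))))
      (solve 4 (λ a e w b → (a :* e) :* (b :* w) := a :* ((b :* e) :* w)) ℤ[c].refl (aPoly s) 1ₚ (word (suc (suc s)) (ones k)) (aPoly (suc s)))
    where open ℤ[c]-Solver

  -- Compares M′ a′_{s+1} / F_{s+1} with 2 M a′_s / F_s, where M = a_s ⋯ a_{s+j}, M′ = a_{s+1} ⋯ a_{s+j+1} and s = p + 1,
  -- over the common denominator: the difference of the numerators has small degree.
  module FullWord (p j b : ℕ) (b< : suc b ≤ 2 ^ p) where
    private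
      s = suc p
      q = 2 ^ p
      D = 2 ^ (p + suc j)
      D₁ = 2 ^ (suc p + suc j)
      F₀ = F p j
      F₁ = F (suc p) j
      A = aPoly s
      B = aPoly (s + suc j)
      M = word s (ones (suc j))
      M′ = word (suc s) (ones (suc j))
      x = X ^ₚ b
      d = da s

      common : Inverse (D + D₁) (F₀ ⊗ F₁)
      common = inverse (Monic-⊗ (Monic-a+a p j) (Monic-a+a (suc p) j))
      open Inverse common

      D₁≡ : D₁ ≡ D + D
      D₁≡ = cong (D ℕ.+_) (ℕₚ.+-identityʳ D)

      qD : q * 2 ^ suc j ≡ D
      qD = sym (^-distribˡ-+-* 2 p (suc j))

      -- 1/F₀ = F₁ / (F₀ F₁), by uniqueness of expansions.
      via-F₁ : ∀ h → res p j h ≡ act (h ⊗ F₁) seq 1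
      via-F₁ h = trans (act-cong h (unique (Monic-a+a p j)
          (λ n → trans (Inverse.inv (1/F p j) n) (trans (sym (inv n)) (act-⊗ F₀ F₁ seq n)))
          (Inverse.van (1/F p j))
          (act-Van (Monic⇒Deg< (Monic-a+a (suc p) j)) (subst (λ N → Van N seq) (ℕₚ.+-comm D D₁) van))) 1)
        (sym (act-⊗ h F₁ seq 1))

      via-F₀ : ∀ h → res (suc p) j h ≡ act (h ⊗ F₀) seq 1
      via-F₀ h = trans (act-cong h (unique (Monic-a+a (suc p) j)
          (λ n → trans (Inverse.inv (1/F (suc p) j) n) (trans (sym (inv n)) (trans (act-⊗ F₀ F₁ seq n) (act-comm F₀ F₁ seq n))))
          (Inverse.van (1/F (suc p) j))
          (act-Van (Monic⇒Deg< (Monic-a+a p j)) van)) 1)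
        (sym (act-⊗ h F₀ seq 1))

      negligible : ∀ {m e Q} → Monic m (x ⊗ M) → Deg< (suc e) Q → suc (e + (q + m)) ≤ D + D₁ → act ((x ⊗ M) ⊗ (d ⊗ Q)) seq 1 ≡ 0ℤ
      negligible {m} {e} {Q} Mm DQ le = trans (act-⊗ (x ⊗ M) (d ⊗ Q) seq 1) (trans (act-cong (x ⊗ M) (act-⊗ d Q seq) 1)
        (act-Van (Monic⇒Deg< Mm) {n = 2} (subst (λ n → Van n (act d (act Q seq))) (eq₁ m)
          (act-Van< (Deg<-da p) {n = suc m} (act-Van DQ (Van-mono (≤-trans (≤-reflexive (eq₂ e q m)) le) van)))) 1 (s≤s (s≤s z≤n))))
        where
          eq₁ : ∀ m → suc (suc m) ≡ m + 2
          eq₁ = ℕSolver.solve-∀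
          eq₂ : ∀ e q m → e + (q + suc m) ≡ suc (e + (q + m))
          eq₂ = ℕSolver.solve-∀

      bin = binary (ones (suc j))

      q+qv : q + q * bin ≡ D
      q+qv = trans (trans (sym (ℕₚ.*-suc q bin)) (cong (q ℕ.*_) (binary-ones (suc j)))) qD

      2q≤D : q + q ≤ D
      2q≤D = ≤-trans (≤-reflexive (cong (q ℕ.+_) (sym (ℕₚ.+-identityʳ q))))
        (≤-trans (^-monoʳ-≤ 2 (≤-trans (m≤m+n (suc p) j) (≤-reflexive (sym (ℕₚ.+-suc p j))))) ≤-refl)

      error₁ : act ((x ⊗ M) ⊗ (d ⊗ (B ⊗ A))) seq 1 ≡ 0ℤ
      error₁ = negligible (Monic-⊗ (Monic-X^ b) (Monic-word p (ones (suc j)))) (Monic⇒Deg< (Monic-⊗ (Monic-a (p + suc j)) (Monic-a p)))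
        (≤-trans (≤-reflexive (eq D q b (q * bin))) (≤-trans
          (+-monoʳ-≤ D (+-mono-≤ (≤-reflexive q+qv) (≤-trans (+-monoʳ-≤ q b<) 2q≤D))) (≤-reflexive (cong (D ℕ.+_) (sym D₁≡)))))
        where eq : ∀ D q b w → suc ((D + q) + (q + (b + w))) ≡ D + ((q + w) + (q + suc b))
              eq = ℕSolver.solve-∀

      error₂ : act ((x ⊗ M) ⊗ (d ⊗ (A ⊗ A ⊕ (X ⊕ X)))) seq 1 ≡ 0ℤ
      error₂ = negligible (Monic-⊗ (Monic-X^ b) (Monic-word p (ones (suc j))))
        (Deg<-⊕ (Monic⇒Deg< (Monic-⊗ (Monic-a p) (Monic-a p))) (Deg<-⊕ X-small X-small))
        (≤-trans (≤-reflexive (eq q b (q * bin))) (≤-trans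
          (+-mono-≤ 2q≤D (+-mono-≤ (≤-reflexive q+qv) (≤-trans b< (≤-trans (m≤m+n q q) 2q≤D)))) (≤-reflexive (cong (D ℕ.+_) (sym D₁≡)))))
        where eq : ∀ q b w → suc ((q + q) + (q + (b + w))) ≡ (q + q) + ((q + w) + suc b)
              eq = ℕSolver.solve-∀
              X-small : Deg< (suc (q + q)) X
              X-small = Deg<-X (s≤s (≤-trans (ℕₚ.m^n>0 2 p) (m≤m+n q q)))

      error₃ : act (x ⊗ M′ ⊗ F₀) seq 1 ≡ 0ℤ
      error₃ = act-Van (Monic⇒Deg< (Monic-⊗ (Monic-⊗ (Monic-X^ b) (Monic-word (suc p) (ones (suc j)))) (Monic-a+a p j))) {n = 2}
        (Van-mono (≤-trans (≤-reflexive (eq₁ b q bin D)) (≤-trans (+-monoʳ-≤ (D + 2 * (q * bin)) (+-mono-≤ b< (≤-trans (ℕₚ.m^n>0 2 p) ≤-refl)))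
          (≤-reflexive (trans (eq₂ D q (q * bin)) (trans (cong (λ u → D + (u + u)) q+qv) (cong (D ℕ.+_) (sym D₁≡))))))) van) 1 (s≤s (s≤s z≤n))
        where
          eq₁ : ∀ b q v D → b + (2 * q) * v + D + 2 ≡ D + 2 * (q * v) + (suc b + 1)
          eq₁ = ℕSolver.solve-∀
          eq₂ : ∀ D q w → D + 2 * w + (q + q) ≡ D + ((q + w) + (q + w))
          eq₂ = ℕSolver.solve-∀

      h₁ = (x ⊗ M′) ⊗ da (suc s)
      h₀ = (x ⊗ M) ⊗ d
      E₁ = (x ⊗ M) ⊗ (d ⊗ (B ⊗ A))
      E₂ = (x ⊗ M) ⊗ (d ⊗ (A ⊗ A ⊕ (X ⊕ X)))
      E₃ = x ⊗ M′ ⊗ F₀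

      -- By a′_{s+1} = 2 A d + 1 and A M′ = M B the left side is 2 x d M B (B + A) + E₃, and B (B +
      -- A) = F₁ + B A - (A² + 2c) because F₁ = B² + A² + 2c.
      numerators : h₁ ⊗ F₀ ≈ₚ (h₀ ⊗ F₁ ⊕ h₀ ⊗ F₁) ⊕ (((E₁ ⊕ E₁) ⊕ ⊝ (E₂ ⊕ E₂)) ⊕ E₃)
      numerators = begin
        ((x ⊗ M′) ⊗ da (suc s)) ⊗ (B ⊕ A)
          ≈⟨ ℤ[c].*-congʳ {B ⊕ A} (ℤ[c].*-congˡ {x ⊗ M′} (da-suc s)) ⟩
        ((x ⊗ M′) ⊗ ((A ⊗ d ⊕ A ⊗ d) ⊕ 1ₚ)) ⊗ (B ⊕ A)
          ≈⟨ solve 5 (λ x m a d b → ((x :* m) :* ((a :* d :+ a :* d) :+ con 1ℤ)) :* (b :+ a)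
               := (x :* d :* (a :* m) :+ x :* d :* (a :* m)) :* (b :+ a) :+ (x :* m) :* (b :+ a)) ℤ[c].refl x M′ A d B ⟩
        (x ⊗ d ⊗ (A ⊗ M′) ⊕ x ⊗ d ⊗ (A ⊗ M′)) ⊗ (B ⊕ A) ⊕ E₃
          ≈⟨ ℤ[c].+-congʳ {E₃} (ℤ[c].*-congʳ {B ⊕ A} (ℤ[c].+-cong am am)) ⟩
        (x ⊗ d ⊗ (M ⊗ B) ⊕ x ⊗ d ⊗ (M ⊗ B)) ⊗ (B ⊕ A) ⊕ E₃
          ≈⟨ ℤ[c].+-congʳ {E₃} (solve 6 (λ x d m b a c → (x :* d :* (m :* b) :+ x :* d :* (m :* b)) :* (b :+ a) :=
               (x :* m :* d :* ((b :* b :+ c) :+ (a :* a :+ c)) :+ x :* m :* d :* ((b :* b :+ c) :+ (a :* a :+ c)))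
               :+ (((x :* m) :* (d :* (b :* a)) :+ (x :* m) :* (d :* (b :* a))) :- ((x :* m) :* (d :* (a :* a :+ (c :+ c))) :+ (x :* m) :* (d :* (a :* a :+ (c :+ c)))))) ℤ[c].refl x d M B A X) ⟩
        ((h₀ ⊗ F₁ ⊕ h₀ ⊗ F₁) ⊕ ((E₁ ⊕ E₁) ⊕ ⊝ (E₂ ⊕ E₂))) ⊕ E₃
          ≈⟨ ℤ[c].+-assoc (h₀ ⊗ F₁ ⊕ h₀ ⊗ F₁) _ E₃ ⟩
        (h₀ ⊗ F₁ ⊕ h₀ ⊗ F₁) ⊕ (((E₁ ⊕ E₁) ⊕ ⊝ (E₂ ⊕ E₂)) ⊕ E₃) ∎
        where
          open ℤ[c]-Reasoning
          open ℤ[c]-Solver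
          am : x ⊗ d ⊗ (A ⊗ M′) ≈ₚ x ⊗ d ⊗ (M ⊗ B)
          am = ℤ[c].*-congˡ {x ⊗ d} (ℤ[c].sym (word-ones-shift s (suc j)))

    doubles : res (suc p) j (term (suc s) b (ones (suc j)) (da (suc s))) ≡ + 2 ℤ.* res p j (term s b (ones (suc j)) (da s))
    doubles = trans (via-F₀ h₁) (trans (Everything.on numerators tt 1) (trans (split₁) (trans
        (cong₂ (λ u w → u ℤ.+ u ℤ.+ w) (sym (via-F₁ h₀)) errors) (double (res p j h₀)))))
      where
        double : ∀ u → u ℤ.+ u ℤ.+ 0ℤ ≡ + 2 ℤ.* u
        double = ℤSolver.solve-∀
        rest = ((E₁ ⊕ E₁) ⊕ ⊝ (E₂ ⊕ E₂)) ⊕ E₃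
        split₁ : act ((h₀ ⊗ F₁ ⊕ h₀ ⊗ F₁) ⊕ rest) seq 1 ≡ act (h₀ ⊗ F₁) seq 1 ℤ.+ act (h₀ ⊗ F₁) seq 1 ℤ.+ act rest seq 1
        split₁ = trans (act-⊕ (h₀ ⊗ F₁ ⊕ h₀ ⊗ F₁) rest seq 1) (cong (ℤ._+ act rest seq 1) (act-⊕ (h₀ ⊗ F₁) (h₀ ⊗ F₁) seq 1))
        errors : act rest seq 1 ≡ 0ℤ
        errors = trans (act-⊕ ((E₁ ⊕ E₁) ⊕ ⊝ (E₂ ⊕ E₂)) E₃ seq 1) (cong₂ ℤ._+_
          (trans (act-⊕ (E₁ ⊕ E₁) (⊝ (E₂ ⊕ E₂)) seq 1) (cong₂ ℤ._+_
            (trans (act-⊕ E₁ E₁ seq 1) (cong₂ ℤ._+_ error₁ error₁))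
            (trans (act-map-neg (E₂ ⊕ E₂) seq 1) (cong (ℤ.-_) (trans (act-⊕ E₂ E₂ seq 1) (cong₂ ℤ._+_ error₂ error₂))))))
          error₃)

  -- Doubling of traces

  module Doubling (j W : ℕ) where

    module _ (p : ℕ) (Wq : W + 2 ≤ 2 * 2 ^ p) where

      Wq′ : W + 2 ≤ 2 * 2 ^ suc p
      Wq′ = ≤-trans Wq (*-monoʳ-≤ 2 (m≤m+n (2 ^ p) _))

      -- The rewriting rules look the same for p and p + 1, so it suffices to compare squarefree
      -- words: the full one by `FullWord.doubles`, while the others vanish on both sides.
      doubling : ∀ n b es → sum es < n → length es ≡ suc j → 2 * b + sum es ≤ W + suc j →
        res (suc p) j (term (suc (suc p)) b es (da (suc (suc p)))) ≡ + 2 ℤ.* res p j (term (suc p) b es (da (suc p)))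
      doubling (suc n) b es lt len h with split es
      ... | small s with missing s
      ...   | zero , e = subst (λ es → res (suc p) j (term (suc (suc p)) b es (da (suc (suc p)))) ≡ + 2 ℤ.* res p j (term (suc p) b es (da (suc p))))
          (sym (trans (all-ones s (trans (sym (ℕₚ.+-identityʳ _)) e)) (cong ones len)))
          (FullWord.doubles p j b (*-cancelˡ-≤ 2 (≤-trans (≤-reflexive (eq b)) (≤-trans
            (weight-small {b} {sum es} {W} {suc j} {0} {2 ^ p} 0 h Wq (trans e len)) (≤-reflexive (ℕₚ.+-identityʳ _))))))
        where eq : ∀ b → 2 * suc b ≡ 2 * b + 2
              eq = ℕSolver.solve-∀
      ...   | suc z , e = trans (none (suc p) Wq′) (sym (trans (cong (ℤ._*_ (+ 2)) (none p Wq)) refl))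
        where none : ∀ p → W + 2 ≤ 2 * 2 ^ p → res p j (term (suc p) b es (da (suc p))) ≡ 0ℤ
              none p Wq = Residue.res-vanish p j (Monic-term p b es) (Deg<-da p)
                (degree-bound₁ {q = 2 ^ p} {v = binary es} {z = z} (ℕₚ.m^n>0 2 p)
                  (weight-small {b} {sum es} {W} {suc j} {suc z} {2 ^ p} 0 h Wq (trans e len)) (word-degree p j {z = suc z} s len e))
      doubling (suc n) b es lt len h | mid pre e f post = trans (Reduction.res-mid (suc p) j (suc (suc p)) b pre e f post (da (suc (suc p))))
        (trans (cong₂ ℤ._-_
          (doubling n b (pre ++ e ∷ suc f ∷ post) (≤-trans (≤-reflexive (sym s₁)) (s≤s⁻¹ lt)) (trans (length-replace pre refl) len) (lower₁ {b} 0 s₁ h))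
          (doubling n (suc b) (pre ++ e ∷ f ∷ post) (≤-trans (n≤1+n _) (≤-trans (≤-reflexive (sym s₂)) (s≤s⁻¹ lt))) (trans (length-replace pre refl) len) (lower₂ {b} 0 s₂ h)))
        (trans (distrib (res p j (term (suc p) b (pre ++ e ∷ suc f ∷ post) (da (suc p)))) (res p j (term (suc p) (suc b) (pre ++ e ∷ f ∷ post) (da (suc p))))) (cong (ℤ._*_ (+ 2)) (sym (Reduction.res-mid p j (suc p) b pre e f post (da (suc p)))))))
        where s₁ = sum-mid pre e f post
              s₂ = sum-lower pre e (f ∷ post)
              distrib : ∀ u v → + 2 ℤ.* u ℤ.- + 2 ℤ.* v ≡ + 2 ℤ.* (u ℤ.- v)
              distrib = ℤSolver.solve-∀
      doubling (suc n) b es lt len h | top pre e = trans (Reduction.res-word-top (suc p) j {i = 0} b pre e (da (suc (suc p))) (end (suc p)) refl 0<)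
        (trans (cong₂ (λ x y → ℤ.- x ℤ.- y)
          (doubling n b (increment 0 es′) (≤-trans (≤-reflexive (sym s₁)) (s≤s⁻¹ lt)) (trans (length-increment 0 es′) len′) (lower₁ {b} 0 s₁ h))
          (doubling n (suc b) es′ (≤-trans (n≤1+n _) (≤-trans (≤-reflexive (sym s₂)) (s≤s⁻¹ lt))) len′ (lower₂ {b} 0 s₂ h)))
        (trans (distrib (res p j (term (suc p) b (increment 0 es′) (da (suc p)))) (res p j (term (suc p) (suc b) es′ (da (suc p))))) (cong (ℤ._*_ (+ 2)) (sym (Reduction.res-word-top p j {i = 0} b pre e (da (suc p)) (end p) refl 0<)))))
        where es′ = pre ++ e ∷ []
              len′ : length es′ ≡ suc j
              len′ = trans (length-replace pre refl) len
              end : ∀ p → suc p + length pre ≡ suc p + j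
              end p = cong (suc p ℕ.+_) (ℕₚ.suc-injective (trans (sym (length-top pre)) len))
              0< : 0 < length es′
              0< = subst (0 <_) (sym len′) z<s
              s₂ = sum-lower pre e []
              s₁ = trans s₂ (cong suc (sym (sum-increment 0 es′ 0<)))
              distrib : ∀ u v → ℤ.- (+ 2 ℤ.* u) ℤ.- + 2 ℤ.* v ≡ + 2 ℤ.* (ℤ.- u ℤ.- v)
              distrib = ℤSolver.solve-∀

      private
        -- a′_{i+1} = 2 a_i a_i′ + 1 trades one derivative index for one letter. The k steps from
        -- a′_{s+k} down to a′_s thus add k to the weight, whence the bound W + k throughout.
        unfold-da : ∀ p r es → r < length es →
          res p j (term (suc p) 0 es (da (suc (suc p + r)))) ≡
          + 2 ℤ.* res p j (term (suc p) 0 (increment r es) (da (suc p + r))) ℤ.+ res p j (term (suc p) 0 es 1ₚ)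
        unfold-da p r es r< = trans (res-≈ step) (trans (res-⊕ (T ⊕ T) _) (trans (cong (ℤ._+ res p j (term (suc p) 0 es 1ₚ)) (res-⊕ T T))
            (double (res p j T) _)))
          where
            open Residue p j
            open ℤ[c]-Solver
            T = term (suc p) 0 (increment r es) (da (suc p + r))
            double : ∀ u v → u ℤ.+ u ℤ.+ v ≡ + 2 ℤ.* u ℤ.+ v
            double = ℤSolver.solve-∀
            inc : aPoly (suc p + r) ⊗ word (suc p) es ≈ₚ word (suc p) (increment r es)
            inc = ℤ[c].sym (subst (λ i → word (suc p) (increment r es) ≈ₚ aPoly i ⊗ word (suc p) es) (ℕₚ.+-comm r (suc p)) (word-increment (suc p) r es r<))
            a = aPoly (suc p + r)
            w = word (suc p) es
            d = da (suc p + r)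
            w′ = word (suc p) (increment r es)
            step : term (suc p) 0 es (da (suc (suc p + r))) ≈ₚ (T ⊕ T) ⊕ term (suc p) 0 es 1ₚ
            step = ℤ[c].trans (ℤ[c].*-congˡ {1ₚ ⊗ w} (da-suc (suc p + r)))
              (ℤ[c].trans (solve 4 (λ e w a d → (e :* w) :* ((a :* d :+ a :* d) :+ con 1ℤ) :=
                  ((e :* (a :* w)) :* d :+ (e :* (a :* w)) :* d) :+ (e :* w) :* con 1ℤ) ℤ[c].refl 1ₚ w a d)
                (ℤ[c].+-congʳ {term (suc p) 0 es 1ₚ} (ℤ[c].+-cong inc′ inc′)))
              where inc′ : (1ₚ ⊗ (a ⊗ w)) ⊗ d ≈ₚ (1ₚ ⊗ w′) ⊗ d
                    inc′ = ℤ[c].*-congʳ {d} (ℤ[c].*-congˡ {1ₚ} inc)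

        -- The summand 1 in a′_{i+1} leaves a word without derivative, killed by `Stable.vanish` on
        -- both sides.
        doubling-da : ∀ r es → r ≤ suc j → length es ≡ suc j → r + sum es ≤ W + suc j →
          res (suc p) j (term (suc (suc p)) 0 es (da (suc (suc p) + r))) ≡ + 2 ℤ.* res p j (term (suc p) 0 es (da (suc p + r)))
        doubling-da zero es _ len h rewrite ℕₚ.+-identityʳ p = doubling (suc (sum es)) 0 es ≤-refl len h
        doubling-da (suc r) es r≤ len h rewrite ℕₚ.+-suc p r = trans (unfold-da (suc p) r es r<)
            (trans (cong₂ (λ u v → + 2 ℤ.* u ℤ.+ v)
              (doubling-da r (increment r es) (≤-trans (n≤1+n r) r≤) (trans (length-increment r es) len)
                (≤-trans (≤-reflexive (trans (cong (r ℕ.+_) (sum-increment r es r<)) (ℕₚ.+-suc r (sum es)))) h))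
              (none (suc p) Wq′))
            (trans (factor u) (cong (ℤ._*_ (+ 2)) (trans (cong (ℤ._+_ (+ 2 ℤ.* u)) (sym (none p Wq))) (sym (unfold-da p r es r<))))))
          where
            u = res p j (term (suc p) 0 (increment r es) (da (suc p + r)))
            r< : r < length es
            r< = ≤-trans r≤ (≤-reflexive (sym len))
            none : ∀ p → W + 2 ≤ 2 * 2 ^ p → res p j (term (suc p) 0 es 1ₚ) ≡ 0ℤ
            none p Wq = Stable.vanish j W p Wq (suc (sum es)) 0 es ≤-refl len (≤-trans (s≤s (m≤n+m (sum es) r)) h)
            factor : ∀ u → + 2 ℤ.* (+ 2 ℤ.* u) ℤ.+ 0ℤ ≡ + 2 ℤ.* (+ 2 ℤ.* u ℤ.+ 0ℤ)
            factor = ℤSolver.solve-∀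

      res-doubles : ∀ es → length es ≡ suc j → suc j + sum es ≤ W + suc j →
        res (suc p) j (word (suc (suc p)) es ⊗ deriv (F (suc p) j)) ≡ + 2 ℤ.* res p j (word (suc p) es ⊗ deriv (F p j))
      res-doubles es len h = trans (parts (suc p)) (trans (cong₂ ℤ._+_
          (doubling-da (suc j) es ≤-refl len h)
          (doubling (suc (sum es)) 0 es ≤-refl len (≤-trans (m≤n+m (sum es) (suc j)) h)))
        (trans (sym (ℤₚ.*-distribˡ-+ (+ 2) (res p j (term (suc p) 0 es (da (suc p + suc j)))) (res p j (term (suc p) 0 es (da (suc p)))))) (cong (ℤ._*_ (+ 2)) (sym (parts p)))))
        where
          parts : ∀ p → res p j (word (suc p) es ⊗ deriv (F p j)) ≡
            res p j (term (suc p) 0 es (da (suc p + suc j))) ℤ.+ res p j (term (suc p) 0 es (da (suc p)))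
          parts p = trans (res-≈ (ℤ[c].trans (ℤ[c].*-congˡ {w} (Everything.acts λ {y} _ n →
                trans (deriv-⊕ (aPoly (suc p + suc j)) (aPoly (suc p)) y n) (sym (act-⊕ d d′ y n))))
              (solve 3 (λ w d d′ → w :* (d :+ d′) := (con 1ℤ :* w) :* d :+ (con 1ℤ :* w) :* d′) ℤ[c].refl w d d′)))
              (res-⊕ (term (suc p) 0 es d) (term (suc p) 0 es d′))
            where open Residue p j
                  open ℤ[c]-Solver
                  w = word (suc p) es
                  d = da (suc p + suc j)
                  d′ = da (suc p)

  -- The multiplier modulo F

  constant : ℤ → Poly
  constant z = z ∷ []

  act-constant : ∀ z y n → act (constant z) y n ≡ z ℤ.* y n
  act-constant z y n = ℤₚ.+-identityʳ _

  word-++ : ∀ s m n → word s (ones (m + n)) ≈ₚ word s (ones m) ⊗ word (s + m) (ones n)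
  word-++ s zero    n rewrite ℕₚ.+-identityʳ s = ℤ[c].sym (ℤ[c].*-identityˡ (word s (ones n)))
  word-++ s (suc m) n rewrite ℕₚ.+-suc s m = ℤ[c].trans (ℤ[c].*-congˡ {aPoly s ^ₚ 1} (word-++ (suc s) m n))
    (ℤ[c].sym (ℤ[c].*-assoc (aPoly s ^ₚ 1) (word (suc s) (ones m)) _))

  word-replicate : ∀ s k N → word s (ones k) ^ₚ N ≈ₚ word s (replicate k N)
  word-replicate s zero    N = 1^ N
    where 1^ : ∀ N → 1ₚ ^ₚ N ≈ₚ 1ₚ
          1^ zero    = ℤ[c].refl
          1^ (suc N) = ℤ[c].trans (ℤ[c].*-identityˡ _) (1^ N)
  word-replicate s (suc k) N = ℤ[c].trans (^-distrib-* (aPoly s ^ₚ 1) (word (suc s) (ones k)) N)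
    (ℤ[c].*-cong (^-congˡ N (ℤ[c].*-identityʳ (aPoly s))) (word-replicate (suc s) k N))

  ⊝-^ : ∀ P N → (⊝ P) ^ₚ N ≈ₚ constant (negOnePow N) ⊗ P ^ₚ N
  ⊝-^ P zero    = ℤ[c].sym (ℤ[c].*-identityˡ 1ₚ)
  ⊝-^ P (suc N) = ℤ[c].trans (ℤ[c].*-congˡ {⊝ P} (⊝-^ P N))
    (ℤ[c].trans (solve 3 (λ p c q → (:- p) :* (c :* q) := (:- c) :* (p :* q)) ℤ[c].refl P (constant (negOnePow N)) (P ^ₚ N)) ℤ[c].refl)
    where open ℤ[c]-Solver

  -- λ_{m,n} without its factor 2^n, where m = p + 2.
  u : ℕ → ℕ → Poly
  u p n = word (suc (suc p)) (ones n)

  trace : ℕ → ℕ → Poly → ℤ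
  trace p j h = res p j (h ⊗ deriv (F p j))

  module Multiplier (p j : ℕ) where
    open Residue p j

    private
      s = suc p
      k = suc j
      M = word s (ones k)

    -- a_{s+k} ≡ - a_s, and the next squaring removes the sign.
    a-periodic : ∀ i → aPoly (suc (suc s + j) + i) ≈F aPoly (suc s + i)
    a-periodic zero rewrite ℕₚ.+-identityʳ (p + j) | ℕₚ.+-identityʳ p = ring.trans
      (ring.+-congʳ {X} (ring.*-cong a-wrap a-wrap))
      (mod (solve 2 (λ a x → (:- a) :* (:- a) :+ x := a :* a :+ x) ℤ[c].refl (aPoly s) X))
      where open ℤ[c]-Solver
    a-periodic (suc i) rewrite ℕₚ.+-suc (p + j) i | ℕₚ.+-suc p i =
      ring.+-congʳ {X} (ring.*-cong (a-periodic i) (a-periodic i))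

    word-periodic : ∀ i n → word (suc (suc s + j) + i) (ones n) ≈F word (suc s + i) (ones n)
    word-periodic i zero    = ring.refl
    word-periodic i (suc n) = ring.*-cong (ring.*-congʳ {1ₚ} (a-periodic i))
      (subst₂′ (λ x y → word x (ones n) ≈F word y (ones n)) (ℕₚ.+-suc (suc (suc s + j)) i) (ℕₚ.+-suc (suc s) i) (word-periodic (suc i) n))
      where subst₂′ : ∀ (P : ℕ → ℕ → Set) {a b c d} → a ≡ b → c ≡ d → P a c → P b d
            subst₂′ P refl refl x = x

    private
      period : word (suc s) (ones k) ≈F ⊝ M
      period = ring.trans (mod (subst (λ i → word (suc s) (ones i) ≈ₚ word (suc s) (ones j) ⊗ word (suc s + j) (ones 1)) (ℕₚ.+-comm j 1) (word-++ (suc s) j 1)))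
        (ring.trans (ring.*-congˡ {word (suc s) (ones j)} (ring.*-congʳ {1ₚ} (ring.*-congʳ {1ₚ} a-wrap)))
          (mod (solve 2 (λ w a → w :* (((:- a) :* con 1ℤ) :* con 1ℤ) := :- ((a :* con 1ℤ) :* w)) ℤ[c].refl (word (suc s) (ones j)) (aPoly s))))
        where open ℤ[c]-Solver

    -- u runs through q periods, and each contains a_{s+k} ≡ - a_s once where M has a_s.
    u-power : ∀ q → u p (q * k) ≈F (⊝ M) ^ₚ q
    u-power zero    = ring.refl
    u-power (suc q) = ring.trans (mod (word-++ (suc s) k (q * k))) (ring.*-cong period
      (ring.trans (subst (λ i → word i (ones (q * k)) ≈F word (suc s) (ones (q * k))) eq
        (subst (λ i → word (suc (suc s + j) + 0) (ones (q * k)) ≈F word i (ones (q * k))) (ℕₚ.+-identityʳ (suc s)) (word-periodic 0 (q * k)))) (u-power q)))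
      where eq : suc (suc s + j) + 0 ≡ suc s + k
            eq = trans (ℕₚ.+-identityʳ _) (sym (ℕₚ.+-suc (suc s) j))

    private
      ^-F : ∀ {g h} N → g ≈F h → g ^ₚ N ≈F h ^ₚ N
      ^-F zero    e = ring.refl
      ^-F (suc N) e = ring.*-cong e (^-F N e)

    trace-u : ∀ q r → trace p j (u p (q * k) ^ₚ r) ≡ negOnePow (q * r) ℤ.* trace p j (word s (replicate k (q * r)))
    trace-u q r = trans (res-F (ring.trans (ring.*-congʳ {F′} (ring.trans (^-F r (u-power q)) (mod power)))
        (mod (ℤ[c].*-assoc (constant (negOnePow (q * r))) W F′))))
      (trans (act-⊗ (constant (negOnePow (q * r))) (W ⊗ F′) seq 1) (act-constant (negOnePow (q * r)) (act (W ⊗ F′) seq) 1))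
      where
        open Inverse (1/F p j) using (seq)
        F′ = deriv (F p j)
        W = word s (replicate k (q * r))
        power : ((⊝ M) ^ₚ q) ^ₚ r ≈ₚ constant (negOnePow (q * r)) ⊗ W
        power = ℤ[c].trans (^-assocʳ (⊝ M) q r) (ℤ[c].trans (⊝-^ M (q * r))
          (ℤ[c].*-congˡ {constant (negOnePow (q * r))} (word-replicate s k (q * r))))

  sum-replicate : ∀ k N → sum (replicate k N) ≡ k * N
  sum-replicate zero    N = refl
  sum-replicate (suc k) N = cong (N ℕ.+_) (sum-replicate k N)

  trace-doubles : ∀ p j q r → (q * suc j) * r + 2 ≤ 2 * 2 ^ p →
    trace (suc p) j (u (suc p) (q * suc j) ^ₚ r) ≡ + 2 ℤ.* trace p j (u p (q * suc j) ^ₚ r)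
  trace-doubles p j q r le = trans (Multiplier.trace-u (suc p) j q r) (trans (cong (ℤ._*_ (negOnePow (q * r)))
      (Doubling.res-doubles j (suc j * (q * r)) p (subst (λ W → W + 2 ≤ 2 * 2 ^ p) (eq q (suc j) r) le) (replicate (suc j) (q * r)) (length-replicate (suc j))
        (≤-reflexive (trans (cong (suc j ℕ.+_) (sum-replicate (suc j) (q * r))) (ℕₚ.+-comm (suc j) _)))))
    (trans (commute (negOnePow (q * r)) (trace p j (word (suc p) (replicate (suc j) (q * r))))) (cong (ℤ._*_ (+ 2)) (sym (Multiplier.trace-u p j q r)))))
    where
      eq : ∀ q k r → (q * k) * r ≡ k * (q * r)
      eq = ℕSolver.solve-∀
      commute : ∀ x y → x ℤ.* (+ 2 ℤ.* y) ≡ + 2 ℤ.* (x ℤ.* y)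
      commute = ℤSolver.solve-∀

  -- Divisibility by a_k and reduction modulo 2

  -- a_{i+k} = f^i(a_k) and a_i = f^i(0), and x divides f^i(x) - f^i(0).
  a-diff : ∀ k i → ∃ λ B → aPoly (i + k) ≈ₚ aPoly i ⊕ aPoly k ⊗ B
  a-diff k zero    = 1ₚ , ℤ[c].sym (ℤ[c].trans (ℤ[c].+-identityˡ _) (ℤ[c].*-identityʳ (aPoly k)))
  a-diff k (suc i) = let B , e = a-diff k i ; a = aPoly i ; K = aPoly k in
    B ⊗ ((a ⊕ a) ⊕ K ⊗ B) , ℤ[c].trans (ℤ[c].+-congʳ {X} (ℤ[c].*-cong e e))
      (solve 4 (λ a k b x → (a :+ k :* b) :* (a :+ k :* b) :+ x := (a :* a :+ x) :+ k :* (b :* ((a :+ a) :+ k :* b))) ℤ[c].refl a K B X)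
    where open ℤ[c]-Solver

  a-multiple : ∀ k t → ∃ λ B → aPoly (t * k) ≈ₚ aPoly k ⊗ B
  a-multiple k zero    = [] , ℤ[c].sym (ℤ[c].zeroʳ (aPoly k))
  a-multiple k (suc t) = let B , e = a-multiple k t ; C , f = a-diff k (t * k) ; K = aPoly k in
    B ⊕ C , subst (λ i → aPoly i ≈ₚ K ⊗ (B ⊕ C)) (ℕₚ.+-comm (t * k) k)
      (ℤ[c].trans f (ℤ[c].trans (ℤ[c].+-congʳ {K ⊗ C} e) (ℤ[c].sym (ℤ[c].distribˡ K B C))))

  letter∣word : ∀ s i r → ∃ λ B → word s (ones (i + suc r)) ≈ₚ aPoly (s + i) ⊗ B
  letter∣word s i r = _ , ℤ[c].trans (word-++ s i (suc r))
      (solve 3 (λ w a v → w :* ((a :* con 1ℤ) :* v) := a :* (w :* v)) ℤ[c].refl (word s (ones i)) (aPoly (s + i)) (word (suc (s + i)) (ones r)))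
    where open ℤ[c]-Solver

  -- One of any k consecutive indices is a multiple of k.
  a∣u : ∀ p j q → ∃ λ B → u p (suc q * suc j) ≈ₚ aPoly (suc j) ⊗ B
  a∣u p j q = let C , e = a-multiple k t ; B , f = letter∣word s i (q * k + r) in
    C ⊗ B , ℤ[c].trans (subst (λ n → word s (ones n) ≈ₚ aPoly (s + i) ⊗ B) length≡ f)
      (ℤ[c].trans (ℤ[c].*-congʳ {B} (subst (λ m → aPoly m ≈ₚ aPoly k ⊗ C) (sym index≡) e)) (ℤ[c].*-assoc (aPoly k) C B))
    where
      k = suc j
      s = suc (suc p)
      -- t k is the least multiple of k that is at least s. Dividing s - 1 rather than s keeps the
      -- offset i below k.
      t = suc (suc p ℕ./ k)
      rem = suc p ℕ.% k
      rem≤j : rem ≤ j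
      rem≤j = s≤s⁻¹ (m%n<n (suc p) k)
      i = j ∸ rem
      r = rem
      index≡ : s + i ≡ t * k
      index≡ = trans (cong (λ m → suc m + i) (m≡m%n+[m/n]*n (suc p) k))
        (trans (eq rem (suc p ℕ./ k * k) i) (cong (λ m → suc m + suc p ℕ./ k * k) (m∸n+n≡m rem≤j)))
        where eq : ∀ a b c → suc (a + b) + c ≡ suc (c + a) + b
              eq = ℕSolver.solve-∀
      length≡ : i + suc (q * k + r) ≡ suc q * k
      length≡ = trans (eq i (q * k) r) (cong (λ m → suc m + q * k) (m∸n+n≡m rem≤j))
        where eq : ∀ a b c → a + suc (b + c) ≡ suc (a + c) + b
              eq = ℕSolver.solve-∀

  -- b² + a² + 2c = (b + a)² + 2 (c - a b): modulo 2 the sum is squared at each step. For i = p + 1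
  -- and k = j + 1 the left side is `F p j`.
  a-sum-frobenius : ∀ k i → ∃ λ C → aPoly (i + k) ⊕ aPoly i ≈ₚ aPoly k ^ₚ (2 ^ i) ⊕ (C ⊕ C)
  a-sum-frobenius k zero    = [] , ℤ[c].trans (ℤ[c].+-identityʳ (aPoly k)) (ℤ[c].sym (ℤ[c].trans (ℤ[c].+-identityʳ _) (ℤ[c].*-identityʳ (aPoly k))))
  a-sum-frobenius k (suc i) = let C , e = a-sum-frobenius k i ; b = aPoly (i + k) ; a = aPoly i ; P = aPoly k ^ₚ (2 ^ i) in
    ((P ⊗ C ⊕ P ⊗ C) ⊕ (C ⊗ C ⊕ C ⊗ C)) ⊕ (X ⊕ ⊝ (b ⊗ a)) ,
    ℤ[c].trans (solve 3 (λ b a x → (b :* b :+ x) :+ (a :* a :+ x) := (b :+ a) :* (b :+ a) :+ ((x :- b :* a) :+ (x :- b :* a))) ℤ[c].refl b a X)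
      (ℤ[c].trans (ℤ[c].+-congʳ {(X ⊕ ⊝ (b ⊗ a)) ⊕ (X ⊕ ⊝ (b ⊗ a))} (ℤ[c].*-cong e e))
      (ℤ[c].trans (solve 3 (λ p c d → (p :+ (c :+ c)) :* (p :+ (c :+ c)) :+ (d :+ d) :=
          p :* p :+ ((((p :* c :+ p :* c) :+ (c :* c :+ c :* c)) :+ d) :+ (((p :* c :+ p :* c) :+ (c :* c :+ c :* c)) :+ d))) ℤ[c].refl P C (X ⊕ ⊝ (b ⊗ a)))
      (ℤ[c].+-congʳ (ℤ[c].trans (ℤ[c].sym (^-homo-* (aPoly k) (2 ^ i) (2 ^ i))) (ℤ[c].reflexive (cong (λ n → aPoly k ^ₚ (2 ^ i + n)) (sym (ℕₚ.+-identityʳ (2 ^ i)))))))))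
    where open ℤ[c]-Solver

  -- With N = 2^{p+1}, F ≡ a_k^N modulo 2, and a_k^N divides u^N.
  u-even : ∀ p j q → let open Residue p j in ∃ λ E → u p (suc q * suc j) ^ₚ (2 ^ suc p) ≈F E ⊕ E
  u-even p j q = let open Residue p j
                     open ℤ[c]-Solver
                     B , e = a∣u p j q
                     C , f = a-sum-frobenius (suc j) (suc p)
                     N = 2 ^ suc p
                     K = aPoly (suc j) ^ₚ N
                     B′ = B ^ₚ N
                     F≈0 : F p j ≈F []
                     F≈0 = actsF λ A n → A n
    in ⊝ (C ⊗ B′) , ring.trans
      (mod (ℤ[c].trans (^-congˡ N e) (ℤ[c].trans (^-distrib-* (aPoly (suc j)) B N)
        (solve 3 (λ k c b → k :* b := (k :+ (c :+ c)) :* b :+ ((:- (c :* b)) :+ (:- (c :* b)))) ℤ[c].refl K C B′))))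
      (ring.trans (ring.+-congʳ {⊝ (C ⊗ B′) ⊕ ⊝ (C ⊗ B′)} (ring.trans (ring.*-congʳ {B′} (ring.trans (mod (ℤ[c].sym f)) F≈0)) (ring.zeroˡ B′)))
        (ring.+-identityˡ _))

  trace-even : ∀ p j q e → ∃ λ z → trace p j (u p (suc q * suc j) ^ₚ (2 ^ suc p * e)) ≡ + (2 ^ e) ℤ.* z
  trace-even p j q e = go e (deriv (F p j))
    where
      open Residue p j
      N = 2 ^ suc p
      U = u p (suc q * suc j)
      E = proj₁ (u-even p j q)
      two : ∀ x y → x ℤ.* y ℤ.+ x ℤ.* y ≡ + 2 ℤ.* x ℤ.* y
      two = ℤSolver.solve-∀
      -- The arbitrary g absorbs the cofactors E, one for each factor 2 taken out.
      go : ∀ e g → ∃ λ z → res p j (U ^ₚ (N * e) ⊗ g) ≡ + (2 ^ e) ℤ.* z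
      go zero    g = _ , sym (ℤₚ.*-identityˡ _)
      go (suc e) g = let z , h = go e (E ⊗ g) ; Ue = U ^ₚ (N * e) ; T = Ue ⊗ (E ⊗ g) in z ,
        trans (res-F (ring.trans (mod (ℤ[c].*-congʳ {g} (subst (λ n → U ^ₚ n ≈ₚ U ^ₚ N ⊗ Ue) (sym (ℕₚ.*-suc N e)) (^-homo-* U N (N * e)))))
          (ring.trans (ring.*-congʳ {g} (ring.*-congʳ {Ue} (proj₂ (u-even p j q))))
            (mod (solve 3 (λ e u g → ((e :+ e) :* u) :* g := u :* (e :* g) :+ u :* (e :* g)) ℤ[c].refl E Ue g)))))
        (trans (res-⊕ T T) (trans (cong₂ ℤ._+_ h h) (trans (two (+ (2 ^ e)) z) (cong (ℤ._* z) (sym (ℤₚ.pos-* 2 (2 ^ e)))))))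
        where open ℤ[c]-Solver

  -- Explicit evaluation of traces

  -- Since a_1 = c, words starting at a_1 need no separate power of c, and the only squarefree one of degree
  -- deg F - 1 or more is the full one; this evaluates every residue.
  module Evaluation (p D : ℕ) where

    eval : ℕ → List ℕ → ℤ
    evalSplit : ℕ → ∀ {es} → Split es → ℤ

    -- Never reached while the fuel exceeds `sum es`, which every rewriting lowers.
    eval zero    es = 0ℤ
    eval (suc f) es with suc (binary es) ℕ.<ᵇ D
    ... | true  = 0ℤ
    ... | false = evalSplit f (split es)

    evalSplit f (small _)          = 1ℤ
    evalSplit f (mid pre e g post) = eval f (pre ++ e ∷ suc g ∷ post) ℤ.- eval f (increment 0 (pre ++ e ∷ g ∷ post))
    -- The letters start at a_1, so a_s with s = p + 1 sits at position p and c = a_1 at position 0.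
    evalSplit f (top pre e)        = ℤ.- eval f (increment p (pre ++ e ∷ [])) ℤ.- eval f (increment 0 (pre ++ e ∷ []))

    evalDeriv : ℕ → List ℕ → ℤ
    evalDeriv zero          es = 0ℤ
    evalDeriv (suc zero)    es = eval (suc (sum es)) es
    evalDeriv (suc (suc r)) es = + 2 ℤ.* evalDeriv (suc r) (increment r es) ℤ.+ eval (suc (sum es)) es

  -- F′ = a′_{s+k} + a′_s; the p leading zeros skip a_1, ..., a_p.
  evalTrace : ℕ → ℕ → ℕ → ℤ
  evalTrace p j N = evalDeriv (suc p + suc j) es ℤ.+ evalDeriv (suc p) es
    where open Evaluation p (2 ^ (p + suc j))
          es = replicate p 0 ++ replicate (suc j) N

  module EvaluationCorrect (p j : ℕ) where
    open Evaluation p (2 ^ (p + suc j))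
    open Residue p j
    open Reduction p j

    private
      plain : ∀ b es → term 1 b es 1ₚ ≈ₚ X ^ₚ b ⊗ word 1 es
      plain b es = ℤ[c].*-identityʳ _

      raise : ∀ es → 0 < length es → term 1 1 es 1ₚ ≈ₚ word 1 (increment 0 es)
      raise es 0< = ℤ[c].trans (plain 1 es) (ℤ[c].trans (ℤ[c].*-congʳ {word 1 es} (ℤ[c].*-identityʳ X)) (ℤ[c].sym (word-increment 1 0 es 0<)))

      base : ∀ es → word 1 es ≈ₚ term 1 0 es 1ₚ
      base es = ℤ[c].sym (ℤ[c].trans (plain 0 es) (ℤ[c].*-identityˡ (word 1 es)))

    eval-correct : ∀ f es → sum es < f → length es ≡ suc (p + j) → res p j (word 1 es) ≡ eval f es
    eval-correct (suc f) es lt len with suc (binary es) ℕ.<ᵇ 2 ^ (p + suc j) in small-degree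
    ... | true  = trans (res-≈ (ℤ[c].sym (ℤ[c].*-identityʳ (word 1 es))))
      (res-vanish (Monic-word 0 es) (Monic⇒Deg< Monic-1) (subst (λ b → suc (suc b) ≤ 2 ^ (p + suc j)) (sym (ℕₚ.+-identityʳ (binary es)))
        (<ᵇ⇒< (suc (binary es)) _ (subst IsTrue (sym small-degree) tt))))
    ... | false = go (split es) lt len large
      where
        large : 2 ^ (p + suc j) ≤ suc (binary es)
        large = ≮⇒≥ λ l → subst IsTrue small-degree (<⇒<ᵇ l)
        go : ∀ {es} (sp : Split es) → sum es < suc f → length es ≡ suc (p + j) → 2 ^ (p + suc j) ≤ suc (binary es) → res p j (word 1 es) ≡ evalSplit f sp
        -- Squarefree of length p + k and of degree at least D - 1 leaves only the full word, of
        -- degree exactly D - 1.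
        go {es} (small s) lt len large = let z , e = missing s in res-top (Monic-word 0 es) (trans (cong suc (ℕₚ.+-identityʳ (binary es)))
          (≤-antisym (≤-trans (s≤s (m≤m+n (binary es) z)) (≤-trans (binary-small s z e)
            (≤-reflexive (cong (2 ^_) (trans len (sym (ℕₚ.+-suc p j))))))) large))
        go (mid pre e g post) lt len large = trans (res-≈ (base (pre ++ suc (suc e) ∷ g ∷ post))) (trans (res-mid₁ 0 pre e g post)
            (cong₂ ℤ._-_
              (trans (res-≈ (ℤ[c].sym (base es₁))) (eval-correct f es₁ (≤-trans (≤-reflexive (sym (sum-mid pre e g post))) (s≤s⁻¹ lt)) (trans (length-replace pre refl) len)))
              (trans (res-≈ (raise es₂ 0<)) (eval-correct f (increment 0 es₂)
                (≤-trans (≤-reflexive (trans (cong suc (sum-increment 0 es₂ 0<)) (sym (sum-lower pre e (g ∷ post))))) (s≤s⁻¹ lt))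
                (trans (length-increment 0 es₂) len₂)))))
          where
            res-mid₁ : ∀ b pre e f post → res p j (term 1 b (pre ++ suc (suc e) ∷ f ∷ post) 1ₚ)
              ≡ res p j (term 1 b (pre ++ e ∷ suc f ∷ post) 1ₚ) ℤ.- res p j (term 1 (suc b) (pre ++ e ∷ f ∷ post) 1ₚ)
            res-mid₁ b pre e f post = res-mid 1 b pre e f post 1ₚ
            es₁ = pre ++ e ∷ suc g ∷ post
            es₂ = pre ++ e ∷ g ∷ post
            len₂ : length es₂ ≡ suc (p + j)
            len₂ = trans (length-replace pre refl) len
            0< : 0 < length es₂
            0< = subst (0 <_) (sym len₂) z<s
        go (top pre e) lt len large = trans (res-≈ (base (pre ++ suc (suc e) ∷ [])))
            (trans (res-word-top {t = 1} {i = p} 0 pre e 1ₚ (cong suc (ℕₚ.suc-injective (trans (sym (length-top pre)) len))) (ℕₚ.+-comm p 1) p<)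
            (cong₂ (λ x y → ℤ.- x ℤ.- y)
              (trans (res-≈ (ℤ[c].sym (base (increment p es′)))) (eval-correct f (increment p es′) (lower p p<) (trans (length-increment p es′) len′)))
              (trans (res-≈ (raise es′ 0<)) (eval-correct f (increment 0 es′) (lower 0 0<) (trans (length-increment 0 es′) len′)))))
          where
            es′ = pre ++ e ∷ []
            len′ : length es′ ≡ suc (p + j)
            len′ = trans (length-replace pre refl) len
            0< : 0 < length es′
            0< = subst (0 <_) (sym len′) z<s
            p< : p < length es′
            p< = subst (p <_) (sym len′) (s≤s (m≤m+n p j))
            lower : ∀ i → i < length es′ → sum (increment i es′) < f
            lower i i< = ≤-trans (≤-reflexive (trans (cong suc (sum-increment i es′ i<)) (sym (sum-lower pre e [])))) (s≤s⁻¹ lt)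

    evalDeriv-correct : ∀ r es → r ≤ suc (suc (p + j)) → length es ≡ suc (p + j) → res p j (word 1 es ⊗ da r) ≡ evalDeriv r es
    evalDeriv-correct zero          es r≤ len = res-≈ (ℤ[c].zeroʳ (word 1 es))
    evalDeriv-correct (suc zero)    es r≤ len = trans (res-≈ (ℤ[c].trans (ℤ[c].*-congˡ {word 1 es} (da-suc 0)) (ℤ[c].*-identityʳ (word 1 es))))
      (eval-correct (suc (sum es)) es ≤-refl len)
    evalDeriv-correct (suc (suc r)) es r≤ len = trans (res-≈ step) (trans (res-⊕ (t ⊕ t) (word 1 es)) (cong₂ ℤ._+_
        (trans (res-⊕ t t) (trans (double (res p j t)) (cong (ℤ._*_ (+ 2)) (evalDeriv-correct (suc r) es′ (≤-trans (n≤1+n _) r≤) (trans (length-increment r es) len)))))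
        (eval-correct (suc (sum es)) es ≤-refl len)))
      where
        open ℤ[c]-Solver
        es′ = increment r es
        a = aPoly (suc r)
        d = da (suc r)
        w = word 1 es
        t = word 1 es′ ⊗ d
        double : ∀ x → x ℤ.+ x ≡ + 2 ℤ.* x
        double = ℤSolver.solve-∀
        inc : (a ⊗ w) ⊗ d ≈ₚ t
        inc = ℤ[c].*-congʳ {d} (ℤ[c].sym (subst (λ i → word 1 es′ ≈ₚ aPoly i ⊗ w) (ℕₚ.+-comm r 1)
          (word-increment 1 r es (subst (r <_) (sym len) (s≤s⁻¹ r≤)))))
        step : w ⊗ da (suc (suc r)) ≈ₚ (t ⊕ t) ⊕ w
        step = ℤ[c].trans (ℤ[c].*-congˡ {w} (da-suc (suc r)))
          (ℤ[c].trans (solve 3 (λ w a d → w :* ((a :* d :+ a :* d) :+ con 1ℤ) := ((a :* w) :* d :+ (a :* w) :* d) :+ w) ℤ[c].refl w a d)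
            (ℤ[c].+-congʳ {w} (ℤ[c].+-cong inc inc)))

  word-zeros : ∀ s m es → word s (replicate m 0 ++ es) ≈ₚ word (m + s) es
  word-zeros s zero    es = ℤ[c].refl
  word-zeros s (suc m) es = ℤ[c].trans (ℤ[c].*-identityˡ _) (subst (λ i → word (suc s) (replicate m 0 ++ es) ≈ₚ word i es) (ℕₚ.+-suc m s) (word-zeros (suc s) m es))

  trace-eval : ∀ p j q → trace p j (u p (q * suc j) ^ₚ 1) ≡ negOnePow q ℤ.* evalTrace p j q
  trace-eval p j q = trans (Multiplier.trace-u p j q 1) (subst (λ N → negOnePow N ℤ.* trace p j (word (suc p) (replicate (suc j) N)) ≡ negOnePow q ℤ.* evalTrace p j q)
      (sym (ℕₚ.*-identityʳ q)) (cong (ℤ._*_ (negOnePow q)) value))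
    where
      open Residue p j
      es = replicate p 0 ++ replicate (suc j) q
      len : length es ≡ suc (p + j)
      len = trans (length-++ (replicate p 0)) (trans (cong₂ ℕ._+_ (length-replicate p) (length-replicate (suc j))) (ℕₚ.+-suc p j))
      value : trace p j (word (suc p) (replicate (suc j) q)) ≡ evalTrace p j q
      value = trans (res-≈ (ℤ[c].trans
          (ℤ[c].*-congʳ {deriv (F p j)} (ℤ[c].sym (subst (λ i → word 1 es ≈ₚ word i (replicate (suc j) q)) (ℕₚ.+-comm p 1) (word-zeros 1 p _))))
          (ℤ[c].trans (ℤ[c].*-congˡ {word 1 es} (Everything.acts λ {y} _ n →
                trans (deriv-⊕ (aPoly (suc p + suc j)) (aPoly (suc p)) y n) (sym (act-⊕ (da (suc p + suc j)) (da (suc p)) y n))))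
            (ℤ[c].distribˡ (word 1 es) (da (suc p + suc j)) (da (suc p))))))
        (trans (res-⊕ (word 1 es ⊗ da (suc p + suc j)) (word 1 es ⊗ da (suc p))) (cong₂ ℤ._+_
          (EvaluationCorrect.evalDeriv-correct p j (suc p + suc j) es (≤-reflexive (cong suc (ℕₚ.+-suc p j))) len)
          (EvaluationCorrect.evalDeriv-correct p j (suc p) es (≤-trans (s≤s (m≤m+n p j)) (n≤1+n _)) len)))

open IntegerPolynomials

-- Power sums as residues of logarithmic derivatives

open OverRing ℤ-ring using () renaming (Poly to Polyℤ; _⊕_ to _⊕ℤ_; _⊗_ to _⊗ℤ_; X to Xℤ; aPoly to aPolyℤ)
open Everything using () renaming (_≈M_ to _≈ₚ_)

divisors : ℕ → List ℕ
divisors n = filter (λ j → suc j ∣? n) (upTo n)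

positive negative : ℤ → Bool
positive e = does (e ℤ.≟ 1ℤ)
negative e = does (e ℤ.≟ -1ℤ)

indicator : Bool → ℤ
indicator true  = 1ℤ
indicator false = 0ℤ

-- The identity on values of `mobius`, written with the tests that place the factors in `Gnum` and
-- `Gden`.
weight : ℤ → ℤ
weight e = indicator (positive e) ℤ.- indicator (negative e)

sumℤ : List ℤ → ℤ
sumℤ = foldr ℤ._+_ 0ℤ

-- The sum of the r-th powers of ∏ a_{m+i} over the roots of G_{m,n}, m = p + 2.
powerSum : ℕ → ℕ → ℕ → ℤ
powerSum p n r = sumℤ (map (λ j → weight (mobius (n / suc j)) ℤ.* trace p j (u p n ^ₚ r)) (divisors n))

abstract
  1/a : ∀ j → Actℤ.Inverse (2 ^ j) (aPolyℤ (suc j))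
  1/a j = Actℤ.inverse (Actℤ.Monic-a j)

logDerivF logDeriva : ℕ → ℕ → Actℤ.Seq
logDerivF p j = Actℤ.act (Actℤ.deriv (F p j)) (Actℤ.Inverse.seq (1/F p j))
logDeriva _ j = Actℤ.act (Actℤ.deriv (aPolyℤ (suc j))) (Actℤ.Inverse.seq (1/a j))

sumSeq : List Actℤ.Seq → Actℤ.Seq
sumSeq = foldr (λ y z n → y n ℤ.+ z n) (λ _ → 0ℤ)

-- Parallel to the factor lists behind `Gnum` and `Gden`, with each factor replaced by its
-- logarithmic derivative.
numSeqs denSeqs : ℕ → ℕ → ℕ → List Actℤ.Seq
numSeqs p n j = (if positive (mobius (n / suc j)) then logDerivF p j ∷ [] else []) ++
                (if does (n ∣? suc p) ∧ negative (mobius (n / suc j)) then logDeriva p j ∷ [] else [])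
denSeqs p n j = (if negative (mobius (n / suc j)) then logDerivF p j ∷ [] else []) ++
                (if does (n ∣? suc p) ∧ positive (mobius (n / suc j)) then logDeriva p j ∷ [] else [])

residues : Polyℤ → List Actℤ.Seq → ℤ
residues h ζs = sumℤ (map (λ ζ → Actℤ.act h ζ 1) ζs)

act-sumSeq : ∀ h ζs → Actℤ.act h (sumSeq ζs) 1 ≡ residues h ζs
act-sumSeq h []       = Actℤ.act-zero h (λ _ → ≡.refl) 1
act-sumSeq h (ζ ∷ ζs) = ≡.trans (Actℤ.act-+ h ζ (sumSeq ζs) 1) (cong (ℤ._+_ (Actℤ.act h ζ 1)) (act-sumSeq h ζs))

residues-++ : ∀ h ζs ξs → residues h (ζs ++ ξs) ≡ residues h ζs ℤ.+ residues h ξs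
residues-++ h []       ξs = ≡.sym (ℤₚ.+-identityˡ _)
residues-++ h (ζ ∷ ζs) ξs = ≡.trans (cong (ℤ._+_ (Actℤ.act h ζ 1)) (residues-++ h ζs ξs)) (≡.sym (ℤₚ.+-assoc (Actℤ.act h ζ 1) _ _))

-- h a_k′ / a_k = C a_k′ is a polynomial and has no term in c^(-1).
residue-a : ∀ {h C} p j → h ≈ₚ aPolyℤ (suc j) ⊗ℤ C → Actℤ.act h (logDeriva p j) 1 ≡ 0ℤ
residue-a {h} {C} p j e = begin
    act h (act a′ y) 1  ≡⟨ Everything.on e tt 1 ⟩
    act (a ⊗ℤ C) (act a′ y) 1  ≡⟨ act-⊗ a C (act a′ y) 1 ⟩
    act a (act C (act a′ y)) 1  ≡⟨ act-cong a (act-⊗ C a′ y) 1 ⟨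
    act a (act (C ⊗ℤ a′) y) 1  ≡⟨ act-comm a (C ⊗ℤ a′) y 1 ⟩
    act (C ⊗ℤ a′) (act a y) 1  ≡⟨ act-cong (C ⊗ℤ a′) inv 1 ⟩
    act (C ⊗ℤ a′) δ 1  ≡⟨ act-suc (C ⊗ℤ a′) δ 0 ⟨
    act (C ⊗ℤ a′) (δ ∘ suc) 0  ≡⟨ act-zero (C ⊗ℤ a′) (λ _ → ≡.refl) 0 ⟩
    0ℤ  ∎
  where
    open ≡.≡-Reasoning
    open Actℤ
    open Inverse (1/a j) renaming (seq to y)
    a = aPolyℤ (suc j)
    a′ = deriv a

trace≡ : ∀ p j h → Actℤ.act h (logDerivF p j) 1 ≡ trace p j h
trace≡ p j h = ≡.sym (Actℤ.act-⊗ h (Actℤ.deriv (F p j)) (Actℤ.Inverse.seq (1/F p j)) 1)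

-- The factors a_k drop out because a_k divides u and the exponent `suc r` is positive; each F_k
-- lands on the side given by the sign of its Möbius value.
powerSum-residues : ∀ p n′ r → let n = suc n′ ; h = u p n ^ₚ suc r in
  residues h (concatMap (numSeqs p n) (divisors n)) ≡ residues h (concatMap (denSeqs p n) (divisors n)) ℤ.+ powerSum p n (suc r)
powerSum-residues p n′ r = go (divisors n) (all-filter (λ j → suc j ∣? n) (upTo n))
  where
    n = suc n′
    h = u p n ^ₚ suc r
    at-a : ∀ j → suc j ∣ n → Actℤ.act h (logDeriva p j) 1 ≡ 0ℤ
    at-a j (divides (suc q) ≡.refl) = let B , e = a∣u p j q in
      residue-a p j (ℤ[c].trans (ℤ[c].*-congʳ {u p n ^ₚ r} e) (ℤ[c].*-assoc (aPolyℤ (suc j)) B (u p n ^ₚ r)))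
    residues-if : ∀ b ζ → residues h (if b then ζ ∷ [] else []) ≡ indicator b ℤ.* Actℤ.act h ζ 1
    residues-if true  ζ = ≡.trans (ℤₚ.+-identityʳ _) (≡.sym (ℤₚ.*-identityˡ _))
    residues-if false ζ = ≡.refl
    cases : ∀ b₊ b₋ b (f a : Actℤ.Seq) → Actℤ.act h a 1 ≡ 0ℤ →
      residues h ((if b₊ then f ∷ [] else []) ++ (if b ∧ b₋ then a ∷ [] else [])) ≡
      residues h ((if b₋ then f ∷ [] else []) ++ (if b ∧ b₊ then a ∷ [] else [])) ℤ.+ (indicator b₊ ℤ.- indicator b₋) ℤ.* Actℤ.act h f 1
    cases b₊ b₋ b f a e = ≡.trans (eval b₊ (b ∧ b₋)) (≡.trans (lemma (indicator b₊) (indicator b₋) (Actℤ.act h f 1) (indicator (b ∧ b₋)) (indicator (b ∧ b₊)))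
        (cong (ℤ._+ ((indicator b₊ ℤ.- indicator b₋) ℤ.* Actℤ.act h f 1)) (≡.sym (eval b₋ (b ∧ b₊)))))
      where
        eval : ∀ b c → residues h ((if b then f ∷ [] else []) ++ (if c then a ∷ [] else [])) ≡ indicator b ℤ.* Actℤ.act h f 1 ℤ.+ indicator c ℤ.* 0ℤ
        eval b c = ≡.trans (residues-++ h (if b then f ∷ [] else []) _) (cong₂ ℤ._+_ (residues-if b f) (≡.trans (residues-if c a) (cong (ℤ._*_ (indicator c)) e)))
        lemma : ∀ x y t c d → x ℤ.* t ℤ.+ c ℤ.* 0ℤ ≡ y ℤ.* t ℤ.+ d ℤ.* 0ℤ ℤ.+ (x ℤ.- y) ℤ.* t
        lemma = ℤSolver.solve-∀
    go : ∀ js → All (λ j → suc j ∣ n) js → residues h (concatMap (numSeqs p n) js) ≡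
      residues h (concatMap (denSeqs p n) js) ℤ.+ sumℤ (map (λ j → weight (mobius (n / suc j)) ℤ.* trace p j h) js)
    go []       []         = ≡.refl
    go (j ∷ js) (d ∷ ds) = begin
        residues h (numSeqs p n j ++ N)  ≡⟨ residues-++ h (numSeqs p n j) N ⟩
        residues h (numSeqs p n j) ℤ.+ residues h N  ≡⟨ cong₂ ℤ._+_ (≡.trans (cases (positive (mobius (n / suc j))) (negative (mobius (n / suc j))) (does (n ∣? suc p)) (logDerivF p j) (logDeriva p j) (at-a j d)) (cong (λ t → residues h (denSeqs p n j) ℤ.+ w ℤ.* t) (trace≡ p j h))) (go js ds) ⟩
        residues h (denSeqs p n j) ℤ.+ w ℤ.* trace p j h ℤ.+ (residues h D ℤ.+ S)
          ≡⟨ rearrange (residues h (denSeqs p n j)) (w ℤ.* trace p j h) (residues h D) S ⟩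
        residues h (denSeqs p n j) ℤ.+ residues h D ℤ.+ (w ℤ.* trace p j h ℤ.+ S)
          ≡⟨ cong (ℤ._+ (w ℤ.* trace p j h ℤ.+ S)) (residues-++ h (denSeqs p n j) D) ⟨
        residues h (denSeqs p n j ++ D) ℤ.+ (w ℤ.* trace p j h ℤ.+ S) ∎
      where
        open ≡.≡-Reasoning
        N = concatMap (numSeqs p n) js
        D = concatMap (denSeqs p n) js
        w = weight (mobius (n / suc j))
        S = sumℤ (map (λ j → weight (mobius (n / suc j)) ℤ.* trace p j h) js)
        rearrange : ∀ a b c d → a ℤ.+ b ℤ.+ (c ℤ.+ d) ≡ a ℤ.+ c ℤ.+ (b ℤ.+ d)
        rearrange = ℤSolver.solve-∀

-- Transport to the roots in K

module Roots {c ℓ} (K : CommutativeRing c ℓ) where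
  open CommutativeRing K hiding (zero)
  open OverRing K
  open IntegerHom K
  open import Relation.Binary.Reasoning.Setoid setoid

  private
    φ-hom : RingMorphisms.IsRingHomomorphism (CommutativeRing.rawRing ℤ-ring) rawRing fromℤ
    φ-hom = record
      { isSemiringHomomorphism = record
        { isNearSemiringHomomorphism = record
          { +-isMonoidHomomorphism = record
            { isMagmaHomomorphism = record { isRelHomomorphism = record { cong = λ { ≡.refl → refl } } ; homo = fromℤ-+ }
            ; ε-homo = refl }
          ; *-homo = fromℤ-* }
        ; 1#-homo = fromℤ-1 }
      ; -‿homo = fromℤ-neg }

  module A = Action K K id (id-isRingHomomorphism K)
  module B = Action ℤ-ring K fromℤ φ-hom
  open A using (Seq; _≐_; Inverse; Monic; Van; deriv; δ)
  open Inverse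

  fromℤ-act : ∀ p y n → B.act p (fromℤ ∘ y) n ≈ fromℤ (Actℤ.act p y n)
  fromℤ-act []      y n = refl
  fromℤ-act (a ∷ p) y n = trans (+-cong (sym (fromℤ-* a (y n))) (fromℤ-act p (y ∘ suc) n)) (sym (fromℤ-+ (a ℤ.* y n) _))

  -- `aPoly` over K is built anew and is not the image of the integer list; agreement of the actions
  -- is all that the residues see.
  record _lifts_ (P : Poly) (p : Polyℤ) : Set (c ⊔ ℓ) where
    field
      same       : ∀ y → A.act P y ≐ B.act p y
      same-deriv : ∀ y → A.act (deriv P) y ≐ B.act (B.deriv p) y
  open _lifts_

  lifts-⊕ : ∀ {P Q p q} → P lifts p → Q lifts q → (P ⊕ Q) lifts (p ⊕ℤ q)
  lifts-⊕ {P} {Q} {p} {q} e f = record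
    { same = λ y n → trans (A.act-⊕ P Q y n) (trans (+-cong (same e y n) (same f y n)) (sym (B.act-⊕ p q y n)))
    ; same-deriv = λ y n → trans (A.deriv-⊕ P Q y n) (trans (+-cong (same-deriv e y n) (same-deriv f y n)) (sym (B.deriv-⊕ p q y n))) }

  lifts-⊗ : ∀ {P Q p q} → P lifts p → Q lifts q → (P ⊗ Q) lifts (p ⊗ℤ q)
  lifts-⊗ {P} {Q} {p} {q} e f = record
    { same = λ y n → trans (A.act-⊗ P Q y n) (trans (trans (same e _ n) (B.act-cong p (same f y) n)) (sym (B.act-⊗ p q y n)))
    ; same-deriv = λ y n → trans (A.deriv-⊗ P Q y n) (trans
        (+-cong (trans (same-deriv e _ n) (B.act-cong (B.deriv p) (same f y) n)) (trans (same e _ n) (B.act-cong p (same-deriv f y) n)))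
        (sym (B.deriv-⊗ p q y n))) }

  lifts-X : X lifts Xℤ
  lifts-X = record
    { same = λ y n → trans (A.act-X y n) (sym (B.act-X y n))
    ; same-deriv = λ y n → trans (dA y n) (sym (dB y n)) }
    where
      dA : ∀ y → A.act (deriv X) y ≐ y
      dA y n = trans (A.act-deriv-∷ 0# (1# ∷ []) y n) (trans (+-cong (A.act-1 y n) (A.act-deriv-∷ 1# [] (y ∘ suc) n)) (trans (+-congˡ (+-identityˡ 0#)) (+-identityʳ _)))
      dB : ∀ y → B.act (B.deriv Xℤ) y ≐ y
      dB y n = trans (B.act-deriv-∷ 0ℤ (1ℤ ∷ []) y n) (trans (+-cong (B.act-1 y n) (B.act-deriv-∷ 1ℤ [] (y ∘ suc) n)) (trans (+-congˡ (+-identityˡ 0#)) (+-identityʳ _)))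

  lifts-a : ∀ i → aPoly i lifts aPolyℤ i
  lifts-a zero    = record { same = λ _ _ → refl ; same-deriv = λ _ _ → refl }
  lifts-a (suc i) = lifts-⊕ (lifts-⊗ (lifts-a i) (lifts-a i)) lifts-X

  -- Z is the expansion at infinity of P′ / P.
  record LogDeriv (P : Poly) (Z : Seq) : Set (c ⊔ ℓ) where
    field
      {degree} : ℕ
      recip    : Inverse degree P
      value    : Z ≐ A.act (deriv P) (seq recip)
  open LogDeriv

  logDeriv-lift : ∀ {d P p} → P lifts p → Monic d P → (I : Actℤ.Inverse d p) →
    LogDeriv P (fromℤ ∘ Actℤ.act (Actℤ.deriv p) (Actℤ.Inverse.seq I))
  logDeriv-lift {P = P} {p} e M I = record
    { recip = record
      { monic = M
      ; seq   = fromℤ ∘ y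
      ; inv   = λ n → trans (same e _ n) (trans (fromℤ-act p y n) (trans (reflexive (cong fromℤ (Actℤ.Inverse.inv I n))) (fromℤ-δ n)))
      ; van   = λ i i<d → reflexive (cong fromℤ (Actℤ.Inverse.van I i i<d)) }
    ; value = λ n → sym (trans (same-deriv e _ n) (fromℤ-act (B.deriv p) y n)) }
    where
      y = Actℤ.Inverse.seq I
      fromℤ-δ : ∀ n → fromℤ (Actℤ.δ n) ≈ δ n
      fromℤ-δ zero    = fromℤ-1
      fromℤ-δ (suc n) = refl

  -- 1/P = Q · 1/(PQ) and 1/Q = P · 1/(PQ) turn the sum into Leibniz's rule.
  logDeriv-⊗ : ∀ {P Q Y Z} → LogDeriv P Y → LogDeriv Q Z → LogDeriv (P ⊗ Q) (λ n → Y n + Z n)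
  logDeriv-⊗ {P} {Q} {Y} {Z} L₁ L₂ = record { recip = J ; value = λ n → begin
      Y n + Z n  ≈⟨ +-cong (value L₁ n) (value L₂ n) ⟩
      A.act (deriv P) (seq (recip L₁)) n + A.act (deriv Q) (seq (recip L₂)) n
        ≈⟨ +-cong (A.act-cong (deriv P) QJ n) (A.act-cong (deriv Q) PJ n) ⟩
      A.act (deriv P) (A.act Q (seq J)) n + A.act (deriv Q) (A.act P (seq J)) n
        ≈⟨ +-congˡ (A.act-comm (deriv Q) P (seq J) n) ⟩
      A.act (deriv P) (A.act Q (seq J)) n + A.act P (A.act (deriv Q) (seq J)) n
        ≈⟨ A.deriv-⊗ P Q (seq J) n ⟨
      A.act (deriv (P ⊗ Q)) (seq J) n  ∎ }
    where
      I₁ = recip L₁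
      I₂ = recip L₂
      J = A.inverse (A.Monic-⊗ (monic I₁) (monic I₂))
      QJ : seq I₁ ≐ A.act Q (seq J)
      QJ = A.unique (monic I₁) (λ n → trans (inv I₁ n) (trans (sym (inv J n)) (A.act-⊗ P Q (seq J) n))) (van I₁)
        (A.act-Van (A.Monic⇒Deg< (monic I₂)) (≡.subst (λ d → Van d (seq J)) (ℕₚ.+-comm (degree L₁) (degree L₂)) (van J)))
      PJ : seq I₂ ≐ A.act P (seq J)
      PJ = A.unique (monic I₂) (λ n → trans (inv I₂ n) (trans (sym (inv J n)) (trans (A.act-⊗ P Q (seq J) n) (A.act-comm P Q (seq J) n)))) (van I₂)
        (A.act-Van (A.Monic⇒Deg< (monic I₁)) (van J))

  logDeriv-1 : LogDeriv (1# ∷ []) (λ _ → 0#)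
  logDeriv-1 = record
    { recip = record { monic = A.Monic-1 ; seq = δ ; inv = A.act-1 δ ; van = λ _ () }
    ; value = λ n → sym (trans (A.act-deriv-∷ 1# [] δ n) (+-identityˡ 0#)) }

  -- The recorded degrees of P and Q are not compared beforehand; uniqueness is applied for the
  -- smaller one, whose vanishing condition both expansions meet.
  logDeriv-unique : ∀ {P Q Y Z} → P ≈P Q → LogDeriv P Y → LogDeriv Q Z → Y ≐ Z
  logDeriv-unique {P} {Q} e L₁ L₂ n = trans (value L₁ n) (trans (A.act-cong (deriv P) recips n)
      (trans (A.deriv-≈P e (seq (recip L₂)) n) (sym (value L₂ n))))
    where
      recips : seq (recip L₁) ≐ seq (recip L₂)
      recips with ≤-total (degree L₁) (degree L₂)
      ... | inj₁ le = A.unique (monic (recip L₁)) (λ n → trans (inv (recip L₁) n) (sym (trans (A.act-≈P e _ n) (inv (recip L₂) n))))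
        (van (recip L₁)) (A.Van-mono le (van (recip L₂)))
      ... | inj₂ le = A.unique (monic (recip L₂)) (λ n → trans (trans (sym (A.act-≈P e _ n)) (inv (recip L₁) n)) (sym (inv (recip L₂) n)))
        (A.Van-mono le (van (recip L₁))) (van (recip L₂))

  -- Expansion of 1 / (c - β).
  geometric : Carrier → Seq
  geometric β zero    = 0#
  geometric β (suc n) = pow β n

  logDeriv-linear : ∀ β → LogDeriv (linear β) (geometric β)
  logDeriv-linear β = record
    { recip = record { monic = A.suc A.Monic-1 ; seq = geometric β ; inv = inv-β ; van = λ { zero _ → refl ; (suc _) (s≤s ()) } }
    ; value = λ n → sym (trans (A.act-deriv-∷ (- β) (1# ∷ []) (geometric β) n)
        (trans (+-cong (A.act-1 (geometric β) n) (trans (A.act-deriv-∷ 1# [] (geometric β ∘ suc) n) (+-identityˡ 0#))) (+-identityʳ _))) }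
    where
      inv-β : A.act (linear β) (geometric β) ≐ δ
      inv-β zero    = trans (+-cong (zeroʳ (- β)) (A.act-1 (geometric β ∘ suc) zero)) (+-identityˡ 1#)
      inv-β (suc n) = trans (+-congˡ (A.act-1 (geometric β ∘ suc) (suc n))) (trans (sym (distribʳ-neg (pow β n))) refl)
        where distribʳ-neg : ∀ x → 0# ≈ - β * x + β * x
              distribʳ-neg x = trans (trans (sym (zeroˡ x)) (*-congʳ (sym (-‿inverseˡ β)))) (distribʳ x (- β) β)

  sumK : List Carrier → Carrier
  sumK = foldr _+_ 0#

  logDeriv-roots : ∀ βs → LogDeriv (prodP (map linear βs)) (λ n → sumK (map (λ β → geometric β n) βs))
  logDeriv-roots []       = logDeriv-1
  logDeriv-roots (β ∷ βs) = logDeriv-⊗ (logDeriv-linear β) (logDeriv-roots βs)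

  LogDerivℤ : Poly → Actℤ.Seq → Set (c ⊔ ℓ)
  LogDerivℤ P ζ = LogDeriv P (fromℤ ∘ ζ)

  logDeriv-prod : ∀ {fs ζs} → Pointwise LogDerivℤ fs ζs → LogDerivℤ (prodP fs) (sumSeq ζs)
  logDeriv-prod []       = logDeriv-1
  logDeriv-prod {ζs = ζ ∷ ζs} (L ∷ Ls) = record { recip = recip L₂ ; value = λ n → trans (fromℤ-+ (ζ n) (sumSeq ζs n)) (value L₂ n) }
    where L₂ = logDeriv-⊗ L (logDeriv-prod Ls)

  pointwise-concatMap : ∀ {f : ℕ → List Poly} {g : ℕ → List Actℤ.Seq} (js : List ℕ) → (∀ j → Pointwise LogDerivℤ (f j) (g j)) → Pointwise LogDerivℤ (concatMap f js) (concatMap g js)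
  pointwise-concatMap []       h = []
  pointwise-concatMap (j ∷ js) h = Pointwise.++⁺ (h j) (pointwise-concatMap js h)

  logDerivF-correct : ∀ p j → LogDerivℤ (aPoly (suc p ℕ.+ suc j) ⊕ aPoly (suc p)) (logDerivF p j)
  logDerivF-correct p j = logDeriv-lift (lifts-⊕ (lifts-a (suc p ℕ.+ suc j)) (lifts-a (suc p))) (A.Monic-a+a p j) (1/F p j)

  logDeriva-correct : ∀ p j → LogDerivℤ (aPoly (suc j)) (logDeriva p j)
  logDeriva-correct p j = logDeriv-lift (lifts-a (suc j)) (A.Monic-a j) (1/a j)

  private
    pointwise-if : ∀ b {P ζ} → LogDerivℤ P ζ → Pointwise LogDerivℤ (if b then P ∷ [] else []) (if b then ζ ∷ [] else [])
    pointwise-if true  L = L ∷ []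
    pointwise-if false L = []

    numPolys denPolys : ℕ → ℕ → ℕ → List Poly
    numPolys p n j = (if positive (mobius (n / suc j)) then (aPoly (suc p ℕ.+ suc j) ⊕ aPoly (suc p)) ∷ [] else []) ++
                     (if does (n ∣? suc p) ∧ negative (mobius (n / suc j)) then aPoly (suc j) ∷ [] else [])
    denPolys p n j = (if negative (mobius (n / suc j)) then (aPoly (suc p ℕ.+ suc j) ⊕ aPoly (suc p)) ∷ [] else []) ++
                     (if does (n ∣? suc p) ∧ positive (mobius (n / suc j)) then aPoly (suc j) ∷ [] else [])

  logDeriv-num : ∀ p n → LogDerivℤ (Gnum (suc (suc p)) n) (sumSeq (concatMap (numSeqs p n) (divisors n)))
  logDeriv-num p n = logDeriv-prod {ζs = concatMap (numSeqs p n) (divisors n)} (pointwise-concatMap {numPolys p n} {numSeqs p n} (divisors n) λ j →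
    Pointwise.++⁺ (pointwise-if (positive (mobius (n / suc j))) (logDerivF-correct p j))
                  (pointwise-if (does (n ∣? suc p) ∧ negative (mobius (n / suc j))) (logDeriva-correct p j)))

  logDeriv-den : ∀ p n → LogDerivℤ (Gden (suc (suc p)) n) (sumSeq (concatMap (denSeqs p n) (divisors n)))
  logDeriv-den p n = logDeriv-prod {ζs = concatMap (denSeqs p n) (divisors n)} (pointwise-concatMap {denPolys p n} {denSeqs p n} (divisors n) λ j →
    Pointwise.++⁺ (pointwise-if (negative (mobius (n / suc j))) (logDerivF-correct p j))
                  (pointwise-if (does (n ∣? suc p) ∧ positive (mobius (n / suc j))) (logDeriva-correct p j)))

  -- This says x = h(β): the powers of β are an eigenvector of the shift, so evaluation is read off
  -- the action.
  record _at_is_ (h : Polyℤ) (β x : Carrier) : Set ℓ where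
    constructor eigenvalue
    field eigen : ∀ n → B.act h (pow β) n ≈ x * pow β n
  open _at_is_

  at-⊗ : ∀ {g h β x y} → g at β is x → h at β is y → (g ⊗ℤ h) at β is (x * y)
  at-⊗ {g} {h} {β} {x} {y} e f = eigenvalue λ n → begin
    B.act (g ⊗ℤ h) (pow β) n  ≈⟨ B.act-⊗ g h (pow β) n ⟩
    B.act g (B.act h (pow β)) n  ≈⟨ B.act-cong g (eigen f) n ⟩
    B.act g (λ n → y * pow β n) n    ≈⟨ B.act-scale g y (pow β) n ⟩
    y * B.act g (pow β) n  ≈⟨ *-congˡ (eigen e n) ⟩
    y * (x * pow β n)  ≈⟨ trans (sym (*-assoc _ _ _)) (*-congʳ (*-comm y x)) ⟩
    x * y * pow β n  ∎

  at-1 : ∀ {β} → 1ₚ at β is 1#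
  at-1 {β} = eigenvalue λ n → trans (B.act-1 (pow β) n) (sym (*-identityˡ _))

  at-^ : ∀ {g β x} r → g at β is x → (g ^ₚ r) at β is (pow x r)
  at-^ zero    e = at-1
  at-^ (suc r) e = at-⊗ e (at-^ r e)

  at-a : ∀ β i → aPolyℤ i at β is aVal β i
  at-a β zero    = eigenvalue λ n → sym (zeroˡ _)
  at-a β (suc i) = eigenvalue λ n → trans (B.act-⊕ (aPolyℤ i ⊗ℤ aPolyℤ i) Xℤ (pow β) n)
    (trans (+-cong (eigen (at-⊗ (at-a β i) (at-a β i)) n) (B.act-X (pow β) n)) (sym (distribʳ _ _ _)))

  at-cong : ∀ {h β x y} → x ≈ y → h at β is x → h at β is y
  at-cong x≈y e = eigenvalue λ n → trans (eigen e n) (*-congʳ x≈y)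

  multiplier : ℕ → ℕ → Carrier → Carrier
  multiplier m n β = foldr _*_ 1# (map (λ i → aVal β (m ℕ.+ i)) (upTo n))

  at-u : ∀ p n β → u p n at β is multiplier (suc (suc p)) n β
  at-u p n β = go (suc (suc p)) n id (λ i → ≡.refl)
    where
      -- `upTo` is `applyUpTo id`, whose recursion changes the function; hence the general f.
      go : ∀ s n (f : ℕ → ℕ) → (∀ i → s ℕ.+ i ≡ suc (suc p) ℕ.+ f i) →
        word s (ones n) at β is foldr _*_ 1# (map (λ i → aVal β (suc (suc p) ℕ.+ i)) (applyUpTo f n))
      go s zero    f e = at-1
      go s (suc n) f e = at-⊗ (at-cong (trans (*-identityʳ _) (reflexive (cong (aVal β) (≡.trans (≡.sym (ℕₚ.+-identityʳ s)) (e 0))))) (at-⊗ (at-a β s) at-1))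
        (go (suc s) n (f ∘ suc) (λ i → ≡.trans (≡.sym (ℕₚ.+-suc s i)) (e (suc i))))

  residue-at : ∀ {h β x} → h at β is x → B.act h (geometric β) 1 ≈ x
  residue-at {h} {β} e = trans (sym (B.act-suc h (geometric β) 0)) (trans (eigen e 0) (*-identityʳ _))

  act-sum-geometric : ∀ h βs → B.act h (λ n → sumK (map (λ β → geometric β n) βs)) 1 ≈ sumK (map (λ β → B.act h (geometric β) 1) βs)
  act-sum-geometric h []       = B.act-zero h (λ _ → refl) 1
  act-sum-geometric h (β ∷ βs) = trans (B.act-+ h (geometric β) _ 1) (+-congˡ (act-sum-geometric h βs))

  sumK-cong : ∀ {f g : Carrier → Carrier} βs → (∀ β → f β ≈ g β) → sumK (map f βs) ≈ sumK (map g βs)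
  sumK-cong []       e = refl
  sumK-cong (β ∷ βs) e = +-cong (e β) (sumK-cong βs e)

  -- Residues of h against the logarithmic derivative of Gden · ∏ (c - β) = Gnum; the part of Gden
  -- appears on both sides and cancels.
  powerSum-correct : ∀ p n′ r βs → RootsOfG (suc (suc p)) (suc n′) βs →
    sumK (map (λ β → pow (multiplier (suc (suc p)) (suc n′) β) (suc r)) βs) ≈ fromℤ (powerSum p (suc n′) (suc r))
  powerSum-correct p n′ r βs roots = cancel (begin
      fromℤ (residues h den) + S
        ≈⟨ +-cong (reflexive (cong fromℤ (act-sumSeq h den))) (sumK-cong βs λ β → residue-at (at-^ (suc r) (at-u p n β))) ⟨
      fromℤ (Actℤ.act h (sumSeq den) 1) + sumK (map (λ β → B.act h (geometric β) 1) βs)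
        ≈⟨ +-cong (fromℤ-act h (sumSeq den) 1) (act-sum-geometric h βs) ⟨
      B.act h (fromℤ ∘ sumSeq den) 1 + B.act h (λ n → sumK (map (λ β → geometric β n) βs)) 1
        ≈⟨ B.act-+ h (fromℤ ∘ sumSeq den) _ 1 ⟨
      B.act h (λ n → fromℤ (sumSeq den n) + sumK (map (λ β → geometric β n) βs)) 1
        ≈⟨ B.act-cong h (logDeriv-unique roots (logDeriv-⊗ (logDeriv-den p n) (logDeriv-roots βs)) (logDeriv-num p n)) 1 ⟩
      B.act h (fromℤ ∘ sumSeq num) 1
        ≈⟨ fromℤ-act h (sumSeq num) 1 ⟩
      fromℤ (Actℤ.act h (sumSeq num) 1)
        ≡⟨ cong fromℤ (≡.trans (act-sumSeq h num) (powerSum-residues p n′ r)) ⟩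
      fromℤ (residues h den ℤ.+ powerSum p n (suc r))
        ≈⟨ fromℤ-+ (residues h den) _ ⟩
      fromℤ (residues h den) + fromℤ (powerSum p n (suc r)) ∎)
    where
      open import Algebra.Properties.Group +-group using () renaming (∙-cancelˡ to +-cancelˡ)
      n = suc n′
      h = u p n ^ₚ suc r
      num = concatMap (numSeqs p n) (divisors n)
      den = concatMap (denSeqs p n) (divisors n)
      S = sumK (map (λ β → pow (multiplier (suc (suc p)) n β) (suc r)) βs)
      cancel : ∀ {x y z} → x + y ≈ x + z → y ≈ z
      cancel {x} {y} {z} = +-cancelˡ x y z

-- Convolutions and divisibility by powers of 2

module Convolution {c ℓ} (R : CommutativeRing c ℓ) where
  open CommutativeRing R hiding (zero)
  open IntegerHom R using (module Solver)

  conv : (ℕ → Carrier) → (ℕ → Carrier) → ℕ → Carrier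
  conv f g zero    = f 0 * g 0
  conv f g (suc n) = f 0 * g (suc n) + conv (f ∘ suc) g n

  conv-cong : ∀ {f f′ g g′} n → (∀ i → i ≤ n → f i ≈ f′ i) → (∀ i → i ≤ n → g i ≈ g′ i) → conv f g n ≈ conv f′ g′ n
  conv-cong zero    e h = *-cong (e 0 z≤n) (h 0 z≤n)
  conv-cong (suc n) e h = +-cong (*-cong (e 0 z≤n) (h (suc n) ≤-refl))
    (conv-cong n (λ i i≤n → e (suc i) (s≤s i≤n)) (λ i i≤n → h i (m≤n⇒m≤1+n i≤n)))

  conv-+ˡ : ∀ f f′ g n → conv (λ i → f i + f′ i) g n ≈ conv f g n + conv f′ g n
  conv-+ˡ f f′ g zero    = distribʳ _ _ _
  conv-+ˡ f f′ g (suc n) = trans (+-congˡ (conv-+ˡ (f ∘ suc) (f′ ∘ suc) g n))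
    (solve 5 (λ a b c x y → (a :+ b) :* c :+ (x :+ y) := (a :* c :+ x) :+ (b :* c :+ y)) refl _ _ _ _ _)
    where open Solver

  conv-*ˡ : ∀ s f g n → conv (λ i → s * f i) g n ≈ s * conv f g n
  conv-*ˡ s f g zero    = *-assoc _ _ _
  conv-*ˡ s f g (suc n) = trans (+-congˡ (conv-*ˡ s (f ∘ suc) g n))
    (solve 4 (λ s a b x → s :* a :* b :+ s :* x := s :* (a :* b :+ x)) refl _ _ _ _)
    where open Solver

  conv-*ʳ : ∀ s f g n → conv f (λ i → s * g i) n ≈ s * conv f g n
  conv-*ʳ s f g zero    = solve 3 (λ s a b → a :* (s :* b) := s :* (a :* b)) refl _ _ _
    where open Solver
  conv-*ʳ s f g (suc n) = trans (+-congˡ (conv-*ʳ s (f ∘ suc) g n))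
    (solve 4 (λ s a b x → a :* (s :* b) :+ s :* x := s :* (a :* b :+ x)) refl _ _ _ _)
    where open Solver

  conv-0ˡ : ∀ f g n → (∀ i → f i ≈ 0#) → conv f g n ≈ 0#
  conv-0ˡ f g zero    e = trans (*-congʳ (e 0)) (zeroˡ _)
  conv-0ˡ f g (suc n) e = trans (+-cong (trans (*-congʳ (e 0)) (zeroˡ _)) (conv-0ˡ (f ∘ suc) g n (e ∘ suc))) (+-identityˡ _)

  conv-last : ∀ f g n → conv f g (suc n) ≈ conv f (g ∘ suc) n + f (suc n) * g 0
  conv-last f g zero    = refl
  conv-last f g (suc n) = trans (+-congˡ (conv-last (f ∘ suc) g n)) (sym (+-assoc _ _ _))

  -- Multiplication of one factor by 1 + x t.
  conv-delayʳ : ∀ x f {g g′} → g′ 0 ≈ g 0 → (∀ i → g′ (suc i) ≈ g (suc i) + x * g i) →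
    ∀ n → conv f g′ (suc n) ≈ conv f g (suc n) + x * conv f g n
  conv-delayʳ x f {g} {g′} e₀ e zero    = trans (+-cong (*-congˡ (e 0)) (*-congˡ e₀))
    (solve 5 (λ x a b c d → a :* (b :+ x :* c) :+ d :* c := (a :* b :+ d :* c) :+ x :* (a :* c)) refl x _ _ _ _)
    where open Solver
  conv-delayʳ x f {g} {g′} e₀ e (suc n) = trans (+-cong (*-congˡ (e (suc n))) (conv-delayʳ x (f ∘ suc) e₀ e n))
    (solve 6 (λ x a b c u v → a :* (b :+ x :* c) :+ (u :+ x :* v) := (a :* b :+ u) :+ x :* (a :* c :+ v)) refl x _ _ _ _ _)
    where open Solver

  conv-delayˡ : ∀ x {f f′} g → f′ 0 ≈ f 0 → (∀ i → f′ (suc i) ≈ f (suc i) + x * f i) →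
    ∀ n → conv f′ g (suc n) ≈ conv f g (suc n) + x * conv f g n
  conv-delayˡ x {f} {f′} g e₀ e zero    = trans (+-cong (*-congʳ e₀) (*-congʳ (e 0)))
    (solve 5 (λ x a b c d → a :* b :+ (d :+ x :* a) :* c := (a :* b :+ d :* c) :+ x :* (a :* c)) refl x _ _ _ _)
    where open Solver
  conv-delayˡ x {f} {f′} g e₀ e (suc n) = trans (conv-last f′ g (suc n)) (trans
    (+-cong (conv-delayˡ x {f} {f′} (g ∘ suc) e₀ e n) (*-congʳ (e (suc n))))
    (trans (solve 6 (λ x u v a b g → (u :+ x :* v) :+ (a :+ x :* b) :* g := (u :+ a :* g) :+ x :* (v :+ b :* g)) refl x _ _ _ _ _)
      (sym (+-cong (conv-last f g (suc n)) (*-congˡ (conv-last f g n))))))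
    where open Solver

double : ℕ → ℕ
double zero    = zero
double (suc n) = suc (suc (double n))

module _ where
  open Convolution ℤ-ring

  -- Modulo 2 the terms i and 2j - i cancel in pairs, and the middle one remains.
  conv-parity : ∀ f g h → (∀ i → f i ≡ g i ℤ.+ + 2 ℤ.* h i) → ∀ j → ∃ λ z → conv f g (double j) ≡ g j ℤ.* g j ℤ.+ + 2 ℤ.* z
  conv-parity f g h e zero    = h 0 ℤ.* g 0 , ≡.trans (cong (ℤ._* g 0) (e 0)) (lemma (g 0) (h 0))
    where lemma : ∀ a b → (a ℤ.+ + 2 ℤ.* b) ℤ.* a ≡ a ℤ.* a ℤ.+ + 2 ℤ.* (b ℤ.* a)
          lemma = ℤSolver.solve-∀
  conv-parity f g h e (suc j) = let z , q = conv-parity (f ∘ suc) (g ∘ suc) (h ∘ suc) (e ∘ suc) j ; N = suc (double j) in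
    g 0 ℤ.* g (suc N) ℤ.+ h 0 ℤ.* g (suc N) ℤ.+ h (suc N) ℤ.* g 0 ℤ.+ z ,
    ≡.trans (cong (ℤ._+_ (f 0 ℤ.* g (suc N))) (conv-last (f ∘ suc) g (double j)))
      (≡.trans (≡.cong₂ ℤ._+_ (cong (ℤ._* g (suc N)) (e 0)) (≡.cong₂ ℤ._+_ q (cong (ℤ._* g 0) (e (suc N)))))
        (lemma (g 0) (h 0) (g (suc N)) (h (suc N)) (g (suc j)) z))
    where lemma : ∀ a b c d x z → (a ℤ.+ + 2 ℤ.* b) ℤ.* c ℤ.+ (x ℤ.* x ℤ.+ + 2 ℤ.* z ℤ.+ (c ℤ.+ + 2 ℤ.* d) ℤ.* a)
            ≡ x ℤ.* x ℤ.+ + 2 ℤ.* (a ℤ.* c ℤ.+ b ℤ.* c ℤ.+ d ℤ.* a ℤ.+ z)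
          lemma = ℤSolver.solve-∀

parity : ∀ x → ∃ λ a → x ≡ + 2 ℤ.* a ⊎ x ≡ 1ℤ ℤ.+ + 2 ℤ.* a
parity x with x ℤ.% (+ 2) in r | n%d<d x (+ 2) | a≡a%n+[a/n]*n x (+ 2)
... | 0 | _ | e = x ℤ./ (+ 2) , inj₁ (≡.trans e (≡.trans (ℤₚ.+-identityˡ _) (ℤₚ.*-comm (x ℤ./ (+ 2)) (+ 2))))
... | 1 | _ | e = x ℤ./ (+ 2) , inj₂ (≡.trans e (cong (ℤ._+_ 1ℤ) (ℤₚ.*-comm (x ℤ./ (+ 2)) (+ 2))))
... | suc (suc _) | s≤s (s≤s ()) | _

1-odd : ∀ a → ¬ (1ℤ ≡ + 2 ℤ.* a)
1-odd a e with ℤ.∣ a ∣ | ≡.trans (cong ℤ.∣_∣ e) (ℤₚ.∣i*j∣≡∣i∣*∣j∣ (+ 2) a)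
... | suc k | eq with ≡.trans eq (cong suc (ℕₚ.+-suc k (k ℕ.+ 0)))
...   | ()

square-even : ∀ x z → x ℤ.* x ≡ + 2 ℤ.* z → ∃ λ y → x ≡ + 2 ℤ.* y
square-even x z e with parity x
... | y , inj₁ even = y , even
... | y , inj₂ odd  = ⊥-elim (1-odd (z ℤ.- (+ 2 ℤ.* y ℤ.* y ℤ.+ + 2 ℤ.* y)) (begin
    1ℤ  ≡⟨ lemma y ⟩
    (1ℤ ℤ.+ + 2 ℤ.* y) ℤ.* (1ℤ ℤ.+ + 2 ℤ.* y) ℤ.- + 2 ℤ.* (+ 2 ℤ.* y ℤ.* y ℤ.+ + 2 ℤ.* y)
      ≡⟨ cong (ℤ._- (+ 2 ℤ.* (+ 2 ℤ.* y ℤ.* y ℤ.+ + 2 ℤ.* y))) (≡.trans (≡.sym (cong₂ ℤ._*_ odd odd)) e) ⟩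
    + 2 ℤ.* z ℤ.- + 2 ℤ.* (+ 2 ℤ.* y ℤ.* y ℤ.+ + 2 ℤ.* y)  ≡⟨ lemma₂ z _ ⟩
    + 2 ℤ.* (z ℤ.- (+ 2 ℤ.* y ℤ.* y ℤ.+ + 2 ℤ.* y))  ∎))
  where
    open ≡.≡-Reasoning
    lemma : ∀ y → 1ℤ ≡ (1ℤ ℤ.+ + 2 ℤ.* y) ℤ.* (1ℤ ℤ.+ + 2 ℤ.* y) ℤ.- + 2 ℤ.* (+ 2 ℤ.* y ℤ.* y ℤ.+ + 2 ℤ.* y)
    lemma = ℤSolver.solve-∀
    lemma₂ : ∀ z w → + 2 ℤ.* z ℤ.- + 2 ℤ.* w ≡ + 2 ℤ.* (z ℤ.- w)
    lemma₂ = ℤSolver.solve-∀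

pow2 : ℕ → ℤ
pow2 n = + (2 ^ n)

pow2-suc : ∀ n → pow2 (suc n) ≡ + 2 ℤ.* pow2 n
pow2-suc n = ℤₚ.pos-* 2 (2 ^ n)

pow2-+ : ∀ m n → pow2 (m ℕ.+ n) ≡ pow2 m ℤ.* pow2 n
pow2-+ m n = ≡.trans (cong +_ (^-distribˡ-+-* 2 m n)) (ℤₚ.pos-* (2 ^ m) (2 ^ n))

-- x = (1 + 2a) x - 2 a x is even if the product is; then halve and repeat.
odd-cancel : ∀ a x k z → (1ℤ ℤ.+ + 2 ℤ.* a) ℤ.* x ≡ pow2 k ℤ.* z → ∃ λ y → x ≡ pow2 k ℤ.* y
odd-cancel a x zero    z e = x , ≡.sym (ℤₚ.*-identityˡ x)
odd-cancel a x (suc k) z e = proj₁ half , ≡.trans x≡ (≡.trans (cong (ℤ._*_ (+ 2)) (proj₂ half))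
    (≡.trans (≡.sym (ℤₚ.*-assoc (+ 2) (pow2 k) (proj₁ half))) (cong (ℤ._* proj₁ half) (≡.sym (pow2-suc k)))))
  where
    x′ = pow2 k ℤ.* z ℤ.- a ℤ.* x
    lemma : ∀ a x → x ≡ (1ℤ ℤ.+ + 2 ℤ.* a) ℤ.* x ℤ.- + 2 ℤ.* (a ℤ.* x)
    lemma = ℤSolver.solve-∀
    lemma₂ : ∀ a y → + 2 ℤ.* ((1ℤ ℤ.+ + 2 ℤ.* a) ℤ.* y) ≡ (1ℤ ℤ.+ + 2 ℤ.* a) ℤ.* (+ 2 ℤ.* y)
    lemma₂ = ℤSolver.solve-∀
    lemma₃ : ∀ p z w → + 2 ℤ.* p ℤ.* z ℤ.- + 2 ℤ.* w ≡ + 2 ℤ.* (p ℤ.* z ℤ.- w)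
    lemma₃ = ℤSolver.solve-∀
    x≡ : x ≡ + 2 ℤ.* x′
    x≡ = ≡.trans (lemma a x) (≡.trans (cong (ℤ._- (+ 2 ℤ.* (a ℤ.* x))) (≡.trans e (cong (ℤ._* z) (pow2-suc k)))) (lemma₃ (pow2 k) z (a ℤ.* x)))
    half : ∃ λ y → x′ ≡ pow2 k ℤ.* y
    half = odd-cancel a x′ k z (ℤₚ.*-cancelˡ-≡ (+ 2) _ _
      (≡.trans (≡.trans (lemma₂ a x′) (cong (ℤ._*_ (1ℤ ℤ.+ + 2 ℤ.* a)) (≡.sym x≡)))
        (≡.trans e (≡.trans (cong (ℤ._* z) (pow2-suc k)) (ℤₚ.*-assoc (+ 2) (pow2 k) z)))))

n<2^n : ∀ n → n < 2 ^ n
n<2^n zero    = s≤s z≤n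
n<2^n (suc n) = ≤-trans (+-mono-≤ (ℕₚ.m^n>0 2 n) (n<2^n n)) (≤-reflexive (cong (2 ^ n ℕ.+_) (≡.sym (ℕₚ.+-identityʳ (2 ^ n)))))

-- If c < 2^B then c absorbs fewer than B of the factors 2.
small-cancel : ∀ B c w x z → 0 < c → c < 2 ^ B → + c ℤ.* x ≡ pow2 (w ℕ.+ B) ℤ.* z → ∃ λ y → x ≡ pow2 (suc w) ℤ.* y
small-cancel zero    (suc c) w x z _ (s≤s ()) e
small-cancel (suc B) c w x z 0<c c< e with parity (+ c)
... | a , inj₂ odd = let y , f = odd-cancel a x (suc w ℕ.+ B) z (≡.trans (cong (ℤ._* x) (≡.sym odd)) (≡.trans e (cong (λ k → pow2 k ℤ.* z) (ℕₚ.+-suc w B)))) in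
  pow2 B ℤ.* y , ≡.trans f (≡.trans (cong (ℤ._* y) (pow2-+ (suc w) B)) (ℤₚ.*-assoc (pow2 (suc w)) (pow2 B) y))
... | -[1+ a ] , inj₁ ()
... | + zero , inj₁ even = ⊥-elim (<-irrefl ≡.refl (≡.subst (0 <_) (ℤₚ.+-injective even) 0<c))
... | +[1+ a ] , inj₁ even = small-cancel B (suc a) w x z z<s
    (*-cancelˡ-< 2 (suc a) (2 ^ B) (≡.subst (_< 2 ^ suc B) c≡ c<))
    (ℤₚ.*-cancelˡ-≡ (+ 2) _ _ (≡.trans (≡.sym (ℤₚ.*-assoc (+ 2) (+ suc a) x)) (≡.trans (cong (ℤ._* x) (≡.sym even))
      (≡.trans e (≡.trans (cong (ℤ._* z) (≡.trans (cong pow2 (ℕₚ.+-suc w B)) (pow2-suc (w ℕ.+ B)))) (ℤₚ.*-assoc (+ 2) (pow2 (w ℕ.+ B)) z))))))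
  where c≡ : c ≡ 2 ℕ.* suc a
        c≡ = ℤₚ.+-injective (≡.trans even (≡.sym (ℤₚ.pos-* 2 (suc a))))

-- Symmetric functions: Newton and Graeffe

module Symmetric {c ℓ} (K : CommutativeRing c ℓ) (field-K : OverRing.IsField K) (char-K : OverRing.CharZero K) where
  open CommutativeRing K hiding (zero)
  open OverRing K
  open IntegerHom K
  open Convolution K
  module Convℤ = Convolution ℤ-ring
  open import Relation.Binary.Reasoning.Setoid setoid

  fromℤ-≢0 : ∀ {i} → ¬ i ≡ 0ℤ → ¬ fromℤ i ≈ 0#
  fromℤ-≢0 {+ zero}   i≢0 e = i≢0 ≡.refl
  fromℤ-≢0 {+[1+ n ]} i≢0 e = char-K n e
  fromℤ-≢0 { -[1+ n ]} i≢0 e = char-K n (trans (sym (-‿involutive _)) (trans (-‿cong e) -0≈0))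
    where open import Algebra.Properties.Group +-group renaming (⁻¹-involutive to -‿involutive; ε⁻¹≈ε to -0≈0)

  *-cancel : ∀ {x y z} → ¬ x ≈ 0# → x * y ≈ x * z → y ≈ z
  *-cancel {x} {y} {z} x≉0 e = let w , xw≈1 = proj₂ field-K x x≉0 in begin
    y  ≈⟨ trans (*-congʳ (trans (*-comm w x) xw≈1)) (*-identityˡ y) ⟨
    w * x * y    ≈⟨ trans (*-assoc w x y) (trans (*-congˡ e) (sym (*-assoc w x z))) ⟩
    w * x * z    ≈⟨ trans (*-congʳ (trans (*-comm w x) xw≈1)) (*-identityˡ z) ⟩
    z  ∎

  fromℤ-cancel : ∀ i {y z} → ¬ i ≡ 0ℤ → fromℤ i * y ≈ fromℤ i * z → y ≈ z
  fromℤ-cancel i i≢0 = *-cancel (fromℤ-≢0 i≢0)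

  fromℤ-injective : ∀ {i j} → fromℤ i ≈ fromℤ j → i ≡ j
  fromℤ-injective {i} {j} e with i ℤ.- j ℤ.≟ 0ℤ
  ... | yes p = ℤₚ.i-j≡0⇒i≡j i j p
  ... | no ¬p = ⊥-elim (fromℤ-≢0 ¬p (trans (fromℤ-+ i (ℤ.- j)) (trans (+-cong e (fromℤ-neg j)) (-‿inverseʳ _))))

  pow2≢0 : ∀ w → ¬ pow2 w ≡ 0ℤ
  pow2≢0 w e = <-irrefl (≡.sym (ℤₚ.+-injective e)) (ℕₚ.m^n>0 2 w)

  fromℤ-conv : ∀ f g n → fromℤ (Convℤ.conv f g n) ≈ conv (fromℤ ∘ f) (fromℤ ∘ g) n
  fromℤ-conv f g zero    = fromℤ-* (f 0) (g 0)
  fromℤ-conv f g (suc n) = trans (fromℤ-+ (f 0 ℤ.* g (suc n)) _) (+-cong (fromℤ-* (f 0) (g (suc n))) (fromℤ-conv (f ∘ suc) g n))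

  elem : ℕ → List Carrier → Carrier
  elem zero    xs       = 1#
  elem (suc j) []       = 0#
  elem (suc j) (x ∷ xs) = elem (suc j) xs + x * elem j xs

  psum : ℕ → List Carrier → Carrier
  psum q xs = foldr _+_ 0# (map (λ x → pow x q) xs)

  sgn : ℕ → Carrier
  sgn i = fromℤ (negOnePow i)

  sgn-suc : ∀ i → sgn (suc i) ≈ - sgn i
  sgn-suc i = fromℤ-neg (negOnePow i)

  newton-seq : List Carrier → ℕ → Carrier
  newton-seq xs i = sgn i * psum (suc i) xs

  private
    alternating : Carrier → ℕ → Carrier
    alternating x i = sgn i * pow x (suc i)

    alternating-suc : ∀ x i → alternating x (suc i) ≈ - x * alternating x i
    alternating-suc x i = trans (*-congʳ (sgn-suc i)) (solve 3 (λ s x p → (:- s) :* (x :* p) := (:- x) :* (s :* p)) refl (sgn i) x (pow x (suc i)))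
      where open Solver

    -- x / (1 + x t) has coefficients `alternating x`, and the factor 1 + x t cancels against the
    -- one in ∏ (1 + x t).
    conv-alternating : ∀ x xs j → conv (alternating x) (λ i → elem i (x ∷ xs)) j ≈ x * elem j xs
    conv-alternating x xs zero    = trans (*-identityʳ _) (trans (*-congʳ fromℤ-1) (trans (*-identityˡ _) refl))
    conv-alternating x xs (suc j) = trans (+-congˡ (trans (conv-cong j (λ i _ → alternating-suc x i) (λ i _ → refl))
        (trans (conv-*ˡ (- x) (alternating x) (λ i → elem i (x ∷ xs)) j) (*-congˡ (conv-alternating x xs j)))))
      (trans (+-congʳ (*-congʳ (trans (*-congʳ fromℤ-1) (trans (*-identityˡ _) (*-identityʳ x)))))
        (solve 3 (λ x a b → x :* (a :+ x :* b) :+ (:- x) :* (x :* b) := x :* a) refl x (elem (suc j) xs) (elem j xs)))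
      where open Solver

  -- These are the coefficients of E′ = (E′/E) E for E(t) = ∏ (1 + x t). By induction on the list: a
  -- new x adds x / (1 + x t) to E′/E.
  newton : ∀ xs j → fromℕ (suc j) * elem (suc j) xs ≈ conv (newton-seq xs) (λ i → elem i xs) j
  newton []       j = trans (zeroʳ _) (sym (conv-0ˡ (newton-seq []) (λ i → elem i []) j (λ i → zeroʳ (sgn i))))
  newton (x ∷ xs) j = sym (begin
      conv (newton-seq (x ∷ xs)) E j
        ≈⟨ conv-cong j (λ i _ → distribˡ (sgn i) (pow x (suc i)) (psum (suc i) xs)) (λ i _ → refl) ⟩
      conv (λ i → alternating x i + newton-seq xs i) E j
        ≈⟨ conv-+ˡ (alternating x) (newton-seq xs) E j ⟩
      conv (alternating x) E j + conv (newton-seq xs) E j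
        ≈⟨ +-cong (conv-alternating x xs j) (rest j) ⟩
      x * elem j xs + (fromℕ (suc j) * elem (suc j) xs + x * (fromℕ j * elem j xs))
        ≈⟨ +-congˡ (+-congʳ (*-congʳ (+-congʳ fromℤ-1))) ⟨
      x * elem j xs + ((fromℤ 1ℤ + fromℕ j) * elem (suc j) xs + x * (fromℕ j * elem j xs))
        ≈⟨ solve 4 (λ x a b n → x :* a :+ ((con 1ℤ :+ n) :* b :+ x :* (n :* a)) := (con 1ℤ :+ n) :* (b :+ x :* a)) refl x (elem j xs) (elem (suc j) xs) (fromℕ j) ⟩
      (fromℤ 1ℤ + fromℕ j) * elem (suc j) (x ∷ xs)
        ≈⟨ *-congʳ (+-congʳ fromℤ-1) ⟩
      fromℕ (suc j) * elem (suc j) (x ∷ xs) ∎)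
    where
      open Solver
      E : ℕ → Carrier
      E i = elem i (x ∷ xs)
      rest : ∀ j → conv (newton-seq xs) E j ≈ fromℕ (suc j) * elem (suc j) xs + x * (fromℕ j * elem j xs)
      rest zero    = trans (sym (newton xs 0)) (sym (trans (+-congˡ (trans (*-congˡ (zeroˡ _)) (zeroʳ x))) (+-identityʳ _)))
      rest (suc j) = trans (conv-delayʳ x (newton-seq xs) refl (λ i → refl) j) (+-cong (sym (newton xs (suc j))) (*-congˡ (sym (newton xs j))))

  signed : List Carrier → ℕ → Carrier
  signed xs i = sgn i * elem i xs

  squares : List Carrier → List Carrier
  squares = map (λ x → x * x)

  -- The even coefficients of E(-t) E(t) = ∏ (1 - x² t²), where E(t) = ∏ (1 + x t).
  graeffe : ∀ xs j → conv (signed xs) (λ i → elem i xs) (double j) ≈ sgn j * elem j (squares xs)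
  graeffe xs       zero    = *-identityʳ _
  graeffe []       (suc j) = trans (+-cong (zeroʳ _) (conv-0ˡ (signed [] ∘ suc) (λ i → elem i []) (suc (double j)) (λ i → zeroʳ (sgn (suc i))))) (trans (+-identityʳ 0#) (sym (zeroʳ _)))
  graeffe (x ∷ xs) (suc j) = begin
      conv f′ E (suc (suc N))
        ≈⟨ conv-delayˡ (- x) {f} {f′} E refl f′-suc (suc N) ⟩
      conv f E (suc (suc N)) + - x * conv f E (suc N)
        ≈⟨ +-cong (conv-delayʳ x f {e} refl (λ _ → refl) (suc N)) (*-congˡ (conv-delayʳ x f {e} refl (λ _ → refl) N)) ⟩
      (conv f e (suc (suc N)) + x * conv f e (suc N)) + - x * (conv f e (suc N) + x * conv f e N)
        ≈⟨ solve 4 (λ x a b c → (a :+ x :* b) :+ (:- x) :* (b :+ x :* c) := a :- (x :* x) :* c) refl x _ _ _ ⟩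
      conv f e (suc (suc N)) - (x * x) * conv f e N
        ≈⟨ +-cong (trans (graeffe xs (suc j)) (*-congʳ (sgn-suc j))) (-‿cong (*-congˡ (graeffe xs j))) ⟩
      - sgn j * elem (suc j) (squares xs) - (x * x) * (sgn j * elem j (squares xs))
        ≈⟨ solve 4 (λ s a y b → (:- s) :* a :- y :* (s :* b) := (:- s) :* (a :+ y :* b)) refl (sgn j) _ (x * x) _ ⟩
      - sgn j * elem (suc j) (squares (x ∷ xs))
        ≈⟨ *-congʳ (sgn-suc j) ⟨
      sgn (suc j) * elem (suc j) (squares (x ∷ xs)) ∎
    where
      open Solver
      N = double j
      f = signed xs
      f′ = signed (x ∷ xs)
      e E : ℕ → Carrier
      e i = elem i xs
      E i = elem i (x ∷ xs)
      f′-suc : ∀ i → f′ (suc i) ≈ f (suc i) + - x * f i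
      f′-suc i = trans (*-congʳ (sgn-suc i)) (trans
        (solve 4 (λ s a x b → (:- s) :* (a :+ x :* b) := (:- s) :* a :+ (:- x) :* (s :* b)) refl (sgn i) (elem (suc i) xs) x (elem i xs))
        (+-congʳ (*-congʳ (sym (sgn-suc i)))))

  -- Evenness of elementary symmetric functions

  -- 2^w is a common denominator of all e_j; this much is known of the multipliers before `even-U`.
  record Integral (w : ℕ) (xs : List Carrier) : Set ℓ where
    constructor integral
    field
      coeff  : ℕ → ℤ
      scaled : ∀ j → fromℤ (coeff j) ≈ fromℤ (pow2 w) * elem j xs
  open Integral

  Even : List Carrier → Set ℓ
  Even xs = ∀ j → ∃ λ z → elem (suc j) xs ≈ fromℤ (+ 2 ℤ.* z)

  negOnePow-square : ∀ j → negOnePow j ℤ.* negOnePow j ≡ 1ℤ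
  negOnePow-square zero    = ≡.refl
  negOnePow-square (suc j) = ≡.trans (lemma (negOnePow j)) (negOnePow-square j)
    where lemma : ∀ x → ℤ.- x ℤ.* ℤ.- x ≡ x ℤ.* x
          lemma = ℤSolver.solve-∀

  private
    negOnePow-odd : ∀ i → ∃ λ s → negOnePow i ≡ 1ℤ ℤ.+ + 2 ℤ.* s
    negOnePow-odd zero    = 0ℤ , ≡.refl
    negOnePow-odd (suc i) = let s , e = negOnePow-odd i in ℤ.- (1ℤ ℤ.+ s) , ≡.trans (cong (ℤ.-_) e) (lemma s)
      where lemma : ∀ s → ℤ.- (1ℤ ℤ.+ + 2 ℤ.* s) ≡ 1ℤ ℤ.+ + 2 ℤ.* (ℤ.- (1ℤ ℤ.+ s))
            lemma = ℤSolver.solve-∀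

  integral-squares : ∀ {w xs} → Integral w xs → Integral (w ℕ.+ w) (squares xs)
  integral-squares {w} {xs} I = record { coeff = H ; scaled = H-scaled }
    where
      E = coeff I
      H : ℕ → ℤ
      H j = negOnePow j ℤ.* Convℤ.conv (λ i → negOnePow i ℤ.* E i) E (double j)
      W = fromℤ (pow2 w)
      H-scaled : ∀ j → fromℤ (H j) ≈ fromℤ (pow2 (w ℕ.+ w)) * elem j (squares xs)
      H-scaled j = begin
        fromℤ (H j)  ≈⟨ fromℤ-* (negOnePow j) _ ⟩
        sgn j * fromℤ (Convℤ.conv (λ i → negOnePow i ℤ.* E i) E (double j))
          ≈⟨ *-congˡ (trans (fromℤ-conv (λ i → negOnePow i ℤ.* E i) E (double j)) (conv-cong (double j)
               (λ i _ → trans (fromℤ-* (negOnePow i) (E i)) (trans (*-congˡ (scaled I i)) (solve 3 (λ s w e → s :* (w :* e) := w :* (s :* e)) refl (sgn i) W (elem i xs))))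
               (λ i _ → scaled I i))) ⟩
        sgn j * conv (λ i → W * signed xs i) (λ i → W * elem i xs) (double j)
          ≈⟨ *-congˡ (trans (conv-*ˡ W (signed xs) _ (double j)) (*-congˡ (conv-*ʳ W (signed xs) (λ i → elem i xs) (double j)))) ⟩
        sgn j * (W * (W * conv (signed xs) (λ i → elem i xs) (double j)))
          ≈⟨ *-congˡ (*-congˡ (*-congˡ (graeffe xs j))) ⟩
        sgn j * (W * (W * (sgn j * elem j (squares xs))))
          ≈⟨ solve 3 (λ s w e → s :* (w :* (w :* (s :* e))) := (s :* s) :* ((w :* w) :* e)) refl (sgn j) W (elem j (squares xs)) ⟩
        (sgn j * sgn j) * ((W * W) * elem j (squares xs))
          ≈⟨ *-cong (trans (sym (fromℤ-* (negOnePow j) (negOnePow j))) (trans (reflexive (cong fromℤ (negOnePow-square j))) fromℤ-1))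
               (*-congʳ (trans (sym (fromℤ-* (pow2 w) (pow2 w))) (reflexive (cong fromℤ (≡.sym (pow2-+ w w)))))) ⟩
        1# * (fromℤ (pow2 (w ℕ.+ w)) * elem j (squares xs)) ≈⟨ *-identityˡ _ ⟩
        fromℤ (pow2 (w ℕ.+ w)) * elem j (squares xs)  ∎
        where open Solver

  private
    -- Graeffe's formula modulo 2: signs disappear and `conv-parity` leaves the middle square.
    coeff-square : ∀ {w xs} (I : Integral w xs) j → ∃ λ z → coeff I j ℤ.* coeff I j ≡ coeff (integral-squares I) j ℤ.+ + 2 ℤ.* z
    coeff-square I j = let
        E = coeff I
        z , e = conv-parity (λ i → negOnePow i ℤ.* E i) E (λ i → proj₁ (negOnePow-odd i) ℤ.* E i)
          (λ i → ≡.trans (cong (ℤ._* E i) (proj₂ (negOnePow-odd i))) (lemma₁ (proj₁ (negOnePow-odd i)) (E i))) j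
        s , f = negOnePow-odd j
        C = Convℤ.conv (λ i → negOnePow i ℤ.* E i) E (double j)
      in ℤ.- (s ℤ.* C) ℤ.- z , ≡.sym (≡.trans (cong (λ t → t ℤ.* C ℤ.+ + 2 ℤ.* (ℤ.- (s ℤ.* C) ℤ.- z)) f)
           (≡.trans (lemma₂ s C z) (≡.trans (cong (ℤ._- (+ 2 ℤ.* z)) e) (lemma₃ (E j ℤ.* E j) z))))
      where
        lemma₁ : ∀ s x → (1ℤ ℤ.+ + 2 ℤ.* s) ℤ.* x ≡ x ℤ.+ + 2 ℤ.* (s ℤ.* x)
        lemma₁ = ℤSolver.solve-∀
        lemma₂ : ∀ s c z → (1ℤ ℤ.+ + 2 ℤ.* s) ℤ.* c ℤ.+ + 2 ℤ.* (ℤ.- (s ℤ.* c) ℤ.- z) ≡ c ℤ.- + 2 ℤ.* z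
        lemma₂ = ℤSolver.solve-∀
        lemma₃ : ∀ x z → x ℤ.+ + 2 ℤ.* z ℤ.- + 2 ℤ.* z ≡ x
        lemma₃ = ℤSolver.solve-∀

    scaled-even : ∀ w {x z} (H : ℤ) → fromℤ H ≈ fromℤ (pow2 w) * x → x ≈ fromℤ (+ 2 ℤ.* z) → H ≡ + 2 ℤ.* (pow2 w ℤ.* z)
    scaled-even w {x} {z} H e f = fromℤ-injective (trans e (trans (*-congˡ f) (trans (sym (fromℤ-* (pow2 w) (+ 2 ℤ.* z)))
      (reflexive (cong fromℤ (lemma (pow2 w) z))))))
      where lemma : ∀ p z → p ℤ.* (+ 2 ℤ.* z) ≡ + 2 ℤ.* (p ℤ.* z)
            lemma = ℤSolver.solve-∀

    coeff-even : ∀ {w xs} (I : Integral w xs) → Even (squares xs) → ∀ j → ∃ λ y → coeff I (suc j) ≡ + 2 ℤ.* y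
    coeff-even {w} {xs} I E j = let
        z , e = coeff-square I (suc j)
        y , f = E j
        H≡ = scaled-even (w ℕ.+ w) {z = y} (coeff (integral-squares I) (suc j)) (scaled (integral-squares I) (suc j)) f
      in square-even (coeff I (suc j)) (pow2 (w ℕ.+ w) ℤ.* y ℤ.+ z) (≡.trans e (≡.trans (cong (ℤ._+ (+ 2 ℤ.* z)) H≡) (≡.sym (ℤₚ.*-distribˡ-+ (+ 2) (pow2 (w ℕ.+ w) ℤ.* y) z))))

  -- Modulo 2 the coefficients for the squares are the squares of the coefficients, so as long as a denominator 2^{w+1}
  -- occurs all numerators are even and it can be halved.
  even-from-squares : ∀ w {xs} → Integral w xs → Even (squares xs) → Even xs
  even-from-squares zero    {xs} I E j = let y , e = coeff-even I E j in
    y , trans (sym (trans (scaled I (suc j)) (trans (*-congʳ fromℤ-1) (*-identityˡ _)))) (reflexive (cong fromℤ e))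
  even-from-squares (suc w) {xs} I E = even-from-squares w (record { coeff = proj₁ ∘ halved ; scaled = λ j → fromℤ-cancel (+ 2) (λ ())
      (trans (sym (fromℤ-* (+ 2) (proj₁ (halved j)))) (trans (reflexive (cong fromℤ (≡.sym (proj₂ (halved j))))) (trans (scaled I j)
        (trans (*-congʳ (trans (reflexive (cong fromℤ (pow2-suc w))) (fromℤ-* (+ 2) (pow2 w)))) (*-assoc _ _ _))))) }) E
    where
      halved : ∀ j → ∃ λ y → coeff I j ≡ + 2 ℤ.* y
      halved zero    = pow2 w , fromℤ-injective (trans (scaled I 0) (trans (*-identityʳ _) (reflexive (cong fromℤ (pow2-suc w)))))
      halved (suc j) = coeff-even I E j

  iterate-squares : ℕ → List Carrier → List Carrier
  iterate-squares zero    xs = xs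
  iterate-squares (suc r) xs = iterate-squares r (squares xs)

  even-from-iterate : ∀ r {w xs} → Integral w xs → Even (iterate-squares r xs) → Even xs
  even-from-iterate zero        I E = E
  even-from-iterate (suc r) {w} I E = even-from-squares w I (even-from-iterate r (integral-squares I) E)

  integral-iterate : ∀ r {w xs} → Integral w xs → ∃ λ w′ → Integral w′ (iterate-squares r xs)
  integral-iterate zero    I = _ , I
  integral-iterate (suc r) I = integral-iterate r (integral-squares I)

  pow-square : ∀ x q → pow (x * x) q ≈ pow x (2 ℕ.* q)
  pow-square x zero    = refl
  pow-square x (suc q) = trans (*-congˡ (pow-square x q)) (trans (*-assoc x x _) (reflexive (cong (pow x) (≡.sym (ℕₚ.*-suc 2 q)))))

  psum-squares : ∀ q xs → psum q (squares xs) ≈ psum (2 ℕ.* q) xs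
  psum-squares q []       = refl
  psum-squares q (x ∷ xs) = +-cong (pow-square x q) (psum-squares q xs)

  psum-iterate : ∀ r q xs → psum q (iterate-squares r xs) ≈ psum (2 ^ r ℕ.* q) xs
  psum-iterate zero    q xs = reflexive (cong (λ n → psum n xs) (≡.sym (ℕₚ.*-identityˡ q)))
  psum-iterate (suc r) q xs = trans (psum-iterate r q (squares xs)) (trans (psum-squares (2 ^ r ℕ.* q) xs)
    (reflexive (cong (λ n → psum n xs) (≡.sym (ℕₚ.*-assoc 2 (2 ^ r) q)))))

  elem-length : ∀ xs j → length xs ≤ j → elem (suc j) xs ≈ 0#
  elem-length []       j       _  = refl
  elem-length (x ∷ xs) (suc j) le = trans (+-cong (elem-length xs (suc j) (≤-trans (n≤1+n _) le))
    (trans (*-congˡ (elem-length xs j (s≤s⁻¹ le))) (zeroʳ x))) (+-identityʳ 0#)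

  length-iterate : ∀ r xs → length (iterate-squares r xs) ≡ length xs
  length-iterate zero    xs = ≡.refl
  length-iterate (suc r) xs = ≡.trans (length-iterate r (squares xs)) (length-map _ xs)

  -- Newton's identity times J!, which clears the denominators of e_0, ..., e_J at once.
  factorial-elem : ∀ B ys → (∀ q → ∃ λ z → psum (suc q) ys ≈ fromℤ (pow2 B ℤ.* z)) →
    ∀ J j → j < J → ∃ λ z → fromℤ (+ (J !)) * elem (suc j) ys ≈ fromℤ (pow2 B ℤ.* z)
  factorial-elem B ys P (suc J) j j<1+J with m≤n⇒m<n∨m≡n (s≤s⁻¹ j<1+J)
  ... | inj₁ j<J = let z , e = factorial-elem B ys P J j j<J in + suc J ℤ.* z , (begin
      fromℤ (+ (suc J !)) * elem (suc j) ys  ≈⟨ *-congʳ (trans (reflexive (cong fromℤ (ℤₚ.pos-* (suc J) (J !)))) (fromℤ-* (+ suc J) (+ (J !)))) ⟩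
      fromℤ (+ suc J) * fromℤ (+ (J !)) * elem (suc j) ys  ≈⟨ trans (*-assoc _ _ _) (*-congˡ e) ⟩
      fromℤ (+ suc J) * fromℤ (pow2 B ℤ.* z)  ≈⟨ fromℤ-* (+ suc J) (pow2 B ℤ.* z) ⟨
      fromℤ (+ suc J ℤ.* (pow2 B ℤ.* z))  ≡⟨ cong fromℤ (lemma (+ suc J) (pow2 B) z) ⟩
      fromℤ (pow2 B ℤ.* (+ suc J ℤ.* z))  ∎)
    where lemma : ∀ a b z → a ℤ.* (b ℤ.* z) ≡ b ℤ.* (a ℤ.* z)
          lemma = ℤSolver.solve-∀
  ... | inj₂ ≡.refl = Convℤ.conv signs lower J , (begin
      fromℤ (+ (suc J !)) * elem (suc J) ys  ≈⟨ *-congʳ (trans (reflexive (cong fromℤ (≡.trans (cong +_ (ℕₚ.*-comm (suc J) (J !))) (ℤₚ.pos-* (J !) (suc J))))) (fromℤ-* (+ (J !)) (+ suc J))) ⟩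
      fromℤ (+ (J !)) * fromℕ (suc J) * elem (suc J) ys  ≈⟨ trans (*-assoc _ _ _) (*-congˡ (newton ys J)) ⟩
      fromℤ (+ (J !)) * conv (newton-seq ys) (λ i → elem i ys) J ≈⟨ conv-*ʳ (fromℤ (+ (J !))) (newton-seq ys) (λ i → elem i ys) J ⟨
      conv (newton-seq ys) (λ i → fromℤ (+ (J !)) * elem i ys) J ≈⟨ conv-cong J (λ i _ → newton-divisible i) lower-correct ⟩
      conv (λ i → fromℤ (pow2 B) * fromℤ (signs i)) (fromℤ ∘ lower) J ≈⟨ conv-*ˡ (fromℤ (pow2 B)) (fromℤ ∘ signs) (fromℤ ∘ lower) J ⟩
      fromℤ (pow2 B) * conv (fromℤ ∘ signs) (fromℤ ∘ lower) J    ≈⟨ *-congˡ (fromℤ-conv signs lower J) ⟨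
      fromℤ (pow2 B) * fromℤ (Convℤ.conv signs lower J)  ≈⟨ fromℤ-* (pow2 B) (Convℤ.conv signs lower J) ⟨
      fromℤ (pow2 B ℤ.* Convℤ.conv signs lower J)  ∎)
    where
      signs lower : ℕ → ℤ
      signs i = negOnePow i ℤ.* proj₁ (P i)
      lower zero    = + (J !)
      lower (suc i) with i ℕₚ.<? J
      ... | yes i<J = pow2 B ℤ.* proj₁ (factorial-elem B ys P J i i<J)
      -- The convolution reads `lower` only up to index J, so this value never enters.
      ... | no  _   = 0ℤ
      newton-divisible : ∀ i → newton-seq ys i ≈ fromℤ (pow2 B) * fromℤ (signs i)
      newton-divisible i = trans (*-congˡ (trans (proj₂ (P i)) (fromℤ-* (pow2 B) (proj₁ (P i)))))
        (trans (solve 3 (λ s b z → s :* (b :* z) := b :* (s :* z)) refl (sgn i) (fromℤ (pow2 B)) (fromℤ (proj₁ (P i))))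
          (*-congˡ (sym (fromℤ-* (negOnePow i) (proj₁ (P i))))))
        where open Solver
      lower-correct : ∀ i → i ≤ J → fromℤ (+ (J !)) * elem i ys ≈ fromℤ (lower i)
      lower-correct zero    _   = *-identityʳ _
      lower-correct (suc i) i<J with i ℕₚ.<? J
      ... | yes p  = proj₂ (factorial-elem B ys P J i p)
      ... | no  ¬p = ⊥-elim (¬p i<J)

  -- Let d be the length. Then d! e_{j+1} is 2^{d!} times an integer, and d! < 2^{d!} cannot absorb
  -- all these factors 2. This inequality is the reason for the exponent d!.
  even-if-divisible : ∀ {w ys} → Integral w ys → (∀ q → ∃ λ z → psum (suc q) ys ≈ fromℤ (pow2 (length ys !) ℤ.* z)) → Even ys
  even-if-divisible {w} {ys} I P j with j ℕₚ.<? length ys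
  ... | no  j≮ = 0ℤ , elem-length ys j (≮⇒≥ j≮)
  ... | yes j< = let
        d = length ys
        B = d !
        z , e = factorial-elem B ys P d j j<
        y , f = small-cancel B B w (coeff I (suc j)) z (1≤n! d) (n<2^n B)
          (fromℤ-injective (trans (fromℤ-* (+ B) (coeff I (suc j))) (trans (*-congˡ (scaled I (suc j)))
            (trans (solve 3 (λ a b x → a :* (b :* x) := b :* (a :* x)) refl (fromℤ (+ B)) (fromℤ (pow2 w)) (elem (suc j) ys))
            (trans (*-congˡ e) (trans (sym (fromℤ-* (pow2 w) (pow2 B ℤ.* z)))
            (reflexive (cong fromℤ (≡.trans (≡.sym (ℤₚ.*-assoc (pow2 w) (pow2 B) z)) (cong (ℤ._* z) (≡.sym (pow2-+ w B))))))))))))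
      in y , fromℤ-cancel (pow2 w) (pow2≢0 w) (trans (sym (scaled I (suc j))) (trans (reflexive (cong fromℤ (≡.trans f (lemma w y)))) (fromℤ-* (pow2 w) (+ 2 ℤ.* y))))
    where
      open Solver
      lemma : ∀ w y → pow2 (suc w) ℤ.* y ≡ pow2 w ℤ.* (+ 2 ℤ.* y)
      lemma w y = ≡.trans (cong (ℤ._* y) (≡.trans (pow2-suc w) (ℤₚ.*-comm (+ 2) (pow2 w)))) (ℤₚ.*-assoc (pow2 w) (+ 2) y)

  even-if-nilpotent : ∀ s {w xs} → Integral w xs → (∀ e → ∃ λ z → psum (2 ^ s ℕ.* suc e) xs ≈ fromℤ (pow2 (suc e) ℤ.* z)) → Even xs
  even-if-nilpotent s {w} {xs} I P = even-from-iterate r I (even-if-divisible (proj₂ (integral-iterate r I)) divisible)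
    where
      B = length xs !
      -- s squarings reach the power sums known to be divisible; B more raise the exponent to 2^B (q
      -- + 1), which is at least B.
      r = s ℕ.+ B
      divisible : ∀ q → ∃ λ z → psum (suc q) (iterate-squares r xs) ≈ fromℤ (pow2 (length (iterate-squares r xs) !) ℤ.* z)
      divisible q = pow2 (e ∸ B) ℤ.* z , (begin
          psum (suc q) (iterate-squares r xs)  ≈⟨ psum-iterate r (suc q) xs ⟩
          psum (2 ^ r ℕ.* suc q) xs  ≡⟨ cong (λ n → psum n xs) index≡ ⟩
          psum (2 ^ s ℕ.* suc e-pred) xs  ≈⟨ proj₂ (P e-pred) ⟩
          fromℤ (pow2 (suc e-pred) ℤ.* z)  ≡⟨ cong (λ n → fromℤ (pow2 n ℤ.* z)) (≡.trans e≡ (≡.sym (m+[n∸m]≡n B≤e))) ⟩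
          fromℤ (pow2 (B ℕ.+ (e ∸ B)) ℤ.* z)  ≡⟨ cong (λ n → fromℤ (n ℤ.* z)) (pow2-+ B (e ∸ B)) ⟩
          fromℤ (pow2 B ℤ.* pow2 (e ∸ B) ℤ.* z)  ≡⟨ cong fromℤ (ℤₚ.*-assoc (pow2 B) (pow2 (e ∸ B)) z) ⟩
          fromℤ (pow2 B ℤ.* (pow2 (e ∸ B) ℤ.* z))  ≡⟨ cong (λ n → fromℤ (pow2 (n !) ℤ.* (pow2 (e ∸ B) ℤ.* z))) (length-iterate r xs) ⟨
          fromℤ (pow2 (length (iterate-squares r xs) !) ℤ.* (pow2 (e ∸ B) ℤ.* z)) ∎)
        where
          e = 2 ^ B ℕ.* suc q
          e-pred = ℕ.pred e
          0<e : 0 < e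
          0<e = ≤-trans (ℕₚ.m^n>0 2 B) (m≤m*n (2 ^ B) (suc q))
          e≡ : suc e-pred ≡ e
          e≡ = ℕₚ.suc-pred e {{ℕ.>-nonZero 0<e}}
          B≤e : B ≤ e
          B≤e = ≤-trans (<⇒≤ (n<2^n B)) (m≤m*n (2 ^ B) (suc q))
          z = proj₁ (P e-pred)
          index≡ : 2 ^ r ℕ.* suc q ≡ 2 ^ s ℕ.* suc e-pred
          index≡ = ≡.trans (cong (ℕ._* suc q) (^-distribˡ-+-* 2 s B)) (≡.trans (ℕₚ.*-assoc (2 ^ s) (2 ^ B) (suc q)) (cong (2 ^ s ℕ.*_) (≡.sym e≡)))

-- Valuations and the power sums of G

module Valuations where

  open ≡ using (refl; sym; trans; cong; cong₂; subst)
  open import Data.Nat.Base using (_+_; _*_)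

  infix 4 2^_∣_
  infixr 4 _2^,_
  record 2^_∣_ (k : ℕ) (x : ℤ) : Set where
    constructor _2^,_
    field
      quotient : ℤ
      equality : x ≡ pow2 k ℤ.* quotient

  from∃ : ∀ {k x} → (∃ λ y → x ≡ pow2 k ℤ.* y) → 2^ k ∣ x
  from∃ (y , e) = y 2^, e

  2^∣⇒∣ : ∀ {k x} → 2^ k ∣ x → 2 ^ k ∣ ℤ.∣ x ∣
  2^∣⇒∣ {k} (y 2^, e) = divides ℤ.∣ y ∣ (trans (cong ℤ.∣_∣ e) (trans (ℤₚ.∣i*j∣≡∣i∣*∣j∣ (pow2 k) y) (ℕₚ.*-comm (2 ^ k) ℤ.∣ y ∣)))

  ∣⇒2^∣ : ∀ {k} x → 2 ^ k ∣ ℤ.∣ x ∣ → 2^ k ∣ x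
  ∣⇒2^∣ {k} (+ n)    (divides q e) = + q 2^, trans (cong +_ (trans e (ℕₚ.*-comm q (2 ^ k)))) (ℤₚ.pos-* (2 ^ k) q)
  ∣⇒2^∣ {k} -[1+ n ] (divides q e) = ℤ.- + q 2^, trans (cong (λ m → ℤ.- + m) (trans e (ℕₚ.*-comm q (2 ^ k))))
    (trans (cong (ℤ.-_) (ℤₚ.pos-* (2 ^ k) q)) (ℤₚ.neg-distribʳ-* (pow2 k) (+ q)))

  2^∣-mono : ∀ {k l x} → k ≤ l → 2^ l ∣ x → 2^ k ∣ x
  2^∣-mono {k} {l} k≤l (y 2^, e) = pow2 (l ∸ k) ℤ.* y 2^, trans e (trans (cong (λ m → pow2 m ℤ.* y) (sym (m+[n∸m]≡n k≤l)))
    (trans (cong (ℤ._* y) (pow2-+ k (l ∸ k))) (ℤₚ.*-assoc (pow2 k) (pow2 (l ∸ k)) y)))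

  2^∣-*ʳ : ∀ {k x} y → 2^ k ∣ x → 2^ k ∣ x ℤ.* y
  2^∣-*ʳ {k} y (z 2^, e) = z ℤ.* y 2^, trans (cong (ℤ._* y) e) (ℤₚ.*-assoc (pow2 k) z y)

  2^∣-* : ∀ {k l x y} → 2^ k ∣ x → 2^ l ∣ y → 2^ (k + l) ∣ x ℤ.* y
  2^∣-* {k} {l} (a 2^, e) (b 2^, f) = a ℤ.* b 2^, trans (cong₂ ℤ._*_ e f) (trans (lemma (pow2 k) a (pow2 l) b) (cong (ℤ._* (a ℤ.* b)) (sym (pow2-+ k l))))
    where lemma : ∀ p a q b → p ℤ.* a ℤ.* (q ℤ.* b) ≡ p ℤ.* q ℤ.* (a ℤ.* b)
          lemma = ℤSolver.solve-∀

  2^∣-+ : ∀ {k x y} → 2^ k ∣ x → 2^ k ∣ y → 2^ k ∣ x ℤ.+ y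
  2^∣-+ {k} (a 2^, e) (b 2^, f) = a ℤ.+ b 2^, trans (cong₂ ℤ._+_ e f) (sym (ℤₚ.*-distribˡ-+ (pow2 k) a b))

  private
    largestPow-∣ : ∀ x f → 2 ^ largestPow 2 x f ∣ x
    largestPow-∣ x zero = divides x (sym (ℕₚ.*-identityʳ x))
    largestPow-∣ x (suc f) with (2 ^ suc f) ∣? x
    ... | yes d = d
    ... | no  _ = largestPow-∣ x f

    largestPow-max : ∀ x f j → j ≤ f → 2 ^ j ∣ x → j ≤ largestPow 2 x f
    largestPow-max x zero    zero _ d = z≤n
    largestPow-max x (suc f) j j≤ d with (2 ^ suc f) ∣? x
    ... | yes _ = j≤
    ... | no ¬d with m≤n⇒m<n∨m≡n j≤
    ...   | inj₁ j< = largestPow-max x f j (s≤s⁻¹ j<) d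
    ...   | inj₂ refl = ⊥-elim (¬d d)

    -- `v` tries exponents up to the absolute value of x; j < 2^j ≤ x shows that none is missed.
    exponent-bound : ∀ {j} x → 0 < x → 2 ^ j ∣ x → j ≤ x
    exponent-bound {j} (suc x) _ d = ≤-trans (<⇒≤ (n<2^n j)) (∣⇒≤ d)

  v-neg : ∀ x → v 2 (ℤ.- x) ≡ v 2 x
  v-neg (+ zero)  = refl
  v-neg +[1+ n ]  = refl
  v-neg -[1+ n ]  = refl

  v-∣ : ∀ {k} x → v 2 x ≡ fin k → 2^ k ∣ x
  v-∣ {k} +[1+ n ] refl = ∣⇒2^∣ +[1+ n ] (largestPow-∣ (suc n) (suc n))
  v-∣ {k} -[1+ n ] refl = ∣⇒2^∣ -[1+ n ] (largestPow-∣ (suc n) (suc n))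

  v-max : ∀ {k j} x → v 2 x ≡ fin k → 2^ j ∣ x → j ≤ k
  v-max +[1+ n ] refl d = largestPow-max (suc n) (suc n) _ (exponent-bound (suc n) z<s (2^∣⇒∣ d)) (2^∣⇒∣ d)
  v-max -[1+ n ] refl d = largestPow-max (suc n) (suc n) _ (exponent-bound (suc n) z<s (2^∣⇒∣ d)) (2^∣⇒∣ d)

  ∣⇒<v : ∀ {k} x → 2^ suc k ∣ x → fin k <∞ v 2 x
  ∣⇒<v (+ zero) d = _
  ∣⇒<v +[1+ n ] d = v-max +[1+ n ] refl d
  ∣⇒<v -[1+ n ] d = v-max -[1+ n ] refl d

  <v⇒∣ : ∀ {k} x → fin k <∞ v 2 x → 2^ suc k ∣ x
  <v⇒∣ {k} (+ zero) _ = 0ℤ 2^, sym (ℤₚ.*-zeroʳ (pow2 (suc k)))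
  <v⇒∣ +[1+ n ] lt = 2^∣-mono lt (v-∣ +[1+ n ] refl)
  <v⇒∣ -[1+ n ] lt = 2^∣-mono lt (v-∣ -[1+ n ] refl)

  powerSum-doubles : ∀ p n r → n * r + 2 ≤ 2 * 2 ^ p → powerSum (suc p) n r ≡ + 2 ℤ.* powerSum p n r
  powerSum-doubles p n r le = go (divisors n) (all-filter (λ j → suc j ∣? n) (upTo n))
    where
      factor : ∀ w x y → w ℤ.* (+ 2 ℤ.* x) ℤ.+ + 2 ℤ.* y ≡ + 2 ℤ.* (w ℤ.* x ℤ.+ y)
      factor = ℤSolver.solve-∀
      term≡ : ∀ j → suc j ∣ n → trace (suc p) j (u (suc p) n ^ₚ r) ≡ + 2 ℤ.* trace p j (u p n ^ₚ r)
      term≡ j (divides q refl) = trace-doubles p j q r le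
      go : ∀ js → All (λ j → suc j ∣ n) js →
        sumℤ (map (λ j → weight (mobius (n / suc j)) ℤ.* trace (suc p) j (u (suc p) n ^ₚ r)) js) ≡
        + 2 ℤ.* sumℤ (map (λ j → weight (mobius (n / suc j)) ℤ.* trace p j (u p n ^ₚ r)) js)
      go []       []       = refl
      go (j ∷ js) (d ∷ ds) = trans (cong₂ (λ x y → weight (mobius (n / suc j)) ℤ.* x ℤ.+ y) (term≡ j d) (go js ds))
        (factor (weight (mobius (n / suc j))) (trace p j (u p n ^ₚ r)) _)

  powerSum-even : ∀ p n′ e → 2^ e ∣ powerSum p (suc n′) (2 ^ suc p * e)
  powerSum-even p n′ e = go (divisors n) (all-filter (λ j → suc j ∣? n) (upTo n))
    where
      n = suc n′
      term-even : ∀ j → suc j ∣ n → 2^ e ∣ trace p j (u p n ^ₚ (2 ^ suc p * e))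
      term-even j (divides (suc q) eq) = subst (λ n → 2^ e ∣ trace p j (u p n ^ₚ (2 ^ suc p * e))) (sym eq) (from∃ (trace-even p j q e))
      go : ∀ js → All (λ j → suc j ∣ n) js → 2^ e ∣ sumℤ (map (λ j → weight (mobius (n / suc j)) ℤ.* trace p j (u p n ^ₚ (2 ^ suc p * e))) js)
      go []       []       = 0ℤ 2^, sym (ℤₚ.*-zeroʳ (pow2 e))
      go (j ∷ js) (d ∷ ds) = 2^∣-+ (subst (2^ e ∣_) (ℤₚ.*-comm (trace p j (u p n ^ₚ (2 ^ suc p * e))) (weight (mobius (n / suc j))))
        (2^∣-*ʳ (weight (mobius (n / suc j))) (term-even j d))) (go js ds)

  -- The doubling range and the exceptional pairs

  evalPowerSum : ℕ → ℕ → ℤ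
  evalPowerSum p n = sumℤ (map (λ j → weight (mobius (n / suc j)) ℤ.* (negOnePow (n / suc j) ℤ.* evalTrace p j (n / suc j))) (divisors n))

  powerSum-eval : ∀ p n → powerSum p n 1 ≡ evalPowerSum p n
  powerSum-eval p n = go (divisors n) (all-filter (λ j → suc j ∣? n) (upTo n))
    where
      go : ∀ js → All (λ j → suc j ∣ n) js → sumℤ (map (λ j → weight (mobius (n / suc j)) ℤ.* trace p j (u p n ^ₚ 1)) js) ≡
        sumℤ (map (λ j → weight (mobius (n / suc j)) ℤ.* (negOnePow (n / suc j) ℤ.* evalTrace p j (n / suc j))) js)
      go []       []       = refl
      go (j ∷ js) (d ∷ ds) = cong₂ (λ x y → weight (mobius (n / suc j)) ℤ.* x ℤ.+ y)
        (trans (cong (λ n → trace p j (u p n ^ₚ 1)) (sym (m/n*n≡m d))) (trace-eval p j (n / suc j))) (go js ds)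

  -- A record, so that comparing types never unfolds powerSum.
  record Indivisible (p n k : ℕ) : Set where
    constructor indivisible
    field not-divides : ¬ 2^ k ∣ powerSum p n 1
  open Indivisible

  private
    not-divisible : ∀ p n k → False ((2 ^ k) ∣? ℤ.∣ evalPowerSum p n ∣) → Indivisible p n k
    not-divisible p n k f = indivisible λ d → toWitnessFalse f (2^∣⇒∣ (subst (2^ k ∣_) (powerSum-eval p n) d))

    -- The first test forces j ≤ J, so the bound has to be tested at J only.
    bounded : ∀ n J C B → True (suc C ℕₚ.≤? 2 * (n * suc J)) → True (n * J + 2 ℕₚ.≤? B) →
      ∀ j → 2 ≤ j → 2 * (n * j) ≤ C → n * j + 2 ≤ B
    bounded n J C B t₁ t₂ j _ h with j ℕₚ.≤? J
    ... | yes j≤J = ≤-trans (+-monoˡ-≤ 2 (*-monoʳ-≤ n j≤J)) (toWitness t₂)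
    ... | no  j≰J = ⊥-elim (<⇒≱ (toWitness t₁) (≤-trans (*-monoʳ-≤ 2 (*-monoʳ-≤ n (≰⇒> j≰J))) h))

    -- The finitely many pairs (m, n), m = p + 2, outside the range of powerSum-doubles; the sum belongs to m + 1.
    exceptional : ∀ p n → ℕ.suc n ≤ 2 * (2 + p) → p < 4 →
      Indivisible (suc p) (suc n) (suc (suc n)) ⊎ (∀ j → 2 ≤ j → 2 * (suc n * j) ≤ 2 * (2 + p) + 3 * suc n → suc n * j + 2 ≤ 2 * 2 ^ p)
        ⊎ (Indivisible (suc p) (suc n) 3 × suc n ≡ 1 × p ≡ 1)
    exceptional 0 0 _ _ = inj₁ (not-divisible 1 1 2 _)
    exceptional 0 1 _ _ = inj₁ (not-divisible 1 2 3 _)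
    exceptional 0 2 _ _ = inj₁ (not-divisible 1 3 4 _)
    exceptional 0 3 _ _ = inj₁ (not-divisible 1 4 5 _)
    -- For m = 3, n = 1 the excluded power is 2^3, not 2^{n+1}. It still gives τ ≤ 3, so j = 2,
    -- which just meets n j + 2 ≤ 4.
    exceptional 1 0 _ _ = inj₂ (inj₂ (not-divisible 2 1 3 _ , refl , refl))
    exceptional 1 1 _ _ = inj₁ (not-divisible 2 2 3 _)
    exceptional 1 2 _ _ = inj₁ (not-divisible 2 3 4 _)
    exceptional 1 3 _ _ = inj₁ (not-divisible 2 4 5 _)
    exceptional 1 4 _ _ = inj₁ (not-divisible 2 5 6 _)
    exceptional 1 5 _ _ = inj₁ (not-divisible 2 6 7 _)
    exceptional 2 0 _ _ = inj₂ (inj₁ (bounded 1 5 11 8 _ _))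
    exceptional 2 1 _ _ = inj₂ (inj₁ (bounded 2 3 14 8 _ _))
    exceptional 2 2 _ _ = inj₂ (inj₁ (bounded 3 2 17 8 _ _))
    exceptional 2 3 _ _ = inj₁ (not-divisible 3 4 5 _)
    exceptional 2 4 _ _ = inj₁ (not-divisible 3 5 6 _)
    exceptional 2 5 _ _ = inj₁ (not-divisible 3 6 7 _)
    exceptional 2 6 _ _ = inj₁ (not-divisible 3 7 8 _)
    exceptional 2 7 _ _ = inj₁ (not-divisible 3 8 9 _)
    exceptional 3 0 _ _ = inj₂ (inj₁ (bounded 1 6 13 16 _ _))
    exceptional 3 1 _ _ = inj₂ (inj₁ (bounded 2 4 16 16 _ _))
    exceptional 3 2 _ _ = inj₂ (inj₁ (bounded 3 3 19 16 _ _))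
    exceptional 3 3 _ _ = inj₂ (inj₁ (bounded 4 2 22 16 _ _))
    exceptional 3 4 _ _ = inj₂ (inj₁ (bounded 5 2 25 16 _ _))
    exceptional 3 5 _ _ = inj₂ (inj₁ (bounded 6 2 28 16 _ _))
    exceptional 3 6 _ _ = inj₂ (inj₁ (bounded 7 2 31 16 _ _))
    exceptional 3 7 _ _ = inj₁ (not-divisible 4 8 9 _)
    exceptional 3 8 _ _ = inj₁ (not-divisible 4 9 10 _)
    exceptional 3 9 _ _ = inj₁ (not-divisible 4 10 11 _)
    exceptional 0 (suc (suc (suc (suc n)))) le _ = ⊥-elim (m+n≮m _ n le)
    exceptional 1 (suc (suc (suc (suc (suc (suc n)))))) le _ = ⊥-elim (m+n≮m _ n le)
    exceptional 2 (suc (suc (suc (suc (suc (suc (suc (suc n)))))))) le _ = ⊥-elim (m+n≮m _ n le)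
    exceptional 3 (suc (suc (suc (suc (suc (suc (suc (suc (suc (suc n)))))))))) le _ = ⊥-elim (m+n≮m _ n le)
    exceptional (suc (suc (suc (suc p)))) n _ (s≤s (s≤s (s≤s (s≤s ()))))

    -- Exponential against linear growth, starting from 26 ≤ 32 at m = 6.
    doubling-range-large : ∀ p → 4 ≤ p → 4 * (2 + p) + 2 ≤ 2 * 2 ^ p
    doubling-range-large p 4≤p = subst (λ p → 4 * (2 + p) + 2 ≤ 2 * 2 ^ p) (m+[n∸m]≡n 4≤p) (go (p ∸ 4))
      where
        go : ∀ i → 4 * (2 + (4 + i)) + 2 ≤ 2 * 2 ^ (4 + i)
        go zero    = toWitness {a? = 26 ℕₚ.≤? 32} _
        go (suc i) = ≤-trans (≤-reflexive (eq i))
            (≤-trans (+-mono-≤ (go i) (≤-trans (≤-trans (m≤m*n 4 (6 + i)) (m≤m+n _ 2)) (go i)))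
              (≤-reflexive (eq₂ (2 ^ (4 + i)))))
          where
            eq : ∀ i → 4 * (2 + (4 + suc i)) + 2 ≡ 4 * (2 + (4 + i)) + 2 + 4
            eq = ℕSolver.solve-∀
            eq₂ : ∀ x → 2 * x + 2 * x ≡ 2 * (2 * x)
            eq₂ = ℕSolver.solve-∀

  2^∣-cancel : ∀ a {b x} → 2^ (a + b) ∣ pow2 a ℤ.* x → 2^ b ∣ x
  2^∣-cancel a {b} {x} (y 2^, e) = y 2^, ℤₚ.*-cancelˡ-≡ (pow2 a) x (pow2 b ℤ.* y) {{ℕₚ.m^n≢0 2 a}}
    (trans e (trans (cong (ℤ._* y) (pow2-+ a b)) (ℤₚ.*-assoc (pow2 a) (pow2 b) y)))

  -- A coefficient not already controlled by its divisibility lies in the range where the power sums double.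
  doubling-range : ∀ p n j τ → 2 ≤ j → suc n * j < τ → 2 * τ ≤ 2 * (suc (suc p) + 1) + 3 * suc n →
    2^ τ ∣ pow2 (suc n) ℤ.* powerSum (suc p) (suc n) 1 → suc n * j + 2 ≤ 2 * 2 ^ p
  doubling-range p n j τ 2≤j lt bound d = by-size (4 ℕₚ.≤? p)
    where
      N = suc n
      m = 2 + p
      h : 2 * (N * j) ≤ 2 * m + 3 * N
      h = +-cancelʳ-≤ 2 _ _ (≤-trans (≤-reflexive (eq₁ (N * j))) (≤-trans (*-monoʳ-≤ 2 lt) (≤-trans bound (≤-reflexive (eq₂ m N)))))
        where
          eq₁ : ∀ x → 2 * x + 2 ≡ 2 * suc x
          eq₁ = ℕSolver.solve-∀
          eq₂ : ∀ m N → 2 * (m + 1) + 3 * N ≡ 2 * m + 3 * N + 2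
          eq₂ = ℕSolver.solve-∀
      2N≤Nj : N + N ≤ N * j
      2N≤Nj = ≤-trans (≤-reflexive (eq N)) (*-monoʳ-≤ N 2≤j)
        where eq : ∀ N → N + N ≡ N * 2
              eq = ℕSolver.solve-∀
      -- As j ≥ 2, 4N ≤ 2Nj ≤ 2m + 3N. Then Nj ≤ 4m, which settles p ≥ 4.
      N≤2m : N ≤ 2 * m
      N≤2m = +-cancelʳ-≤ (3 * N) _ _ (≤-trans (≤-reflexive (eq N)) (≤-trans (*-monoʳ-≤ 2 2N≤Nj) h))
        where eq : ∀ N → N + 3 * N ≡ 2 * (N + N)
              eq = ℕSolver.solve-∀
      by-size : Dec (4 ≤ p) → N * j + 2 ≤ 2 * 2 ^ p
      by-size (yes 4≤p) = ≤-trans (+-monoˡ-≤ 2 (*-cancelˡ-≤ {N * j} {4 * m} 2 (≤-trans h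
          (≤-trans (+-monoʳ-≤ (2 * m) (*-monoʳ-≤ 3 N≤2m)) (≤-reflexive (eq m)))))) (doubling-range-large p 4≤p)
        where eq : ∀ m → 2 * m + 3 * (2 * m) ≡ 2 * (4 * m)
              eq = ℕSolver.solve-∀
      by-size (no 4≰p) = by-case (exceptional p n N≤2m (≰⇒> 4≰p))
        where
          single : ∀ {N p τ} → N ≡ 1 → p ≡ 1 → N * j < τ → ¬ 4 ≤ τ → N * j + 2 ≤ 2 * 2 ^ p
          single refl refl lt 4≰τ = +-monoˡ-≤ 2 (s≤s⁻¹ (≤-trans lt (s≤s⁻¹ (≰⇒> 4≰τ))))
          by-case : _ ⊎ _ ⊎ _ → N * j + 2 ≤ 2 * 2 ^ p
          -- τ > N j ≥ 2N, and 2^τ divides 2^N times the power sum; so 2^{N+1} would divide the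
          -- power sum.
          by-case (inj₁ ¬d) = ⊥-elim (not-divides ¬d (2^∣-cancel N (2^∣-mono
            (≤-trans (≤-reflexive (ℕₚ.+-suc N N)) (≤-trans (s≤s 2N≤Nj) lt)) d)))
          by-case (inj₂ (inj₁ f)) = f j 2≤j h
          by-case (inj₂ (inj₂ (¬d , N≡1 , p≡1))) = single N≡1 p≡1 lt λ 4≤τ →
            not-divides ¬d (2^∣-cancel N (2^∣-mono (≤-trans (+-monoˡ-≤ 3 (≤-reflexive N≡1)) 4≤τ) d))

open Valuations

-- The coefficients of P_{m,n}

nth : List ℤ → ℕ → ℤ
nth []       i       = 0ℤ
nth (x ∷ xs) zero    = x
nth (x ∷ xs) (suc i) = nth xs i

nth-∷ʳ-< : ∀ xs {y} i → i < length xs → nth (xs ∷ʳ y) i ≡ nth xs i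
nth-∷ʳ-< (x ∷ xs) zero    _  = ≡.refl
nth-∷ʳ-< (x ∷ xs) (suc i) lt = nth-∷ʳ-< xs i (s<s⁻¹ lt)

nth-∷ʳ-length : ∀ xs {y} → nth (xs ∷ʳ y) (length xs) ≡ y
nth-∷ʳ-length []       = ≡.refl
nth-∷ʳ-length (x ∷ xs) = nth-∷ʳ-length xs

nth-beyond : ∀ xs i → length xs ≤ i → nth xs i ≡ 0ℤ
nth-beyond []       i       _  = ≡.refl
nth-beyond (x ∷ xs) (suc i) le = nth-beyond xs i (s≤s⁻¹ le)

length-∷ʳ : ∀ {A : Set} (xs : List A) {y} → length (xs ∷ʳ y) ≡ suc (length xs)
length-∷ʳ []       = ≡.refl
length-∷ʳ (_ ∷ xs) = cong suc (length-∷ʳ xs)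

all-nth : ∀ {Q : ℤ → Set} xs → (∀ i → i < length xs → Q (nth xs i)) → All Q xs
all-nth []       q = []
all-nth (x ∷ xs) q = q 0 z<s ∷ all-nth xs (λ i lt → q (suc i) (s<s lt))

nth-all : ∀ {Q : ℤ → Set} {xs} → All Q xs → ∀ i → i < length xs → Q (nth xs i)
nth-all (q ∷ _)  zero    _  = q
nth-all (_ ∷ qs) (suc i) lt = nth-all qs i (s<s⁻¹ lt)

open OverRing ℤ-ring using () renaming (pow to powℤ)

powℤ-neg-pow2 : ∀ n j → powℤ (ℤ.- pow2 n) j ≡ negOnePow j ℤ.* pow2 (n ℕ.* j)
powℤ-neg-pow2 n zero    = ≡.sym (cong (λ k → 1ℤ ℤ.* pow2 k) (ℕₚ.*-zeroʳ n))
powℤ-neg-pow2 n (suc j) = ≡.trans (cong (ℤ._*_ (ℤ.- pow2 n)) (powℤ-neg-pow2 n j)) (≡.trans (lemma (pow2 n) (negOnePow j) (pow2 (n ℕ.* j)))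
    (cong (ℤ._*_ (ℤ.- negOnePow j)) (≡.trans (≡.sym (pow2-+ n (n ℕ.* j))) (cong pow2 (≡.sym (ℕₚ.*-suc n j))))))
  where lemma : ∀ a b c → ℤ.- a ℤ.* (b ℤ.* c) ≡ ℤ.- b ℤ.* (a ℤ.* c)
        lemma = ℤSolver.solve-∀

conv-∣ : ∀ {k l} f g → (∀ i → 2^ k ∣ f i) → (∀ i → 2^ l ∣ g i) → ∀ n → 2^ (k ℕ.+ l) ∣ Convolution.conv ℤ-ring f g n
conv-∣ f g df dg zero    = 2^∣-* (df 0) (dg 0)
conv-∣ f g df dg (suc n) = 2^∣-+ (2^∣-* (df 0) (dg (suc n))) (conv-∣ (f ∘ suc) g (df ∘ suc) dg n)

conv-geometric : ∀ c f g n → Convolution.conv ℤ-ring (λ i → powℤ c i ℤ.* f i) (λ i → powℤ c i ℤ.* g i) n ≡ powℤ c n ℤ.* Convolution.conv ℤ-ring f g n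
conv-geometric c f g zero    = lemma (f 0) (g 0)
  where lemma : ∀ a b → 1ℤ ℤ.* a ℤ.* (1ℤ ℤ.* b) ≡ 1ℤ ℤ.* (a ℤ.* b)
        lemma = ℤSolver.solve-∀
conv-geometric c f g (suc n) = ≡.trans (cong (ℤ._+_ (1ℤ ℤ.* f 0 ℤ.* (powℤ c (suc n) ℤ.* g (suc n))))
    (≡.trans (conv-cong n (λ i _ → ℤₚ.*-assoc c (powℤ c i) (f (suc i))) (λ _ _ → ≡.refl))
      (≡.trans (conv-*ˡ c (λ i → powℤ c i ℤ.* f (suc i)) _ n) (cong (ℤ._*_ c) (conv-geometric c (f ∘ suc) g n)))))
    (lemma (f 0) (g (suc n)) c (powℤ c n) (conv (f ∘ suc) g n))
  where open Convolution ℤ-ring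
        lemma : ∀ a b c p z → 1ℤ ℤ.* a ℤ.* (c ℤ.* p ℤ.* b) ℤ.+ c ℤ.* (p ℤ.* z) ≡ c ℤ.* p ℤ.* (a ℤ.* b ℤ.+ z)
        lemma = ℤSolver.solve-∀

module Coefficients {c ℓ} (K : CommutativeRing c ℓ) (field-K : OverRing.IsField K) (char-K : OverRing.CharZero K) where
  open CommutativeRing K hiding (zero)
  open OverRing K
  open IntegerHom K
  open Symmetric K field-K char-K public
  open Roots K public using (multiplier; powerSum-correct; sumK; sumK-cong)
  open Convolution K
  open import Relation.Binary.Reasoning.Setoid setoid
  open import Algebra.Properties.Ring ring using (-‿distribˡ-*)

  coef : Poly → ℕ → Carrier
  coef []      i       = 0#
  coef (a ∷ p) zero    = a
  coef (a ∷ p) (suc i) = coef p i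

  coef-≈0 : ∀ {p} → [] ≈P p → ∀ i → coef p i ≈ 0#
  coef-≈0 {[]}    e       i       = refl
  coef-≈0 {a ∷ p} (e , f) zero    = e
  coef-≈0 {a ∷ p} (e , f) (suc i) = coef-≈0 f i

  coef-0≈ : ∀ {p} → p ≈P [] → ∀ i → coef p i ≈ 0#
  coef-0≈ {[]}    e       i       = refl
  coef-0≈ {a ∷ p} (e , f) zero    = e
  coef-0≈ {a ∷ p} (e , f) (suc i) = coef-0≈ f i

  coef-≈P : ∀ {p q} → p ≈P q → ∀ i → coef p i ≈ coef q i
  coef-≈P {[]}    {q}     e       i       = sym (coef-≈0 {q} e i)
  coef-≈P {a ∷ p} {[]}    e       i       = coef-0≈ {a ∷ p} e i
  coef-≈P {a ∷ p} {b ∷ q} (e , f) zero    = e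
  coef-≈P {a ∷ p} {b ∷ q} (e , f) (suc i) = coef-≈P f i

  coef-⊕ : ∀ p q i → coef (p ⊕ q) i ≈ coef p i + coef q i
  coef-⊕ []      q       i       = sym (+-identityˡ _)
  coef-⊕ (a ∷ p) []      i       = sym (+-identityʳ _)
  coef-⊕ (a ∷ p) (b ∷ q) zero    = refl
  coef-⊕ (a ∷ p) (b ∷ q) (suc i) = coef-⊕ p q i

  coef-map-* : ∀ a p i → coef (map (a *_) p) i ≈ a * coef p i
  coef-map-* a []      i       = sym (zeroʳ a)
  coef-map-* a (b ∷ p) zero    = refl
  coef-map-* a (b ∷ p) (suc i) = coef-map-* a p i

  coef-fromℤ : ∀ xs i → coef (map fromℤ xs) i ≈ fromℤ (nth xs i)
  coef-fromℤ []       i       = refl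
  coef-fromℤ (x ∷ xs) zero    = refl
  coef-fromℤ (x ∷ xs) (suc i) = coef-fromℤ xs i

  coef-linear-zero : ∀ r q → coef (linear r ⊗ q) 0 ≈ - r * coef q 0
  coef-linear-zero r q = trans (coef-⊕ (map (- r *_) q) _ 0) (trans (+-identityʳ _) (coef-map-* (- r) q 0))

  coef-linear-suc : ∀ r q i → coef (linear r ⊗ q) (suc i) ≈ - r * coef q (suc i) + coef q i
  coef-linear-suc r q i = trans (coef-⊕ (map (- r *_) q) _ (suc i)) (+-cong (coef-map-* (- r) q (suc i))
    (trans (coef-⊕ (map (1# *_) q) (0# ∷ []) i) (trans (+-cong (trans (coef-map-* 1# q i) (*-identityˡ _)) (zero-coef i)) (+-identityʳ _))))
    where zero-coef : ∀ i → coef (0# ∷ []) i ≈ 0#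
          zero-coef zero    = refl
          zero-coef (suc i) = refl

  -- Used with g = λ, h = u and c = - 2^n: sign and powers of 2 split off the coefficients together.
  module Product (c : Carrier) (g h : Carrier → Carrier) (eq : ∀ β → - g β ≈ c * h β) where
    product : List Carrier → Poly
    product βs = prodP (map (λ β → linear (g β)) βs)

    coef-beyond : ∀ βs i → length βs < i → coef (product βs) i ≈ 0#
    coef-beyond []       (suc i) _  = refl
    coef-beyond (β ∷ βs) (suc i) lt = trans (coef-linear-suc (g β) (product βs) i) (trans
      (+-cong (trans (*-congˡ (coef-beyond βs (suc i) (m<n⇒m<1+n (s<s⁻¹ lt)))) (zeroʳ _)) (coef-beyond βs i (s<s⁻¹ lt))) (+-identityˡ 0#))

    coef-elem : ∀ βs i j → i ℕ.+ j ≡ length βs → coef (product βs) i ≈ pow c j * elem j (map h βs)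
    coef-elem []       zero    zero    e = sym (*-identityˡ 1#)
    coef-elem (β ∷ βs) zero    (suc j) e = begin
        coef (linear (g β) ⊗ product βs) 0  ≈⟨ coef-linear-zero (g β) (product βs) ⟩
        - g β * coef (product βs) 0  ≈⟨ *-cong (eq β) (coef-elem βs 0 j (ℕₚ.suc-injective e)) ⟩
        c * h β * (pow c j * elem j (map h βs))  ≈⟨ solve 4 (λ c h p e → c :* h :* (p :* e) := c :* p :* (con 0ℤ :+ h :* e)) refl c (h β) (pow c j) (elem j (map h βs)) ⟩
        pow c (suc j) * (0# + h β * elem j (map h βs))  ≈⟨ *-congˡ (+-congʳ (elem-length (map h βs) j (≤-reflexive (≡.trans (length-map h βs) (≡.sym (ℕₚ.suc-injective e)))))) ⟨
        pow c (suc j) * elem (suc j) (map h (β ∷ βs))  ∎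
      where open Solver
    coef-elem (β ∷ βs) (suc i) zero    e = trans (coef-linear-suc (g β) (product βs) i) (trans
      (+-cong (trans (*-congˡ (coef-beyond βs (suc i) (s≤s (≤-reflexive (≡.trans (≡.sym (ℕₚ.suc-injective e)) (ℕₚ.+-identityʳ i)))))) (zeroʳ _))
        (coef-elem βs i zero (ℕₚ.suc-injective e))) (+-identityˡ _))
    coef-elem (β ∷ βs) (suc i) (suc j) e = begin
        coef (linear (g β) ⊗ product βs) (suc i)  ≈⟨ coef-linear-suc (g β) (product βs) i ⟩
        - g β * coef (product βs) (suc i) + coef (product βs) i
          ≈⟨ +-cong (*-cong (eq β) (coef-elem βs (suc i) j (≡.trans (≡.sym (ℕₚ.+-suc i j)) (ℕₚ.suc-injective e)))) (coef-elem βs i (suc j) (ℕₚ.suc-injective e)) ⟩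
        c * h β * (pow c j * elem j (map h βs)) + c * pow c j * elem (suc j) (map h βs)
          ≈⟨ solve 5 (λ c h p e f → c :* h :* (p :* e) :+ c :* p :* f := c :* p :* (f :+ h :* e)) refl c (h β) (pow c j) (elem j (map h βs)) (elem (suc j) (map h βs)) ⟩
        pow c (suc j) * elem (suc j) (map h (β ∷ βs))  ∎
      where open Solver

  fromℤ-pow : ∀ x j → fromℤ (powℤ x j) ≈ pow (fromℤ x) j
  fromℤ-pow x zero    = fromℤ-1
  fromℤ-pow x (suc j) = trans (fromℤ-* x (powℤ x j)) (*-congˡ (fromℤ-pow x j))

  fromℤ-pow2 : ∀ n → pow (1# + 1#) n ≈ fromℤ (pow2 n)
  fromℤ-pow2 zero    = sym fromℤ-1
  fromℤ-pow2 (suc n) = trans (*-cong (+-congˡ (sym (+-identityʳ 1#))) (fromℤ-pow2 n)) (trans (sym (fromℤ-* (+ 2) (pow2 n))) (reflexive (cong fromℤ (≡.sym (pow2-suc n)))))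

  psum-++ : ∀ q xs ys → psum q (xs ++ ys) ≈ psum q xs + psum q ys
  psum-++ q []       ys = sym (+-identityˡ _)
  psum-++ q (x ∷ xs) ys = trans (+-congˡ (psum-++ q xs ys)) (sym (+-assoc _ _ _))

  elem-++ : ∀ xs ys j → elem j (xs ++ ys) ≈ conv (λ i → elem i xs) (λ i → elem i ys) j
  elem-++ xs       ys zero    = sym (*-identityˡ 1#)
  elem-++ []       ys (suc j) = sym (trans (+-cong (*-identityˡ _) (conv-0ˡ _ (λ i → elem i ys) j (λ _ → refl))) (+-identityʳ _))
  elem-++ (x ∷ xs) ys (suc j) = trans (+-cong (elem-++ xs ys (suc j)) (*-congˡ (elem-++ xs ys j)))
    (sym (conv-delayˡ x {λ i → elem i xs} {λ i → elem i (x ∷ xs)} (λ i → elem i ys) refl (λ _ → refl) j))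

  -- Newton's identities determine e_{j+1} after division by j + 1, possible in characteristic 0.
  elem-determined : ∀ {xs ys} J → (∀ i → i < J → psum (suc i) xs ≈ psum (suc i) ys) → ∀ j → j ≤ J → elem j xs ≈ elem j ys
  elem-determined         J       P zero    _  = refl
  elem-determined {xs} {ys} (suc J) P (suc j) le = fromℤ-cancel (+ suc j) (λ ()) (trans (newton xs j) (trans
    (conv-cong j (λ i i≤j → *-congˡ (P i (≤-trans (s≤s i≤j) le)))
      (λ i i≤j → elem-determined J (λ k k<J → P k (m<n⇒m<1+n k<J)) i (≤-trans i≤j (s≤s⁻¹ le))))
    (sym (newton ys j))))

  elem-1 : ∀ xs → elem 1 xs ≈ psum 1 xs
  elem-1 []       = refl
  elem-1 (x ∷ xs) = trans (+-congʳ (elem-1 xs)) (+-comm _ _)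

  module Multipliers (p n′ : ℕ) (βs : List Carrier) (roots : RootsOfG (suc (suc p)) (suc n′) βs)
    (Bs : List ℤ) (int : IsIntPoly Bs (Pmn (suc (suc p)) (suc n′) βs)) where

    private
      m = suc (suc p)
      n = suc n′
      d = length βs
    C : ℤ
    C = ℤ.- pow2 n

    U : List Carrier
    U = map (multiplier m n) βs

    lam-multiplier : ∀ β → lam m n β ≈ fromℤ (pow2 n) * multiplier m n β
    lam-multiplier β = *-congʳ (fromℤ-pow2 n)

    private
      neg-lam : ∀ β → - lam m n β ≈ fromℤ C * multiplier m n β
      neg-lam β = trans (-‿cong (lam-multiplier β)) (trans (-‿distribˡ-* _ _) (*-congʳ (sym (fromℤ-neg (pow2 n)))))
      open Product (fromℤ C) (lam m n) (multiplier m n) neg-lam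

      1≉0 : ¬ 1# ≈ 0#
      1≉0 = proj₁ field-K

      nth-int : ∀ i → fromℤ (nth (Bs ∷ʳ 1ℤ) i) ≈ coef (product βs) i
      nth-int i = trans (sym (coef-fromℤ (Bs ∷ʳ 1ℤ) i)) (coef-≈P int i)

    -- `_≈P_` ignores trailing zeros, so the degrees are matched through the leading coefficients 1.
    length≡ : length Bs ≡ d
    length≡ with <-cmp (length Bs) d
    ... | tri≈ _ e _ = e
    ... | tri< lt _ _ = ⊥-elim (1≉0 (begin
        1#  ≈⟨ *-identityˡ 1# ⟨
        pow (fromℤ C) 0 * elem 0 U  ≈⟨ coef-elem βs d 0 (ℕₚ.+-identityʳ d) ⟨
        coef (product βs) d  ≈⟨ nth-int d ⟨
        fromℤ (nth (Bs ∷ʳ 1ℤ) d)    ≡⟨ cong fromℤ (nth-beyond (Bs ∷ʳ 1ℤ) d (≡.subst (_≤ d) (≡.sym (length-∷ʳ Bs)) lt)) ⟩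
        0#  ∎))
    ... | tri> _ _ gt = ⊥-elim (1≉0 (begin
        1#  ≈⟨ fromℤ-1 ⟨
        fromℤ 1ℤ  ≡⟨ cong fromℤ (nth-∷ʳ-length Bs) ⟨
        fromℤ (nth (Bs ∷ʳ 1ℤ) (length Bs))    ≈⟨ nth-int (length Bs) ⟩
        coef (product βs) (length Bs)  ≈⟨ coef-beyond βs (length Bs) gt ⟩
        0#  ∎))

    private
      nth-elem : ∀ i j → i ℕ.+ suc j ≡ d → fromℤ (nth Bs i) ≈ pow (fromℤ C) (suc j) * elem (suc j) U
      nth-elem i j e = trans (reflexive (cong fromℤ (≡.sym (nth-∷ʳ-< Bs i (≡.subst (i <_) (≡.trans e (≡.sym length≡)) (m<m+n i z<s))))))
        (trans (nth-int i) (coef-elem βs i (suc j) e))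

      scaled-elem : ∀ j → ∃ λ E → fromℤ E ≈ pow (fromℤ C) j * elem j U
      scaled-elem zero    = 1ℤ , trans fromℤ-1 (sym (*-identityˡ 1#))
      scaled-elem (suc j) with j ℕₚ.<? d
      ... | yes lt = nth Bs (d ∸ suc j) , nth-elem (d ∸ suc j) j (m∸n+n≡m lt)
      ... | no  ge = 0ℤ , sym (trans (*-congˡ (elem-length U j (≡.subst (_≤ j) (≡.sym (length-map _ βs)) (≮⇒≥ ge)))) (zeroʳ _))

      -- 2^{nd} = ± 2^{n(d-J)} C^J for J ≤ d, and C^J e_J is a coefficient of P_{m,n}; beyond d all
      -- e_J vanish.
      integral-U : Integral (n ℕ.* d) U
      integral-U = integral (λ j → proj₁ (coefficient j)) (λ j → proj₂ (coefficient j))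
        where
          coefficient : ∀ j → ∃ λ E → fromℤ E ≈ fromℤ (pow2 (n ℕ.* d)) * elem j U
          coefficient zero    = pow2 (n ℕ.* d) , sym (*-identityʳ _)
          coefficient (suc j) with j ℕₚ.<? d
          ... | no  ge = 0ℤ , sym (trans (*-congˡ (elem-length U j (≡.subst (_≤ j) (≡.sym (length-map _ βs)) (≮⇒≥ ge)))) (zeroʳ _))
          ... | yes lt = let E , e = scaled-elem J ; F = negOnePow J ℤ.* pow2 (n ℕ.* (d ∸ J)) in F ℤ.* E , (begin
              fromℤ (F ℤ.* E)  ≈⟨ trans (fromℤ-* F E) (*-congˡ e) ⟩
              fromℤ F * (pow (fromℤ C) J * elem J U)  ≈⟨ trans (sym (*-assoc _ _ _)) (*-congʳ (*-congˡ (sym (fromℤ-pow C J)))) ⟩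
              fromℤ F * fromℤ (powℤ C J) * elem J U  ≈⟨ *-congʳ (trans (sym (fromℤ-* F (powℤ C J))) (reflexive (cong fromℤ signs))) ⟩
              fromℤ (pow2 (n ℕ.* d)) * elem J U  ∎)
            where
              J = suc j
              lemma : ∀ s a b → s ℤ.* a ℤ.* (s ℤ.* b) ≡ s ℤ.* s ℤ.* (a ℤ.* b)
              lemma = ℤSolver.solve-∀
              signs : negOnePow J ℤ.* pow2 (n ℕ.* (d ∸ J)) ℤ.* powℤ C J ≡ pow2 (n ℕ.* d)
              signs = ≡.trans (cong (ℤ._*_ (negOnePow J ℤ.* pow2 (n ℕ.* (d ∸ J)))) (powℤ-neg-pow2 n J))
                (≡.trans (lemma (negOnePow J) (pow2 (n ℕ.* (d ∸ J))) (pow2 (n ℕ.* J)))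
                (≡.trans (cong (ℤ._* (pow2 (n ℕ.* (d ∸ J)) ℤ.* pow2 (n ℕ.* J))) (negOnePow-square J))
                (≡.trans (ℤₚ.*-identityˡ _) (≡.trans (≡.sym (pow2-+ (n ℕ.* (d ∸ J)) (n ℕ.* J)))
                (cong pow2 (≡.trans (≡.sym (ℕₚ.*-distribˡ-+ n (d ∸ J) J)) (cong (n ℕ.*_) (m∸n+n≡m lt))))))))

    psum-U : ∀ r → psum (suc r) U ≈ fromℤ (powerSum p n (suc r))
    psum-U r = trans (reflexive (cong (foldr _+_ 0#) (≡.sym (map-∘ βs)))) (powerSum-correct p n′ r βs roots)

    abstract
      even-U : Even U
      even-U = even-if-nilpotent (suc p) integral-U (λ e → let z 2^, eq = powerSum-even p n′ (suc e) ; N = ℕ.pred (2 ^ suc p ℕ.* suc e) in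
        z , trans (reflexive (cong (λ q → psum q U) (≡.sym (N≡ e)))) (trans (psum-U N) (reflexive (cong fromℤ (≡.trans (cong (powerSum p n) (N≡ e)) eq)))))
        where N≡ : ∀ e → suc (ℕ.pred (2 ^ suc p ℕ.* suc e)) ≡ 2 ^ suc p ℕ.* suc e
              N≡ e = ℕₚ.suc-pred (2 ^ suc p ℕ.* suc e) {{ℕ.>-nonZero (≤-trans (ℕₚ.m^n>0 2 (suc p)) (m≤m*n (2 ^ suc p) (suc e)))}}

    a : ℕ → ℤ
    a zero    = 1ℤ
    a (suc j) = + 2 ℤ.* proj₁ (even-U j)

    a-elem : ∀ j → fromℤ (a j) ≈ elem j U
    a-elem zero    = fromℤ-1
    a-elem (suc j) = sym (proj₂ (even-U j))

    -- The coefficient of x^{d-j} in P_{m,n}, sign included, and 0 for j > d.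
    e : ℕ → ℤ
    e j = powℤ C j ℤ.* a j

    nth-e : ∀ i j → i ℕ.+ suc j ≡ d → nth Bs i ≡ e (suc j)
    nth-e i j eq = fromℤ-injective (trans (nth-elem i j eq) (sym (trans (fromℤ-* (powℤ C (suc j)) (a (suc j))) (*-cong (fromℤ-pow C (suc j)) (a-elem (suc j))))))

    e-beyond : ∀ j → d ≤ j → e (suc j) ≡ 0ℤ
    e-beyond j d≤j = ≡.trans (cong (ℤ._*_ (powℤ C (suc j))) (fromℤ-injective (trans (a-elem (suc j)) (elem-length U j (≡.subst (_≤ j) (≡.sym (length-map _ βs)) d≤j)))))
      (ℤₚ.*-zeroʳ (powℤ C (suc j)))

    e-divisible : ∀ j → 2^ suc (n ℕ.* suc j) ∣ e (suc j)
    e-divisible j = ≡.subst (λ k → 2^ k ∣ e (suc j)) (ℕₚ.+-comm (n ℕ.* suc j) 1)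
      (2^∣-* {n ℕ.* suc j} {1} (≡.subst (2^ (n ℕ.* suc j) ∣_) (≡.trans (ℤₚ.*-comm (pow2 (n ℕ.* suc j)) (negOnePow (suc j))) (≡.sym (powℤ-neg-pow2 n (suc j))))
        (2^∣-*ʳ (negOnePow (suc j)) (1ℤ 2^, ≡.sym (ℤₚ.*-identityʳ (pow2 (n ℕ.* suc j)))))) (proj₁ (even-U j) 2^, ≡.refl))

    a-1 : a 1 ≡ powerSum p n 1
    a-1 = fromℤ-injective (trans (a-elem 1) (trans (elem-1 U) (psum-U 0)))

    e-1 : e 1 ≡ ℤ.- (pow2 n ℤ.* a 1)
    e-1 = lemma (pow2 n) (a 1)
      where lemma : ∀ x y → (ℤ.- x) ℤ.* 1ℤ ℤ.* y ≡ ℤ.- (x ℤ.* y)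
            lemma = ℤSolver.solve-∀

    trace-a : ∀ t → fromℤ t ≈ trP m n βs → t ≡ pow2 n ℤ.* a 1
    trace-a t eq = fromℤ-injective (trans eq (trans (go βs) (trans (*-congˡ (sym (a-elem 1))) (sym (fromℤ-* (pow2 n) (a 1))))))
      where go : ∀ βs → foldr _+_ 0# (map (lam m n) βs) ≈ fromℤ (pow2 n) * elem 1 (map (multiplier m n) βs)
            go []       = sym (zeroʳ _)
            go (β ∷ βs) = trans (+-cong (lam-multiplier β) (go βs)) (trans (sym (distribˡ _ _ _)) (*-congˡ (trans (+-comm _ _) (+-congˡ (sym (*-identityʳ _))))))

-- From P_{m,n} to P_{m+1,n}

module Transfer {c ℓ} (K : CommutativeRing c ℓ) (field-K : OverRing.IsField K) (char-K : OverRing.CharZero K)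
  (p n′ : ℕ) (αs βs : List (CommutativeRing.Carrier K))
  (rootsα : OverRing.RootsOfG K (suc (suc p)) (suc n′) αs) (rootsβ : OverRing.RootsOfG K (suc (suc (suc p))) (suc n′) βs)
  (As Bs : List ℤ) (intα : OverRing.IsIntPoly K As (OverRing.Pmn K (suc (suc p)) (suc n′) αs))
  (intβ : OverRing.IsIntPoly K Bs (OverRing.Pmn K (suc (suc (suc p))) (suc n′) βs)) where

  open Coefficients K field-K char-K
  open CommutativeRing K using (_≈_; reflexive) renaming (sym to ≈-sym; trans to ≈-trans; +-cong to ≈-+-cong)
  open OverRing K using (fromℤ; trP)
  open IntegerHom K using (fromℤ-+)
  module α = Multipliers p n′ αs rootsα As intα
  module β = Multipliers (suc p) n′ βs rootsβ Bs intβ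
  open Convolution ℤ-ring using (conv; conv-last)

  private
    n = suc n′

  -- Doubled power sums are those of the list repeated twice, the root list of a square.
  psum-doubles : ∀ r → n ℕ.* suc r ℕ.+ 2 ≤ 2 ℕ.* 2 ^ p → psum (suc r) β.U ≈ psum (suc r) (α.U ++ α.U)
  psum-doubles r le = ≈-trans (β.psum-U r) (≈-trans (reflexive (cong fromℤ (≡.trans (powerSum-doubles p n (suc r) le) (twice (powerSum p n (suc r))))))
      (≈-trans (fromℤ-+ (powerSum p n (suc r)) (powerSum p n (suc r))) (≈-sym (≈-trans (psum-++ (suc r) α.U α.U) (≈-+-cong (α.psum-U r) (α.psum-U r))))))
    where twice : ∀ x → + 2 ℤ.* x ≡ x ℤ.+ x
          twice = ℤSolver.solve-∀

  a-convolution : ∀ J → n ℕ.* J ℕ.+ 2 ≤ 2 ℕ.* 2 ^ p → β.a J ≡ conv α.a α.a J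
  a-convolution J le = fromℤ-injective (≈-trans (β.a-elem J) (≈-trans
      (elem-determined J (λ i i<J → psum-doubles i (≤-trans (+-monoˡ-≤ 2 (*-monoʳ-≤ n i<J)) le)) J ≤-refl)
      (≈-trans (elem-++ α.U α.U J) (≈-trans (Convolution.conv-cong K J (λ i _ → ≈-sym (α.a-elem i)) (λ i _ → ≈-sym (α.a-elem i)))
        (≈-sym (fromℤ-conv α.a α.a J))))))

  -- C depends on n alone, so its powers are the same for m and m + 1.
  e-convolution : ∀ J → n ℕ.* J ℕ.+ 2 ≤ 2 ℕ.* 2 ^ p → β.e J ≡ conv α.e α.e J
  e-convolution J le = ≡.trans (cong (ℤ._*_ (powℤ β.C J)) (a-convolution J le)) (≡.sym (conv-geometric β.C α.a α.a J))

  e-doubles : n ℕ.+ 2 ≤ 2 ℕ.* 2 ^ p → β.e 1 ≡ + 2 ℤ.* α.e 1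
  e-doubles le = ≡.trans (e-convolution 1 (≤-trans (≤-reflexive (cong (ℕ._+ 2) (ℕₚ.*-identityʳ n))) le)) (lemma (α.e 1))
    where lemma : ∀ x → 1ℤ ℤ.* 1ℤ ℤ.* x ℤ.+ x ℤ.* (1ℤ ℤ.* 1ℤ) ≡ + 2 ℤ.* x
          lemma = ℤSolver.solve-∀

  private
    double-fin : ∀ {τ} x → v 2 (+ 2 ℤ.* x) ≡ fin τ → ∃ λ s → v 2 x ≡ fin s × τ ≡ suc s
    double-fin {τ} x vτ with v 2 x in vx
    ... | ∞     = ⊥-elim (zero-∞ x vx vτ)
      where zero-∞ : ∀ x → v 2 x ≡ ∞ → ¬ v 2 (+ 2 ℤ.* x) ≡ fin τ
            zero-∞ (+ zero) _ ()
    ... | fin s = s , ≡.refl , ≤-antisym (upper τ vτ)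
        (v-max (+ 2 ℤ.* x) vτ (2^∣-* {1} {s} {+ 2} {x} (1ℤ 2^, ≡.refl) (v-∣ x vx)))
      where upper : ∀ τ → v 2 (+ 2 ℤ.* x) ≡ fin τ → τ ≤ suc s
            upper zero     _  = z≤n
            upper (suc τ′) vτ = s≤s (v-max x vx (2^∣-cancel 1 {τ′} (v-∣ (+ 2 ℤ.* x) vτ)))

    special-divides : ∀ {s} → v 2 (α.e 1) ≡ fin s → Special 2 As → 2 ≤ s × (∀ j → 2^ suc s ∣ α.e (suc (suc j)))
    special-divides {s} vs (As′ , lead , ≡.refl , lead> , others) = 2≤s , divides-e
      where
        d = length αs
        d≡ : suc (length As′) ≡ d
        d≡ = ≡.trans (≡.sym (length-∷ʳ As′)) α.length≡
        lead≡ : lead ≡ α.e 1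
        lead≡ = ≡.trans (≡.sym (nth-∷ʳ-length As′)) (α.nth-e (length As′) 0 (≡.trans (ℕₚ.+-comm (length As′) 1) d≡))
        v-lead : v 2 lead ≡ fin s
        v-lead = ≡.trans (cong (v 2) lead≡) vs
        2≤s : 2 ≤ s
        2≤s = ≡.subst (fin 1 <∞_) v-lead lead>
        divides-e : ∀ j → 2^ suc s ∣ α.e (suc (suc j))
        divides-e j with suc j ℕₚ.<? d
        ... | no  ge = ≡.subst (2^ suc s ∣_) (≡.sym (α.e-beyond (suc j) (≮⇒≥ ge))) (0ℤ 2^, ≡.sym (ℤₚ.*-zeroʳ (pow2 (suc s))))
        ... | yes lt = ≡.subst (2^ suc s ∣_) (≡.trans (≡.sym (nth-∷ʳ-< As′ i i<)) (α.nth-e i (suc j) i+))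
              (<v⇒∣ (nth As′ i) (≡.subst (_<∞ v 2 (nth As′ i)) v-lead (nth-all others i i<)))
          where
            i = d ∸ suc (suc j)
            i+ : i ℕ.+ suc (suc j) ≡ d
            i+ = m∸n+n≡m lt
            i< : i < length As′
            i< = ≤-trans (≤-trans (m≤m+n (suc i) j) (≤-reflexive (≡.sym (ℕₚ.+-suc i j))))
              (≤-reflexive (ℕₚ.suc-injective (≡.trans (≡.sym (ℕₚ.+-suc i (suc j))) (≡.trans i+ (≡.sym d≡)))))

  -- In the doubling range P_{m+1,n} agrees with P_{m,n}², whose lower coefficients are 2 A_j + ∑ A_i A_k.
  doubled-divides : ∀ {τ} j → n ℕ.* suc (suc j) ℕ.+ 2 ≤ 2 ℕ.* 2 ^ p → v 2 (β.e 1) ≡ fin τ → Special 2 As → 2^ suc τ ∣ β.e (suc (suc j))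
  doubled-divides {τ} j le vτ special = ≡.subst (λ τ → 2^ suc τ ∣ β.e (suc (suc j))) (≡.sym (proj₂ (proj₂ halved)))
      (≡.subst (2^ suc (suc s) ∣_) (≡.sym (≡.trans (e-convolution (suc (suc j)) le) expand))
        (2^∣-+ (2^∣-* {1} {suc s} {+ 2} (1ℤ 2^, ≡.refl) (proj₂ facts j))
          (2^∣-mono s+2≤ (conv-∣ (α.e ∘ suc) (α.e ∘ suc) e-s e-s j))))
    where
      halved : ∃ λ s → v 2 (α.e 1) ≡ fin s × τ ≡ suc s
      halved = double-fin (α.e 1) (≡.trans (cong (v 2) (≡.sym (e-doubles (≤-trans (+-monoˡ-≤ 2 (m≤m*n n (suc (suc j)))) le)))) vτ)
      s = proj₁ halved
      vs = proj₁ (proj₂ halved)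
      facts = special-divides vs special
      e-s : ∀ i → 2^ s ∣ α.e (suc i)
      e-s zero    = v-∣ (α.e 1) vs
      e-s (suc i) = 2^∣-mono (n≤1+n s) (proj₂ facts i)
      -- Here v_2 of the trace coefficient must exceed v_2(2): products of two coefficients are
      -- divisible by 2^{2s}, and 2^{s+2} is wanted.
      s+2≤ : suc (suc s) ≤ s ℕ.+ s
      s+2≤ = ≤-trans (≤-reflexive (ℕₚ.+-comm 2 s)) (+-monoʳ-≤ s (proj₁ facts))
      regroup : ∀ x y → 1ℤ ℤ.* 1ℤ ℤ.* x ℤ.+ (y ℤ.+ x ℤ.* (1ℤ ℤ.* 1ℤ)) ≡ + 2 ℤ.* x ℤ.+ y
      regroup = ℤSolver.solve-∀
      expand : conv α.e α.e (suc (suc j)) ≡ + 2 ℤ.* α.e (suc (suc j)) ℤ.+ conv (α.e ∘ suc) (α.e ∘ suc) j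
      expand = ≡.trans (cong (ℤ._+_ (α.e 0 ℤ.* α.e (suc (suc j)))) (conv-last (α.e ∘ suc) α.e j))
        (regroup (α.e (suc (suc j))) (conv (α.e ∘ suc) (α.e ∘ suc) j))

  special : ∀ t → fromℤ t ≈ trP (suc (suc (suc p))) n βs → TraceBound (suc (suc p)) n t → Special 2 As → Special 2 Bs
  special t t≈ (τ , vt , bound) specialA = conclude (initLast Bs) ≡.refl
    where
      t≡ : t ≡ pow2 n ℤ.* β.a 1
      t≡ = β.trace-a t t≈
      e1≡ : β.e 1 ≡ ℤ.- t
      e1≡ = ≡.trans β.e-1 (cong (ℤ.-_) (≡.sym t≡))
      v-e1 : v 2 (β.e 1) ≡ fin τ
      v-e1 = ≡.trans (cong (v 2) e1≡) (≡.trans (v-neg t) vt)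
      τ-trace : 2^ τ ∣ pow2 n ℤ.* powerSum (suc p) n 1
      τ-trace = ≡.subst (2^ τ ∣_) (≡.trans t≡ (cong (ℤ._*_ (pow2 n)) β.a-1)) (v-∣ t vt)
      lower : ∀ j → 2^ suc τ ∣ β.e (suc (suc j))
      lower j = by-size (n ℕ.* suc (suc j) ℕₚ.<? τ)
        where
          by-size : Dec (n ℕ.* suc (suc j) < τ) → 2^ suc τ ∣ β.e (suc (suc j))
          -- n (j + 2) ≥ τ, and the extra factor 2 in `e-divisible` makes the comparison strict.
          by-size (no  ge) = 2^∣-mono (s≤s (≮⇒≥ ge)) (β.e-divisible (suc j))
          by-size (yes lt) = doubled-divides j (doubling-range p n′ (suc (suc j)) τ (s≤s (s≤s z≤n)) lt bound τ-trace) v-e1 specialA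
      conclude : ∀ {Cs} → InitLast Cs → Cs ≡ Bs → Special 2 Bs
      -- Without roots the trace is 0, of infinite valuation, against the trace bound.
      conclude [] ≡.refl = ⊥-elim (impossible (≡.trans (cong (v 2) (≡.sym (β.e-beyond 0 (≤-reflexive (≡.sym β.length≡))))) v-e1))
        where impossible : ¬ v 2 0ℤ ≡ fin τ
              impossible ()
      conclude (Bs′ ∷ʳ′ lead) ≡.refl = Bs′ , lead , ≡.refl
          -- 2^{n+1} divides the trace coefficient and n ≥ 1, so its valuation exceeds 1 = v_2(2).
          , ≡.subst (fin 1 <∞_) (≡.sym v-lead) (v-max (β.e 1) v-e1 (2^∣-mono (s≤s (≤-trans (s≤s z≤n) (≤-reflexive (≡.sym (ℕₚ.*-identityʳ n))))) (β.e-divisible 0)))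
          , all-nth Bs′ λ i i< → ≡.subst (_<∞ v 2 (nth Bs′ i)) (≡.sym v-lead) (∣⇒<v (nth Bs′ i) (at i i<))
        where
          d≡ : suc (length Bs′) ≡ length βs
          d≡ = ≡.trans (≡.sym (length-∷ʳ Bs′)) β.length≡
          lead≡ : lead ≡ β.e 1
          lead≡ = ≡.trans (≡.sym (nth-∷ʳ-length Bs′)) (β.nth-e (length Bs′) 0 (≡.trans (ℕₚ.+-comm (length Bs′) 1) d≡))
          v-lead : v 2 lead ≡ fin τ
          v-lead = ≡.trans (cong (v 2) lead≡) v-e1
          at : ∀ i → i < length Bs′ → 2^ suc τ ∣ nth Bs′ i
          at i i< = ≡.subst (2^ suc τ ∣_) (≡.trans (≡.sym (β.nth-e i (suc j) i+)) (nth-∷ʳ-< Bs′ i i<)) (lower j)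
            where
              j = length Bs′ ∸ suc i
              i+ : i ℕ.+ suc (suc j) ≡ length βs
              i+ = ≡.trans (ℕₚ.+-suc i (suc j)) (≡.trans (cong suc (≡.trans (ℕₚ.+-suc i j) (≡.trans (cong suc (ℕₚ.+-comm i j))
                (≡.trans (≡.sym (ℕₚ.+-suc j i)) (m∸n+n≡m i<))))) d≡)

theorem4p1 : ∀ {c ℓ} (K : CommutativeRing c ℓ) → OverRing.IsField K → OverRing.CharZero K →
    (m n : ℕ) → 2 ≤ m → 1 ≤ n →
    (αs βs : List (CommutativeRing.Carrier K)) →
    OverRing.RootsOfG K m n αs → OverRing.RootsOfG K (suc m) n βs →
    (As Bs : List ℤ) →
    OverRing.IsIntPoly K As (OverRing.Pmn K m n αs) →
    OverRing.IsIntPoly K Bs (OverRing.Pmn K (suc m) n βs) →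
    (t : ℤ) → CommutativeRing._≈_ K (OverRing.fromℤ K t) (OverRing.trP K (suc m) n βs) →
    TraceBound m n t →
    Special 2 As → Special 2 Bs
theorem4p1 K field-K char-K (suc (suc p)) (suc n) (s≤s (s≤s _)) _ αs βs rootsα rootsβ As Bs intα intβ =
  Transfer.special K field-K char-K p n αs βs rootsα rootsβ As Bs intα intβ
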